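{- There is a constant $\Delta_2$ such that for every graph $G$ with maximum degree $\Delta\geq \Delta_2$, we have $\chi''_\Sigma(G)\leq \Delta+95\sqrt{\Delta}$, and, if $G$ has no isolated edges, also $\chi'_\Sigma(G)\leq \Delta+95\sqrt{\Delta}$.
   Context: All graphs are finite and simple. For a graph $G=(V,E)$ and an edge colouring $c:E\to\{1,\ldots,k\}$, the sum at a vertex $v$ is $d_c(v)=\sum_{u\in N(v)}c(uv)$. A proper edge colouring $c:E\to\{1,2,\ldots,k\}$ is neighbour sum distinguishing if $d_c(u)\neq d_c(v)$ for every edge $uv\in E$; $\chi'_\Sigma(G)$ (defined for graphs without isolated edges) is the least $k$ admitting such a colouring. For a proper total colouring $c:V\cup E\to\{1,2,\ldots,k\}$ (adjacent vertices get distinct colours, adjacent edges get distinct colours, and each vertex's colour differs from the colours of its incident edges), the total sum of $v$ is $c(v)+d_c(v)$, where $d_c(v)=\sum_{u\in N(v)}c(uv)$; $\chi''_\Sigma(G)$ is the least $k$ admitting a proper total colouring $c:V\cup E\to\{1,\ldots,k\}$ with $c(u)+d_c(u)\neq c(v)+d_c(v)$ for every edge $uv\in E$. -}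

module Defs where

open import Data.Nat using (ℕ; zero; suc; _+_; _*_; _∸_; _≤_; _⊔_)
open import Data.Bool using (Bool; true; false; if_then_else_)
open import Data.Fin using (Fin)
open import Data.List using (List; map; foldr; allFin)
open import Data.Nat.ListAction using (sum)
open import Data.Product using (_×_; Σ; ∃-syntax)
open import Relation.Binary.PropositionalEquality using (_≡_; _≢_)
open import Relation.Nullary using (¬_)

record Graph : Set where
  field
    n     : ℕ
    adj   : Fin n → Fin n → Bool
    sym   : ∀ u v → adj u v ≡ adj v u
    irref : ∀ v → adj v v ≡ false
open Graph public

Adj : (G : Graph) → Fin (n G) → Fin (n G) → Set
Adj G u v = adj G u v ≡ true

nbSum : (G : Graph) → Fin (n G) → (Fin (n G) → ℕ) → ℕ
nbSum G v f = sum (map (λ u → if adj G v u then f u else 0) (allFin (n G)))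

degree : (G : Graph) → Fin (n G) → ℕ
degree G v = nbSum G v (λ _ → 1)

maxDegree : Graph → ℕ
maxDegree G = foldr _⊔_ 0 (map (degree G) (allFin (n G)))

NoIsolatedEdges : Graph → Set
NoIsolatedEdges G = ∀ u v → Adj G u v → ¬ (degree G u ≡ 1 × degree G v ≡ 1)

-- Edge colourings are represented by a function on ordered pairs, required
-- to be symmetric on edges; values on non-edges are irrelevant.
EdgeCol : Graph → Set
EdgeCol G = Fin (n G) → Fin (n G) → ℕ

InRange : ℕ → ℕ → Set
InRange k x = 1 ≤ x × x ≤ k

dsum : (G : Graph) → EdgeCol G → Fin (n G) → ℕ
dsum G c v = nbSum G v (λ u → c v u)

IsProperEdgeColouring : (G : Graph) → ℕ → EdgeCol G → Set
IsProperEdgeColouring G k c =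
  (∀ u v → Adj G u v → c u v ≡ c v u) ×
  (∀ u v → Adj G u v → InRange k (c u v)) ×
  (∀ u v w → Adj G u v → Adj G u w → v ≢ w → c u v ≢ c u w)

IsNSDEdgeColouring : (G : Graph) → ℕ → EdgeCol G → Set
IsNSDEdgeColouring G k c =
  IsProperEdgeColouring G k c ×
  (∀ u v → Adj G u v → dsum G c u ≢ dsum G c v)

IsProperTotalColouring : (G : Graph) → ℕ → (Fin (n G) → ℕ) → EdgeCol G → Set
IsProperTotalColouring G k cv c =
  IsProperEdgeColouring G k c ×
  (∀ v → InRange k (cv v)) ×
  (∀ u v → Adj G u v → cv u ≢ cv v) ×
  (∀ u v → Adj G u v → cv u ≢ c u v)

IsNSDTotalColouring : (G : Graph) → ℕ → (Fin (n G) → ℕ) → EdgeCol G → Set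
IsNSDTotalColouring G k cv c =
  IsProperTotalColouring G k cv c ×
  (∀ u v → Adj G u v → cv u + dsum G c u ≢ cv v + dsum G c v)

-- χ'_Σ(G) ≤ B  iff some k ≤ B admits an NSD edge colouring with colours 1..k.
-- Bound B = Δ + 95√Δ: for natural k, k ≤ Δ + 95√Δ ⇔ (k ∸ Δ)² ≤ 9025·Δ.
BelowBound : ℕ → ℕ → Set
BelowBound Δ k = (k ∸ Δ) * (k ∸ Δ) ≤ 9025 * Δ

χ'Σ≤Bound : Graph → ℕ → Set
χ'Σ≤Bound G Δ = ∃[ k ] (BelowBound Δ k × Σ (EdgeCol G) (IsNSDEdgeColouring G k))

χ''Σ≤Bound : Graph → ℕ → Set
χ''Σ≤Bound G Δ = ∃[ k ] (BelowBound Δ k ×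
  Σ (Fin (n G) → ℕ) λ cv → Σ (EdgeCol G) (IsNSDTotalColouring G k cv))

{-# OPTIONS --safe #-}

-- Let D = ⌈√Δ⌉ and let d(v) be the degree of v. Outside a subgraph H of maximum degree O(D), about Δ + 7D
-- colours suffice even for a total colouring: sort the edges at each vertex by the class (vertex colours being
-- divided into D + 1 classes) of their other end, cut them into blocks of D, and apply Vizing's theorem to the
-- graph split along the blocks. This distributes the edges over D + 1 groups, each with its own small palette,
-- in such a way that a vertex has only O(D) edges whose group coincides with the class of one of the ends.
--
-- The colours of the edges of H can be shifted by ±1 or by ±M, where M ≈ 2D. The vertices v with d(v) ≥ 14D are
-- processed by increasing degree, and v shifts edges of H that it owns, the direction being dictated by the sum
-- at the other end, which is thereby kept in its cell of four sums. So only the cell of v changes. Owning m edges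
-- of each kind, v can choose among (m + 1)² sums, while its b(v) earlier neighbours exclude at most 4 b(v) sums.
--
-- It remains to let v own about 2√b(v) edges of each kind. If 4 b(v) D² < d(v)², every D-th edge at v suffices.
-- Otherwise v takes one in p ≈ √(b(v)/5) of the edges to its earlier neighbours, where 6 D p ≥ d(v). Since an
-- earlier neighbour u has d(u) ≤ d(v), at most about 6D edges at u are taken this way. König's theorem on a split
-- bipartite graph realises these selections exactly.
--
-- The edges between vertices of degree below 14D are coloured greedily at the end, each colour avoiding all
-- equalities of sums at its two ends. Such an edge which is not adjacent to another one gets its two ends
-- separated beforehand, by a shift in H or by the colour of an adjacent edge.
module Submission where

open import Defs hiding (sym; n)
open import Data.Nat
open import Data.Nat.Properties
open import Data.Nat.DivMod
open import Data.Nat.Divisibility using (divides; divides-refl)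
open import Data.Nat.Solver using (module +-*-Solver)
open import Data.Bool using (Bool; true; false; not; if_then_else_)
import Data.Bool.Properties as Bool
open import Data.Fin using (Fin; zero; suc; toℕ; fromℕ<; combine; remQuot)
import Data.Fin.Properties as Fin
open import Data.Fin.Properties using (toℕ<n; toℕ-injective; toℕ-fromℕ<; any?; all?; pigeonhole)
open import Data.List as List using (List; []; _∷_; _++_; length; map; allFin)
open import Data.List.Membership.Propositional using (_∈_; _∉_)
open import Data.List.Relation.Unary.Any using (here; there; index)
open import Data.Product using (Σ; ∃; ∃-syntax; _×_; _,_; proj₁; proj₂; uncurry)
open import Data.Sum using (_⊎_; inj₁; inj₂; [_,_]′)
open import Data.Empty using (⊥; ⊥-elim)
open import Data.Unit using (tt)
open import Data.Maybe using (Maybe; just; nothing)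
open import Data.Maybe.Properties using (just-injective)
open import Function using (_∘_; id; case_of_)
open import Relation.Nullary using (¬_; Dec; yes; no; contradiction)
open import Relation.Nullary.Decidable using (_×-dec_; _⊎-dec_; _→-dec_; ¬?; map′; decidable-stable)
open import Relation.Unary using (Decidable)
open import Relation.Binary.Definitions using (Tri; tri<; tri≈; tri>)
open import Relation.Binary.PropositionalEquality
open import Algebra.Properties.CommutativeMonoid.Sum +-0-commutativeMonoid
  using (sum; sum-cong-≗; ∑-distrib-+; ∑-comm)
import Data.List.Membership.DecPropositional as DecMem
import Data.List.Relation.Unary.Any.Properties as Any
open import Data.List.Membership.Propositional.Properties
  using (∈-allFin; ∈-cartesianProduct⁺; ∈-map⁺; ∈-++⁺ˡ; ∈-++⁺ʳ)
open import Data.List.Properties using (length-map; length-++; map-tabulate)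
import Data.Nat.ListAction as ListAction

-- The obstacle is that up to 4Δ sums have to be dodged, while a vertex can own only O(√Δ) edges of
-- `H` and shifts of a single size would yield only O(√Δ) sums. Two step sizes behave like two
-- digits: i unit shifts and j shifts by M reach different sums for different pairs (i, j) as long
-- as i stays below M. A shift also moves the sum at the other end. Write M = 2m and read a sum as
-- 2(r + qm) + β with β < 2 and r < m. A unit shift whose sign is dictated by β can only flip β, and
-- a shift by M whose sign is dictated by the parity of q stays within one pair of values of q.
-- Hence the four members of a cell, and hence the need to avoid earlier neighbours cell by cell:
-- their sums may still move later, but only inside their cells. Since it is not known in advance
-- which shifts will be made, the colouring must stay proper under all of them. Each base colour of
-- `H` therefore receives a private progression of layers: three if only one end may alter the edge,
-- five if both may. Most of the constant comes from these layers.

-- Counting and summation over finite sets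

bit : {A : Set} → Dec A → ℕ
bit (yes _) = 1
bit (no _)  = 0

ifDec : {A : Set} {B : Set} → Dec A → B → B → B
ifDec (yes _) x _ = x
ifDec (no _)  _ y = y

ifDec-yes : {A : Set} {B : Set} (d : Dec A) {x y : B} → A → ifDec d x y ≡ x
ifDec-yes (yes _) _ = refl
ifDec-yes (no ¬a) a = contradiction a ¬a

ifDec-no : {A : Set} {B : Set} (d : Dec A) {x y : B} → ¬ A → ifDec d x y ≡ y
ifDec-no (yes a) ¬a = contradiction a ¬a
ifDec-no (no _)  _  = refl

bit≤1 : {A : Set} (a? : Dec A) → bit a? ≤ 1
bit≤1 (yes _) = ≤-refl
bit≤1 (no _)  = z≤n

bit-yes : {A : Set} (a? : Dec A) → A → bit a? ≡ 1
bit-yes (yes _) _ = refl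
bit-yes (no ¬a) a = contradiction a ¬a

bit-no : {A : Set} (a? : Dec A) → ¬ A → bit a? ≡ 0
bit-no (yes a) ¬a = contradiction a ¬a
bit-no (no _)  _  = refl

bit-mono : {A B : Set} (a? : Dec A) (b? : Dec B) → (A → B) → bit a? ≤ bit b?
bit-mono (no _)  _       _ = z≤n
bit-mono (yes _) (yes _) _ = ≤-refl
bit-mono (yes a) (no ¬b) f = contradiction (f a) ¬b

bit-cong : {A B : Set} (a? : Dec A) (b? : Dec B) → (A → B) → (B → A) → bit a? ≡ bit b?
bit-cong a? b? f g = ≤-antisym (bit-mono a? b? f) (bit-mono b? a? g)

sum-mono : ∀ {n} {f g : Fin n → ℕ} → (∀ i → f i ≤ g i) → sum f ≤ sum g
sum-mono {zero}  _ = z≤n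
sum-mono {suc n} h = +-mono-≤ (h zero) (sum-mono (h ∘ suc))

sum-bound : ∀ {n} {f : Fin n → ℕ} {h} → (∀ i → f i ≤ h) → sum f ≤ n * h
sum-bound {zero}  _ = z≤n
sum-bound {suc n} p = +-mono-≤ (p zero) (sum-bound (p ∘ suc))

sum-* : ∀ {n} (c : ℕ) (f : Fin n → ℕ) → sum (λ i → c * f i) ≡ c * sum f
sum-* {zero}  c f = sym (*-zeroʳ c)
sum-* {suc n} c f = trans (cong (c * f zero +_) (sum-* c (f ∘ suc))) (sym (*-distribˡ-+ c (f zero) _))

sum-zero : ∀ {n} {f : Fin n → ℕ} → (∀ i → f i ≡ 0) → sum f ≡ 0
sum-zero {zero}  _ = refl
sum-zero {suc n} h = cong₂ _+_ (h zero) (sum-zero (h ∘ suc))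

sum-one : ∀ {n} (f : Fin n → ℕ) j → (∀ i → i ≢ j → f i ≡ 0) → sum f ≡ f j
sum-one f zero    h = trans (cong (f zero +_) (sum-zero (λ i → h (suc i) λ ()))) (+-identityʳ _)
sum-one f (suc j) h = cong₂ _+_ (h zero λ ()) (sum-one (f ∘ suc) j (λ i i≢j → h (suc i) (i≢j ∘ Fin.suc-injective)))

-- The change at `j` may go either way, so the terms at `j` are added crosswise instead of being
-- subtracted.
sum-two : ∀ {n} (f g : Fin n → ℕ) j → (∀ i → i ≢ j → f i ≡ g i) → sum f + g j ≡ sum g + f j
sum-two f g zero h rewrite sum-cong-≗ {x = f ∘ suc} {y = g ∘ suc} (λ i → h (suc i) λ ()) =
  solve 3 (λ a b c → (a :+ b) :+ c := (c :+ b) :+ a) refl (f zero) (sum (g ∘ suc)) (g zero)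
  where open +-*-Solver
sum-two f g (suc j) h rewrite h zero (λ ()) =
  trans (+-assoc (g zero) _ _) (trans (cong (g zero +_)
    (sum-two (f ∘ suc) (g ∘ suc) j (λ i i≢j → h (suc i) (i≢j ∘ Fin.suc-injective)))) (sym (+-assoc (g zero) _ _)))

abstract
  cnt : ∀ {n} {P : Fin n → Set} → Decidable P → ℕ
  cnt P? = sum (λ i → bit (P? i))

  cnt-sum : ∀ {n} {P : Fin n → Set} (P? : Decidable P) → cnt P? ≡ sum (λ i → bit (P? i))
  cnt-sum P? = refl

  cnt-mono : ∀ {n} {P Q : Fin n → Set} (P? : Decidable P) (Q? : Decidable Q) → (∀ i → P i → Q i) → cnt P? ≤ cnt Q?
  cnt-mono P? Q? h = sum-mono (λ i → bit-mono (P? i) (Q? i) (h i))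

  cnt-cong : ∀ {n} {P Q : Fin n → Set} (P? : Decidable P) (Q? : Decidable Q) → (∀ i → P i → Q i) → (∀ i → Q i → P i) → cnt P? ≡ cnt Q?
  cnt-cong P? Q? f g = sum-cong-≗ (λ i → bit-cong (P? i) (Q? i) (f i) (g i))

  cnt-split : ∀ {n} {P Q : Fin n → Set} (P? : Decidable P) (Q? : Decidable Q) → cnt P? ≡ cnt (λ i → P? i ×-dec Q? i) + cnt (λ i → P? i ×-dec ¬? (Q? i))
  cnt-split P? Q? = trans (sum-cong-≗ split) (∑-distrib-+ (λ i → bit (P? i ×-dec Q? i)) (λ i → bit (P? i ×-dec ¬? (Q? i))))
    where
    split : ∀ i → bit (P? i) ≡ bit (P? i ×-dec Q? i) + bit (P? i ×-dec ¬? (Q? i))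
    split i with P? i | Q? i
    ... | yes _ | yes _ = refl
    ... | yes _ | no _  = refl
    ... | no _  | yes _ = refl
    ... | no _  | no _  = refl

  cnt-⊎ : ∀ {n} {P Q : Fin n → Set} (P? : Decidable P) (Q? : Decidable Q) → cnt (λ i → P? i ⊎-dec Q? i) ≤ cnt P? + cnt Q?
  cnt-⊎ P? Q? = ≤-trans (sum-mono or) (≤-reflexive (∑-distrib-+ (λ i → bit (P? i)) (λ i → bit (Q? i))))
    where
    or : ∀ i → bit (P? i ⊎-dec Q? i) ≤ bit (P? i) + bit (Q? i)
    or i with P? i | Q? i
    ... | yes _ | yes _ = s≤s z≤n
    ... | yes _ | no _  = ≤-refl
    ... | no _  | yes _ = ≤-refl
    ... | no _  | no _  = ≤-refl

  cnt-none : ∀ {n} {P : Fin n → Set} (P? : Decidable P) → (∀ i → ¬ P i) → cnt P? ≡ 0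
  cnt-none P? h = sum-zero (λ i → bit-no (P? i) (h i))

  cnt-all : ∀ {n} {P : Fin n → Set} (P? : Decidable P) → (∀ i → P i) → cnt P? ≡ n
  cnt-all {zero}  P? h = refl
  cnt-all {suc n} P? h = cong₂ _+_ (bit-yes (P? zero) (h zero)) (cnt-all (P? ∘ suc) (h ∘ suc))

  cnt-remove : ∀ {n} {Q : Fin n → Set} (Q? : Decidable Q) j → Q j →
               cnt Q? ≡ suc (cnt (λ i → Q? i ×-dec ¬? (i Fin.≟ j)))
  cnt-remove Q? zero q = trans
    (cong₂ _+_ (bit-yes (Q? zero) q)
      (cnt-cong (Q? ∘ suc) (λ i → Q? (suc i) ×-dec ¬? (suc i Fin.≟ zero)) (λ i x → x , λ ()) (λ i → proj₁)))
    (cong (λ z → suc (z + cnt (λ i → Q? (suc i) ×-dec ¬? (suc i Fin.≟ zero))))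
      (sym (bit-no (Q? zero ×-dec ¬? (zero Fin.≟ zero)) (λ z → proj₂ z refl))))
  cnt-remove Q? (suc j) q = trans
    (cong₂ _+_ (bit-cong (Q? zero) (Q? zero ×-dec ¬? (zero Fin.≟ suc j)) (λ x → x , λ ()) proj₁)
      (trans (cnt-remove (Q? ∘ suc) j q)
        (cong suc (cnt-cong (λ i → Q? (suc i) ×-dec ¬? (i Fin.≟ j)) (λ i → Q? (suc i) ×-dec ¬? (suc i Fin.≟ suc j))
              (λ i (a , b) → a , (b ∘ Fin.suc-injective)) (λ i (a , b) → a , (b ∘ cong suc))))))
    (+-suc _ _)

  cnt-inj : ∀ {m n} {P : Fin m → Set} {Q : Fin n → Set} (P? : Decidable P) (Q? : Decidable Q)
            (f : Fin m → Fin n) → (∀ i → P i → Q (f i)) →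
            (∀ i j → P i → P j → f i ≡ f j → i ≡ j) → cnt P? ≤ cnt Q?
  cnt-inj {zero}  P? Q? f _ _ = z≤n
  cnt-inj {suc m} P? Q? f h inj with P? zero
  ... | no _  = cnt-inj (P? ∘ suc) Q? (f ∘ suc) (h ∘ suc)
                  (λ i j p q e → Fin.suc-injective (inj (suc i) (suc j) p q e))
  ... | yes p = subst (_ ≤_) (sym (cnt-remove Q? (f zero) (h zero p)))
                  (s≤s (cnt-inj (P? ∘ suc) (λ i → Q? i ×-dec ¬? (i Fin.≟ f zero)) (f ∘ suc)
                    (λ i q → h (suc i) q , λ e → case inj (suc i) zero q p e of λ ())
                    (λ i j p q e → Fin.suc-injective (inj (suc i) (suc j) p q e))))

  -- The common form of the degree and load estimates: the neighbours counted carry distinct labels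
  -- below `q`, often a pair (colour, block) coded as one number.
  cnt-bound : ∀ {m} {P : Fin m → Set} (P? : Decidable P) (f : Fin m → ℕ) q → (∀ i → P i → f i < q) →
              (∀ i j → P i → P j → f i ≡ f j → i ≡ j) → cnt P? ≤ q
  cnt-bound P? f zero    h inj = ≤-reflexive (cnt-none P? (λ i p → case h i p of λ ()))
  cnt-bound {m} {P} P? f (suc q) h inj =
    subst (cnt P? ≤_) (cnt-all (λ _ → yes tt) (λ _ → tt)) (cnt-inj P? (λ _ → yes tt) g (λ _ _ → tt) g-inj)
    where
    g : Fin m → Fin (suc q)
    g i with f i <? suc q
    ... | yes p = fromℕ< p
    ... | no _  = zero
    g-val : ∀ i → P i → toℕ (g i) ≡ f i
    g-val i p with f i <? suc q
    ... | yes x = toℕ-fromℕ< x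
    ... | no ¬x = contradiction (h i p) ¬x
    g-inj : ∀ i j → P i → P j → g i ≡ g j → i ≡ j
    g-inj i j p q e = inj i j p q (trans (sym (g-val i p)) (trans (cong toℕ e) (g-val j q)))

  cnt<-witness : ∀ {n} {P Q : Fin n → Set} (P? : Decidable P) (Q? : Decidable Q) j →
                 (∀ i → P i → Q i) → Q j → ¬ P j → cnt P? < cnt Q?
  cnt<-witness P? Q? j h q ¬p = subst (suc (cnt P?) ≤_) (sym (cnt-remove Q? j q))
    (s≤s (cnt-mono P? _ (λ i p → h i p , λ e → ¬p (subst _ e p))))

  cnt-fibre : ∀ {n} {P : Fin n → Set} (P? : Decidable P) (f : Fin n → ℕ) k → (∀ i → P i → f i < k) →
              cnt P? ≡ sum {k} (λ χ → cnt (λ i → P? i ×-dec (f i ≟ toℕ χ)))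
  cnt-fibre P? f k h = trans (sum-cong-≗ inner) (∑-comm (λ i (χ : Fin k) → bit (P? i ×-dec (f i ≟ toℕ χ))))
    where
    inner : ∀ i → bit (P? i) ≡ sum {k} (λ χ → bit (P? i ×-dec (f i ≟ toℕ χ)))
    inner i = case P? i of λ where
      (no ¬p) → trans (bit-no (P? i) ¬p)
                  (sym (sum-zero {k} (λ χ → bit-no (P? i ×-dec (f i ≟ toℕ χ)) (¬p ∘ proj₁))))
      (yes p) → let j = fromℕ< (h i p); e = toℕ-fromℕ< (h i p) in
        trans (bit-yes (P? i) p) (sym (trans
          (sum-one (λ χ → bit (P? i ×-dec (f i ≟ toℕ χ))) j
            (λ χ χ≢j → bit-no (P? i ×-dec (f i ≟ toℕ χ)) (λ (_ , q) → χ≢j (toℕ-injective (trans (sym q) (sym e))))))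
          (bit-yes (P? i ×-dec (f i ≟ toℕ j)) (p , sym e))))

cnt≤n : ∀ {n} {P : Fin n → Set} (P? : Decidable P) → cnt P? ≤ n
cnt≤n P? = subst (cnt P? ≤_) (cnt-all (λ _ → yes tt) (λ _ → tt)) (cnt-mono P? (λ _ → yes tt) (λ _ _ → tt))

-- If every `f i` were in `F`, its position there would inject `Fin m` into a shorter list.
avoid : ∀ {m} (f : Fin m → ℕ) → (∀ i j → f i ≡ f j → i ≡ j) → (F : List ℕ) → length F < m → ∃[ i ] f i ∉ F
avoid {m} f inj F lt = decidable-stable (any? (λ i → ¬? (f i ∈? F))) λ none →
  let mem : ∀ i → f i ∈ F
      mem i = decidable-stable (f i ∈? F) (λ z → none (i , z))
      i , j , i<j , e = pigeonhole lt (index ∘ mem)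
  in <⇒≢ i<j (cong toℕ (inj i j (same (mem i) (mem j) e)))
  where
  open DecMem _≟_ using (_∈?_)
  same : ∀ {x y : ℕ} {G} (p : x ∈ G) (q : y ∈ G) → index p ≡ index q → x ≡ y
  same {G = G} p q e = trans (Any.lookup-index p) (trans (cong (List.lookup G) e) (sym (Any.lookup-index q)))

-- Ranks and blocks of consecutive elements

module Rank {n} {P : Fin n → Set} (P? : Decidable P) (κ : Fin n → ℕ) (κ-inj : ∀ u w → κ u ≡ κ w → u ≡ w) where

  abstract
    rank : Fin n → ℕ
    rank u = cnt (λ w → P? w ×-dec (κ w <? κ u))

    rank-mono : ∀ {u w} → P u → κ u < κ w → rank u < rank w
    rank-mono {u} {w} p lt = cnt<-witness (λ x → P? x ×-dec (κ x <? κ u)) (λ x → P? x ×-dec (κ x <? κ w)) u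
      (λ x (a , b) → a , <-trans b lt) (p , lt) (λ (_ , b) → <-irrefl refl b)

    rank<cnt : ∀ {u} → P u → rank u < cnt P?
    rank<cnt {u} p = cnt<-witness (λ x → P? x ×-dec (κ x <? κ u)) P? u (λ x → proj₁) p (λ (_ , b) → <-irrefl refl b)

    rank-inj : ∀ {u w} → P u → P w → rank u ≡ rank w → u ≡ w
    rank-inj {u} {w} p q e with <-cmp (κ u) (κ w)

    ... | tri< a _ _ = contradiction e (<⇒≢ (rank-mono p a))
    ... | tri≈ _ b _ = κ-inj u w b
    ... | tri> _ _ c = contradiction (sym e) (<⇒≢ (rank-mono q c))

    cnt-rank≥ : ∀ m → m ≤ cnt P? → m ≤ cnt (λ u → P? u ×-dec (rank u <? m))
    cnt-rank≥ m le = +-cancelʳ-≤ (cnt P? ∸ m) m _ (begin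
      m + (cnt P? ∸ m) ≡⟨ m+[n∸m]≡n le ⟩
      cnt P? ≡⟨ cnt-split P? (λ u → rank u <? m) ⟩
      -- The remaining elements have distinct ranks from `m` up to below `cnt P?`.
      low + cnt (λ u → P? u ×-dec ¬? (rank u <? m)) ≤⟨ +-monoʳ-≤ low (cnt-bound _ (λ u → rank u ∸ m) (cnt P? ∸ m)
          (λ u (p , q) → ∸-monoˡ-< (rank<cnt p) (≮⇒≥ q))
          (λ u w (p , q) (p′ , q′) e → rank-inj p p′ (∸-cancelʳ-≡ (≮⇒≥ q) (≮⇒≥ q′) e))) ⟩
      low + (cnt P? ∸ m) ∎)
      where
      open ≤-Reasoning
      low : ℕ
      low = cnt (λ u → P? u ×-dec (rank u <? m))

    cnt-rank≤ : ∀ m → cnt (λ u → P? u ×-dec (rank u <? m)) ≤ m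
    cnt-rank≤ m = cnt-bound _ rank m (λ u → proj₂) (λ u w (p , _) (p′ , _) → rank-inj p p′)

    block-≤ : ∀ q .{{_ : NonZero q}} j → cnt (λ u → P? u ×-dec (rank u / q ≟ j)) ≤ q
    block-≤ q j = cnt-bound _ (λ u → rank u % q) q (λ u _ → m%n<n (rank u) q)
      (λ u w (p , e) (p′ , e′) s → rank-inj p p′
        (trans (m≡m%n+[m/n]*n (rank u) q) (trans (cong₂ _+_ s (cong (_* q) (trans e (sym e′))))
          (sym (m≡m%n+[m/n]*n (rank w) q)))))

    rank-bound : ∀ {Q : Fin n → Set} (Q? : Decidable Q) {u} → (∀ w → P w → κ w < κ u → Q w) → rank u ≤ cnt Q?
    rank-bound Q? {u} h = cnt-mono (λ w → P? w ×-dec (κ w <? κ u)) Q? (λ w (a , b) → h w a b)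

    rank≤n : ∀ u → rank u ≤ n
    rank≤n u = cnt≤n (λ w → P? w ×-dec (κ w <? κ u))

-- Partial edge colourings, Kempe chains, and the theorems of Vizing and König

module PartialColouring {n k : ℕ} (E : Fin n → Fin n → Set)
                        (E-sym : ∀ {x y} → E x y → E y x) (E-irr : ∀ {x} → ¬ E x x) where

  -- A partial proper edge colouring, stored as one matching per colour.
  record PC : Set where
    field
      N    : Fin k → Fin n → Maybe (Fin n)
      inv  : ∀ {a x y} → N a x ≡ just y → N a y ≡ just x
      sub  : ∀ {a x y} → N a x ≡ just y → E x y
      uniq : ∀ {a b x y} → N a x ≡ just y → N b x ≡ just y → a ≡ b
  open PC

  Coloured : PC → Fin n → Fin n → Set
  Coloured C x y = ∃[ a ] N C a x ≡ just y

  _⊑_ : PC → PC → Set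
  C ⊑ C′ = ∀ {x y} → Coloured C x y → Coloured C′ x y

  nothing≢just : ∀ {A : Set} {m : Maybe A} {y} → m ≡ nothing → m ≡ just y → ⊥
  nothing≢just refl ()

  -- A whole matching is exchanged at once. By `M-new`, an edge of `M` may have had a colour before
  -- only if that colour was `α`, so no edge ends up with two colours.
  module Replace (C : PC) (α : Fin k) (M : Fin n → Maybe (Fin n))
    (M-inv : ∀ {x y} → M x ≡ just y → M y ≡ just x) (M-sub : ∀ {x y} → M x ≡ just y → E x y)
    (M-new : ∀ {x y b} → M x ≡ just y → N C b x ≡ just y → b ≡ α) where

    N′ : Fin k → Fin n → Maybe (Fin n)
    N′ a x = ifDec (a Fin.≟ α) (M x) (N C a x)

    at : ∀ x → N′ α x ≡ M x
    at x = ifDec-yes (α Fin.≟ α) refl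

    other : ∀ {a} → a ≢ α → ∀ x → N′ a x ≡ N C a x
    other {a} a≢α x = ifDec-no (a Fin.≟ α) a≢α

    replaced : PC
    replaced .N = N′
    replaced .inv {a} e with a Fin.≟ α
    ... | yes _ = M-inv e
    ... | no _  = inv C e
    replaced .sub {a} e with a Fin.≟ α
    ... | yes _ = M-sub e
    ... | no _  = sub C e
    replaced .uniq {a} {b} e f with a Fin.≟ α | b Fin.≟ α
    ... | yes p | yes q = trans p (sym q)
    ... | yes p | no _  = trans p (sym (M-new e f))
    ... | no _  | yes q = trans (M-new f e) (sym q)
    ... | no _  | no _  = uniq C e f

  abstract
    add-edge : ∀ C {α x y} → N C α x ≡ nothing → N C α y ≡ nothing → E x y → ¬ Coloured C x y →
               Σ PC λ C′ → C ⊑ C′ × N C′ α x ≡ just y × (∀ a → a ≢ α → ∀ v → N C′ a v ≡ N C a v)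
    add-edge C {α} {x} {y} αx αy exy ¬c = replaced , ext , trans (at x) Mx , (λ a → other)
      where
      M : Fin n → Maybe (Fin n)
      M v = ifDec (v Fin.≟ x) (just y) (ifDec (v Fin.≟ y) (just x) (N C α v))
      Mx : M x ≡ just y
      Mx = ifDec-yes (x Fin.≟ x) refl
      My : M y ≡ just x
      My = trans (ifDec-no (y Fin.≟ x) (λ { refl → E-irr exy })) (ifDec-yes (y Fin.≟ y) refl)
      data View (v : Fin n) : Set where
        is-x : v ≡ x → View v
        is-y : v ≡ y → View v
        else : M v ≡ N C α v → View v
      view : ∀ v → View v
      view v with v Fin.≟ x | v Fin.≟ y
      ... | yes e | _ = is-x e
      ... | no _ | yes e = is-y e
      ... | no f | no g = else (trans (ifDec-no (v Fin.≟ x) f) (ifDec-no (v Fin.≟ y) g))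
      M-inv : ∀ {u v} → M u ≡ just v → M v ≡ just u
      M-inv {u} {v} e with view u
      ... | is-x refl = trans (cong M (just-injective (trans (sym e) Mx))) My
      ... | is-y refl = trans (cong M (just-injective (trans (sym e) My))) Mx
      ... | else s with view v
      ...   | is-x refl = ⊥-elim (nothing≢just αx (inv C (trans (sym s) e)))
      ...   | is-y refl = ⊥-elim (nothing≢just αy (inv C (trans (sym s) e)))
      ...   | else t = trans t (inv C (trans (sym s) e))
      M-sub : ∀ {u v} → M u ≡ just v → E u v
      M-sub {u} e with view u
      ... | is-x refl = subst (E x) (just-injective (trans (sym Mx) e)) exy
      ... | is-y refl = subst (E y) (just-injective (trans (sym My) e)) (E-sym exy)
      ... | else s = sub C (trans (sym s) e)
      M-new : ∀ {u v b} → M u ≡ just v → N C b u ≡ just v → b ≡ α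
      M-new {u} {v} {b} e f with view u
      ... | is-x refl = contradiction (b , trans f (trans (sym e) Mx)) ¬c
      ... | is-y refl = contradiction (b , inv C (trans f (trans (sym e) My))) ¬c
      ... | else s = uniq C f (trans (sym s) e)
      open Replace C α M M-inv M-sub M-new
      ext : C ⊑ replaced
      ext {u} {v} (a , e) with a Fin.≟ α
      ... | no ¬p = a , trans (other ¬p u) e
      ... | yes refl with view u
      ...   | is-x refl = ⊥-elim (nothing≢just αx e)
      ...   | is-y refl = ⊥-elim (nothing≢just αy e)
      ...   | else s = α , trans (at u) (trans s e)

    remove-edge : ∀ C {β x y} → N C β x ≡ just y →
      Σ PC λ C′ → (∀ a → a ≢ β → ∀ v → N C′ a v ≡ N C a v) ×
        N C′ β x ≡ nothing × N C′ β y ≡ nothing × (∀ v → N C β v ≡ nothing → N C′ β v ≡ nothing) ×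
        (∀ u v → Coloured C u v → Coloured C′ u v ⊎ (u ≡ x × v ≡ y) ⊎ (u ≡ y × v ≡ x))
    remove-edge C {β} {x} {y} βx =
      replaced , (λ a → other) , trans (at x) Mx , trans (at y) My , (λ v e → trans (at v) (Mn e)) , keep
      where
      M : Fin n → Maybe (Fin n)
      M v = ifDec (v Fin.≟ x) nothing (ifDec (v Fin.≟ y) nothing (N C β v))
      Mk : ∀ {u} → u ≢ x → u ≢ y → M u ≡ N C β u
      Mk {u} f g = trans (ifDec-no (u Fin.≟ x) f) (ifDec-no (u Fin.≟ y) g)
      Mx : M x ≡ nothing
      Mx = ifDec-yes (x Fin.≟ x) refl
      My : M y ≡ nothing
      My with y Fin.≟ x
      ... | yes _ = refl
      ... | no _  = ifDec-yes (y Fin.≟ y) refl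
      Mj : ∀ {u v} → M u ≡ just v → u ≢ x × u ≢ y × N C β u ≡ just v
      Mj {u} e with u Fin.≟ x | u Fin.≟ y
      Mj () | yes _ | _
      Mj () | no _ | yes _
      ... | no f | no g = f , g , e
      Mn : ∀ {v} → N C β v ≡ nothing → M v ≡ nothing
      Mn {v} e with v Fin.≟ x | v Fin.≟ y
      ... | yes _ | _ = refl
      ... | no _ | yes _ = refl
      ... | no _ | no _ = e
      M-inv : ∀ {u v} → M u ≡ just v → M v ≡ just u
      M-inv {u} {v} e = let f , g , h = Mj e in
        trans (Mk (λ { refl → g (just-injective (trans (sym (inv C h)) βx)) })
                  (λ { refl → f (just-injective (trans (sym (inv C h)) (inv C βx))) })) (inv C h)
      open Replace C β M M-inv (λ e → sub C (proj₂ (proj₂ (Mj e)))) (λ e f → uniq C f (proj₂ (proj₂ (Mj e))))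
      keep : ∀ u v → Coloured C u v → Coloured replaced u v ⊎ (u ≡ x × v ≡ y) ⊎ (u ≡ y × v ≡ x)
      keep u v (a , e) = go (a Fin.≟ β) (u Fin.≟ x) (u Fin.≟ y)
        where
        go : Dec (a ≡ β) → Dec (u ≡ x) → Dec (u ≡ y) → Coloured replaced u v ⊎ (u ≡ x × v ≡ y) ⊎ (u ≡ y × v ≡ x)
        go (no ¬p) _ _ = inj₁ (a , trans (other ¬p u) e)
        go (yes refl) (yes refl) _ = inj₂ (inj₁ (refl , just-injective (trans (sym e) βx)))
        go (yes refl) (no _) (yes refl) = inj₂ (inj₂ (refl , just-injective (trans (sym e) (inv C βx))))
        go (yes refl) (no f) (no g) = inj₁ (β , trans (at u) (trans (Mk f g) e))

  Solved : PC → Fin n → Fin n → Set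
  Solved C x y = Σ PC λ C′ → C ⊑ C′ × Coloured C′ x y

  -- A fan at x: consecutive vertices y, y′ where the edge xy′ has a colour missing at y.
  data Path (C : PC) (x y₀ : Fin n) : List (Fin k) → Fin n → Set where
    []   : Path C x y₀ [] y₀
    snoc : ∀ {bs y β y′} → Path C x y₀ bs y → N C β y ≡ nothing → N C β x ≡ just y′ → β ∉ bs →
           Path C x y₀ (β ∷ bs) y′

  path-present : ∀ {C x y₀ bs y b} → Path C x y₀ bs y → b ∈ bs → ∃[ z ] N C b x ≡ just z
  path-present (snoc _ _ e _) (here refl) = _ , e
  path-present (snoc p _ _ _) (there i)   = path-present p i

  path-transport : ∀ {C C′ x y₀ bs y} → (∀ {b} → b ∈ bs → ∀ v → N C′ b v ≡ N C b v) →
                   Path C x y₀ bs y → Path C′ x y₀ bs y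
  path-transport h [] = []
  path-transport h (snoc p m e f) =
    snoc (path-transport (h ∘ there) p) (trans (h (here refl) _) m) (trans (h (here refl) _) e) f

  -- The fan is rotated from its far end. Once the last edge changes from `β` to `α`, the colour `β`
  -- is free at `x`, and it was missing at the previous fan vertex already; so the shorter fan is in
  -- the same situation with `β` in the role of `α`. Its own colours are untouched, as they contain
  -- neither `β` nor `α`.
  shift : ∀ bs {C x y₀ y α} → Path C x y₀ bs y → N C α x ≡ nothing → N C α y ≡ nothing →
          E x y₀ → ¬ Coloured C x y₀ → Solved C x y₀
  shift [] {C} {α = α} [] αx αy e ¬c = let C′ , ext , c , _ = add-edge C αx αy e ¬c in C′ , ext , (α , c)
  shift (β ∷ bs) {C} {x} {y₀} {y′} {α} (snoc {y = y} p βy βx β∉) αx αy′ e ¬c =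
    let C₃ , ext₃ , c₃ = shift bs {C₂} {x} {y₀} {y} {β} (path-transport {C} {C₂} same p) βx₂ βy₂ e ¬c₂ in C₃ , (λ c → ext₃ (ext₂′ c)) , c₃
    where
    α≢β : α ≢ β
    α≢β refl = nothing≢just αx βx
    R = remove-edge C βx
    C₁ : PC
    C₁ = proj₁ R
    same₁ : ∀ a → a ≢ β → ∀ v → N C₁ a v ≡ N C a v
    same₁ = proj₁ (proj₂ R)
    βx₁ : N C₁ β x ≡ nothing
    βx₁ = proj₁ (proj₂ (proj₂ R))
    keepn = proj₁ (proj₂ (proj₂ (proj₂ (proj₂ R))))
    keep = proj₂ (proj₂ (proj₂ (proj₂ (proj₂ R))))
    ¬c₁ : ¬ Coloured C₁ x y′
    ¬c₁ (a , f) = go (a Fin.≟ β)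
      where
      go : Dec (a ≡ β) → ⊥
      go (yes p) = nothing≢just βx₁ (trans (cong (λ b → N C₁ b x) (sym p)) f)
      go (no a≢β) = a≢β (uniq C (trans (sym (same₁ a a≢β x)) f) βx)
    A = add-edge C₁ (trans (same₁ α α≢β x) αx) (trans (same₁ α α≢β y′) αy′) (sub C βx) ¬c₁
    C₂ = proj₁ A
    ext₂ : C₁ ⊑ C₂
    ext₂ = proj₁ (proj₂ A)
    αx₂ = proj₁ (proj₂ (proj₂ A))
    same₂ = proj₂ (proj₂ (proj₂ A))
    ext₂′ : C ⊑ C₂
    ext₂′ c with keep _ _ c
    ... | inj₁ c₁ = ext₂ c₁
    ... | inj₂ (inj₁ (refl , refl)) = α , αx₂
    ... | inj₂ (inj₂ (refl , refl)) = α , inv C₂ {α} αx₂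
    βx₂ : N C₂ β x ≡ nothing
    βx₂ = trans (same₂ β (α≢β ∘ sym) x) βx₁
    βy₂ : N C₂ β y ≡ nothing
    βy₂ = trans (same₂ β (α≢β ∘ sym) y) (keepn y βy)
    ¬c₂ : ¬ Coloured C₂ x y₀
    ¬c₂ (a , f) = go (a Fin.≟ α) (a Fin.≟ β)
      where
      go : Dec (a ≡ α) → Dec (a ≡ β) → ⊥
      go (yes p) _ = ¬c (β , trans βx (trans (sym αx₂) (trans (cong (λ b → N C₂ b x) (sym p)) f)))
      go (no a≢α) (yes p) = nothing≢just βx₂ (trans (cong (λ b → N C₂ b x) (sym p)) f)
      go (no a≢α) (no a≢β) = ¬c (a , trans (sym (trans (same₂ a a≢α x) (same₁ a a≢β x))) f)
    same : ∀ {b} → b ∈ bs → ∀ v → N C₂ b v ≡ N C b v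
    same {b} i v = trans (same₂ b (λ { refl → nothing≢just αx (proj₂ (path-present p i)) }) v)
                         (same₁ b (λ { refl → β∉ i }) v)

  transpose : (α β a : Fin k) → Fin k
  transpose α β a = ifDec (a Fin.≟ α) β (ifDec (a Fin.≟ β) α a)

  module _ (α β : Fin k) where

    transpose-α : transpose α β α ≡ β
    transpose-α = ifDec-yes (α Fin.≟ α) refl

    transpose-β : transpose α β β ≡ α
    transpose-β with β Fin.≟ α
    ... | yes p = p
    ... | no _  = ifDec-yes (β Fin.≟ β) refl

    transpose-other : ∀ {a} → a ≢ α → a ≢ β → transpose α β a ≡ a
    transpose-other {a} p q = trans (ifDec-no (a Fin.≟ α) p) (ifDec-no (a Fin.≟ β) q)

    transpose-invol : ∀ a → transpose α β (transpose α β a) ≡ a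
    transpose-invol a = go (a Fin.≟ α) (a Fin.≟ β)
      where
      go : Dec (a ≡ α) → Dec (a ≡ β) → transpose α β (transpose α β a) ≡ a
      go (yes refl) _ = trans (cong (transpose α β) transpose-α) transpose-β
      go (no _) (yes refl) = trans (cong (transpose α β) transpose-β) transpose-α
      go (no f) (no g) = trans (cong (transpose α β) (transpose-other f g)) (transpose-other f g)

  -- `S` is a union of components of the subgraph formed by the colours `α` and `β`. The new
  -- matchings are read off the old ones through the transposition, so the same edges stay coloured.
  module Swap (C : PC) (α β : Fin k) (S : Fin n → Bool)
    (closed : ∀ {a x y} → a ≡ α ⊎ a ≡ β → N C a x ≡ just y → S x ≡ S y) where

    τ : Bool → Fin k → Fin k
    τ s a = if s then transpose α β a else a

    τ-invol : ∀ s a → τ s (τ s a) ≡ a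
    τ-invol true  a = transpose-invol α β a
    τ-invol false a = refl

    τ-other : ∀ s {a} → a ≢ α → a ≢ β → τ s a ≡ a
    τ-other true  p q = transpose-other α β p q
    τ-other false p q = refl

    τ-edge : ∀ {a x y} → N C a x ≡ just y → τ (S x) a ≡ τ (S y) a
    τ-edge {a} {x} {y} e = go (a Fin.≟ α) (a Fin.≟ β)
      where
      go : Dec (a ≡ α) → Dec (a ≡ β) → τ (S x) a ≡ τ (S y) a
      go (yes p) _ = cong (λ s → τ s a) (closed (inj₁ p) e)
      go (no _) (yes q) = cong (λ s → τ s a) (closed (inj₂ q) e)
      go (no p) (no q) = trans (τ-other (S x) p q) (sym (τ-other (S y) p q))

    τ-edge′ : ∀ {a x y} → N C (τ (S x) a) x ≡ just y → τ (S x) a ≡ τ (S y) a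
    τ-edge′ {a} {x} {y} e = begin
      τ (S x) a ≡⟨ τ-invol (S y) _ ⟨
      τ (S y) (τ (S y) (τ (S x) a)) ≡⟨ cong (τ (S y)) (τ-edge e) ⟨
      τ (S y) (τ (S x) (τ (S x) a)) ≡⟨ cong (τ (S y)) (τ-invol (S x) a) ⟩
      τ (S y) a ∎
      where open ≡-Reasoning

    swapped : PC
    swapped .N a x = N C (τ (S x) a) x
    swapped .inv {a} {x} {y} e = trans (cong (λ b → N C b y) (sym (τ-edge′ {a} e))) (inv C e)
    swapped .sub e = sub C e
    swapped .uniq {a} {b} {x} e f =
      trans (sym (τ-invol (S x) a)) (trans (cong (τ (S x)) (uniq C e f)) (τ-invol (S x) b))

    swap-⊑ : C ⊑ swapped
    swap-⊑ {x} (a , e) = τ (S x) a , trans (cong (λ b → N C b x) (τ-invol (S x) a)) e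

    swap-out : ∀ {x} a → S x ≡ false → N swapped a x ≡ N C a x
    swap-out a e rewrite e = refl

    swap-in : ∀ {x} → S x ≡ true → N swapped α x ≡ N C β x
    swap-in {x} e rewrite e = cong (λ b → N C b x) (transpose-α α β)

    swap-other : ∀ {a} → a ≢ α → a ≢ β → ∀ x → N swapped a x ≡ N C a x
    swap-other p q x = cong (λ b → N C b x) (τ-other (S x) p q)

  -- z t is the t-th vertex of the α/β-chain from x, with the colour to be followed next (true for β).
  module Chain (C : PC) (α β : Fin k) (x : Fin n) (αx : N C α x ≡ nothing) where

    State = Fin n × Bool

    col : Bool → Fin k
    col true  = β
    col false = α

    step : State → Maybe State
    step (v , b) with N C (col b) v
    ... | just u  = just (u , not b)
    ... | nothing = nothing

    next : Maybe State → Maybe State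
    next (just s) = step s
    next nothing  = nothing

    z : ℕ → Maybe State
    z zero    = just (x , true)
    z (suc t) = next (z t)

    step-just : ∀ {v b u b′} → step (v , b) ≡ just (u , b′) → N C (col b) v ≡ just u × b′ ≡ not b
    step-just {v} {b} e with N C (col b) v
    step-just refl | just u = refl , refl

    just-step : ∀ {v b u} → N C (col b) v ≡ just u → step (v , b) ≡ just (u , not b)
    just-step {v} {b} e with N C (col b) v
    just-step refl | just u = refl

    pred-just : ∀ t {u b′} → z (suc t) ≡ just (u , b′) →
                ∃[ v ] z t ≡ just (v , not b′) × N C (col (not b′)) v ≡ just u
    pred-just t e with z t
    ... | just (v , b) with step-just {v} {b} e
    ...   | f , refl rewrite Bool.not-involutive b = v , refl , f

    -- A state determines its predecessor, because matchings are involutions, and the starting state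
    -- has none, because `α` is missing at `x`. Running backwards from a repetition would produce a
    -- predecessor of the start.
    z-inj : ∀ s t {p} → z s ≡ just p → z t ≡ just p → s ≡ t
    z-inj zero zero _ _ = refl
    z-inj zero (suc t) refl f = let v , _ , g = pred-just t f in ⊥-elim (nothing≢just αx (inv C g))
    z-inj (suc s) zero e refl = let v , _ , g = pred-just s e in ⊥-elim (nothing≢just αx (inv C g))
    z-inj (suc s) (suc t) {u , b} e f with pred-just s e | pred-just t f
    ... | v , p , g | v′ , p′ , g′ = cong suc (z-inj s t p
      (trans p′ (cong (λ w → just (w , not b)) (just-injective (trans (sym (inv C g′)) (inv C g))))))

    is-nothing? : (m : Maybe State) → Dec (m ≡ nothing)
    is-nothing? nothing  = yes refl
    is-nothing? (just _) = no λ ()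

    fromJust : ∀ {m : Maybe State} → m ≢ nothing → ∃[ p ] m ≡ just p
    fromJust {just p}  _ = p , refl
    fromJust {nothing} h = contradiction refl h

    code : State → Fin (n * 2)
    code (v , b) = combine v (if b then zero else suc zero)

    code-inj : ∀ p q → code p ≡ code q → p ≡ q
    code-inj (v , b) (v′ , b′) e with Fin.combine-injective v _ v′ _ e
    code-inj (v , true)  (v , true)  e | refl , _ = refl
    code-inj (v , false) (v , false) e | refl , _ = refl
    code-inj (v , true)  (v , false) e | refl , ()
    code-inj (v , false) (v , true)  e | refl , ()

    ends : ∃[ T ] z T ≡ nothing
    ends with any? (λ (t : Fin (suc (n * 2))) → is-nothing? (z (toℕ t)))
    ... | yes (t , e) = toℕ t , e
    ... | no h = let i , j , i<j , e = pigeonhole (n<1+n (n * 2)) (λ t → code (proj₁ (val t))) in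
        contradiction (z-inj (toℕ i) (toℕ j) (proj₂ (val i))
          (trans (proj₂ (val j)) (cong just (sym (code-inj _ _ e))))) (<⇒≢ i<j)
      where
      val : (t : Fin (suc (n * 2))) → ∃[ p ] z (toℕ t) ≡ just p
      val t = fromJust (λ e → h (t , e))

    ended : ∀ s d → z s ≡ nothing → z (d + s) ≡ nothing
    ended s zero    e = e
    ended s (suc d) e rewrite ended s d e = refl

    ended-≤ : ∀ {s t} → s ≤ t → z s ≡ nothing → z t ≡ nothing
    ended-≤ {s} {t} le e = subst (λ w → z w ≡ nothing) (m∸n+n≡m le) (ended s (t ∸ s) e)

    T = proj₁ ends

    live : ∀ {t p} → z t ≡ just p → t < T
    live {t} e with t <? T
    ... | yes p = p
    ... | no ¬p = ⊥-elim (nothing≢just (ended-≤ (≮⇒≥ ¬p) (proj₂ ends)) e)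

    Hit : Fin n → Set
    Hit v = ∃[ t ] ∃[ b ] z t ≡ just (v , b)

    at? : ∀ t v → Dec (∃[ b ] z t ≡ just (v , b))
    at? t v with z t
    ... | nothing = no λ ()
    ... | just (u , b) = map′ (λ { refl → b , refl }) (λ { (_ , refl) → refl }) (u Fin.≟ v)

    Hit? : ∀ v → Dec (Hit v)
    Hit? v = map′ (λ (t , h) → toℕ t , h)
      (λ (t , b , e) → fromℕ< (live {t} e) , b , trans (cong z (toℕ-fromℕ< (live {t} e))) e)
      (any? {n = T} (λ t → at? (toℕ t) v))

    S : Fin n → Bool
    S v = ifDec (Hit? v) true false

    S-true : ∀ {v} → Hit v → S v ≡ true
    S-true {v} h = ifDec-yes (Hit? v) h

    S-false : ∀ {v} → ¬ Hit v → S v ≡ false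
    S-false {v} ¬h = ifDec-no (Hit? v) ¬h

    Hit-closed : ∀ {a v u} → a ≡ α ⊎ a ≡ β → N C a v ≡ just u → Hit v → Hit u
    Hit-closed {a} {v} {u} a∈ e (t , b , h) = go b h t h (outgoing b a∈)
      where
      outgoing : ∀ b → a ≡ α ⊎ a ≡ β → a ≡ col b ⊎ a ≡ col (not b)
      outgoing true  (inj₁ p) = inj₂ p
      outgoing true  (inj₂ p) = inj₁ p
      outgoing false (inj₁ p) = inj₁ p
      outgoing false (inj₂ p) = inj₂ p
      go : ∀ b → z t ≡ just (v , b) → ∀ s → z s ≡ just (v , b) → a ≡ col b ⊎ a ≡ col (not b) → Hit u
      go b h s hs (inj₁ refl) = suc t , not b , trans (cong next h) (just-step {v} {b} e)
      go b h zero refl (inj₂ refl) = ⊥-elim (nothing≢just αx e)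
      go b h (suc s) hs (inj₂ refl) = let v′ , p , g = pred-just s hs in
        s , not b , trans p (cong (λ w → just (w , not b)) (just-injective (trans (sym (inv C g)) e)))

    S-closed : ∀ {a v u} → a ≡ α ⊎ a ≡ β → N C a v ≡ just u → S v ≡ S u
    S-closed {a} {v} {u} a∈ e with Hit? v | Hit? u
    ... | yes _ | yes _ = refl
    ... | no _  | no _  = refl
    ... | yes h | no ¬h = contradiction (Hit-closed a∈ e h) ¬h
    ... | no ¬h | yes h = contradiction (Hit-closed a∈ (inv C e) h) ¬h

    end-of-chain : ∀ {y} → y ≢ x → N C β y ≡ nothing → Hit y →
                   ∃[ t ] z t ≡ just (y , true) × z (suc t) ≡ nothing
    end-of-chain y≢x βy (zero , b , refl) = contradiction refl y≢x
    end-of-chain y≢x βy (suc t , false , e) =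
      let v , _ , g = pred-just t e in ⊥-elim (nothing≢just βy (inv C g))
    end-of-chain {y} y≢x βy (suc t , true , e) = suc t , e , trans (cong next e) stop
      where
      stop : step (y , true) ≡ nothing
      stop with N C β y
      stop | nothing = refl

    -- A vertex other than `x` that misses `β` can be entered only along `α` and stops the chain, so
    -- both vertices are the last one.
    one-end : ∀ {y y′} → y ≢ x → y′ ≢ x → N C β y ≡ nothing → N C β y′ ≡ nothing → Hit y → Hit y′ → y ≡ y′
    one-end {y} {y′} p p′ m m′ h h′ with end-of-chain p m h | end-of-chain p′ m′ h′
    ... | t , e , f | t′ , e′ , f′ with <-cmp t t′
    ...   | tri< lt _ _ = ⊥-elim (nothing≢just (ended-≤ lt f) e′)
    ...   | tri≈ _ refl _ = cong proj₁ (just-injective (trans (sym e) e′))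
    ...   | tri> _ _ gt = ⊥-elim (nothing≢just (ended-≤ gt f′) e)

    -- Exchanging the colours off the chain rather than on it leaves all colours at `x` as they are,
    -- so that a fan at `x` keeps its labels. A vertex off the chain that misses `β` afterwards
    -- misses `α`, as `x` does.
    module Complement = Swap C α β (not ∘ S) (λ a∈ e → cong not (S-closed a∈ e))

    x-out : not (S x) ≡ false
    x-out = cong not (S-true (0 , true , refl))

  -- `Q` need only contain the neighbours along coloured edges. For bipartite graphs the uncoloured
  -- edge at `v` is left out, which saves the extra colour.
  missing : ∀ C v {Q : Fin n → Set} (Q? : Decidable Q) → (∀ {a u} → N C a v ≡ just u → Q u) → cnt Q? < k →
            ∃[ a ] N C a v ≡ nothing
  missing C v {Q} Q? h lt with any? (λ a → free? (N C a v))
    where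
    free? : (m : Maybe (Fin n)) → Dec (m ≡ nothing)
    free? nothing  = yes refl
    free? (just _) = no λ ()
  ... | yes r = r
  ... | no r = contradiction lt (≤⇒≯ (subst (_≤ cnt Q?) (cnt-all {k} (λ _ → yes tt) (λ _ → tt))
      (cnt-inj (λ _ → yes tt) Q? (λ a → proj₁ (val a)) (λ a _ → h (proj₂ (val a)))
        (λ a b _ _ e → uniq C (proj₂ (val a)) (trans (proj₂ (val b)) (cong just (sym e)))))))
    where
    total : ∀ {m : Maybe (Fin n)} → m ≢ nothing → ∃[ u ] m ≡ just u
    total {just u}  _ = u , refl
    total {nothing} p = contradiction refl p
    val : ∀ a → ∃[ u ] N C a v ≡ just u
    val a = total (λ e → r (a , e))

  just≢? : (m : Maybe (Fin n)) → m ≡ nothing ⊎ ∃[ u ] m ≡ just u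
  just≢? nothing  = inj₁ refl
  just≢? (just u) = inj₂ (u , refl)

  Coloured? : ∀ C x y → Dec (Coloured C x y)
  Coloured? C x y = any? (λ a → is? (N C a x))
    where
    is? : (m : Maybe (Fin n)) → Dec (m ≡ just y)
    is? nothing  = no λ ()
    is? (just u) = map′ (cong just) just-injective (u Fin.≟ y)

  empty : PC
  empty .N _ _ = nothing
  empty .inv ()
  empty .sub ()
  empty .uniq ()

  module Extend (solve : ∀ C {x y} → E x y → ¬ Coloured C x y → Solved C x y) (E? : ∀ x y → Dec (E x y)) where

    Full : PC → List (Fin n × Fin n) → Set
    Full C ps = ∀ {x y} → (x , y) ∈ ps → E x y → Coloured C x y

    extend : ∀ ps → Σ PC λ C → Full C ps
    extend [] = empty , λ ()
    extend ((x , y) ∷ ps) with extend ps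
    ... | C , full with E? x y | Coloured? C x y
    ...   | no ¬e | _ = C , λ { (here refl) e → contradiction e ¬e ; (there i) e → full i e }
    ...   | yes _ | yes c = C , λ { (here refl) _ → c ; (there i) e → full i e }
    ...   | yes e | no ¬c = let C′ , ext , c = solve C e ¬c in
      C′ , λ { (here refl) _ → c ; (there i) e → ext (full i e) }

    colouring : Σ (Fin n → Fin n → ℕ) λ c → (∀ {x y} → E x y → c x y < k) ×
                (∀ {x y} → E x y → c x y ≡ c y x) ×
                (∀ {x y w} → E x y → E x w → y ≢ w → c x y ≢ c x w)
    colouring with extend (List.cartesianProduct (allFin n) (allFin n))
    ... | C , full = c , c-bound , c-sym , c-proper
      where
      c : Fin n → Fin n → ℕ
      c x y with Coloured? C x y
      ... | yes (b , _) = toℕ b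
      ... | no _        = 0
      c-ok : ∀ {x y} → E x y → ∃[ b ] c x y ≡ toℕ b × N C b x ≡ just y
      c-ok {x} {y} e with Coloured? C x y
      ... | yes (b , s) = b , refl , s
      ... | no ¬c = contradiction (full (∈-cartesianProduct⁺ (∈-allFin x) (∈-allFin y)) e) ¬c
      c-bound : ∀ {x y} → E x y → c x y < k
      c-bound e = let b , p , _ = c-ok e in subst (_< k) (sym p) (toℕ<n b)
      c-sym : ∀ {x y} → E x y → c x y ≡ c y x
      c-sym e = let _ , p , s = c-ok e; _ , q , t = c-ok (E-sym e) in
        trans p (trans (cong toℕ (uniq C s (inv C t))) (sym q))
      c-proper : ∀ {x y w} → E x y → E x w → y ≢ w → c x y ≢ c x w
      c-proper {x} e f y≢w r = let _ , p , s = c-ok e; b , q , t = c-ok f in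
        y≢w (just-injective (trans (sym s)
          (trans (cong (λ a → N C a x) (toℕ-injective (trans (sym p) (trans r q)))) t)))

  module Vizing (E? : ∀ x y → Dec (E x y)) (deg : ∀ v → cnt (E? v) < k) where

    μ : ∀ C v → ∃[ a ] N C a v ≡ nothing
    μ C v = missing C v (E? v) (sub C) (deg v)

    path-adj : ∀ {C x y₀ bs y} → E x y₀ → Path C x y₀ bs y → E x y
    path-adj e [] = e
    path-adj {C} e (snoc _ _ f _) = sub C f

    module _ (C : PC) {x y₀ : Fin n} (e₀ : E x y₀) (¬c : ¬ Coloured C x y₀)
             {α : Fin k} (αx : N C α x ≡ nothing) {β : Fin k} (βx : ∃[ u ] N C β x ≡ just u) where
      open Chain C α β x αx
      module W = Complement
      C′ = W.swapped

      x-same : ∀ a → N C′ a x ≡ N C a x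
      x-same a = W.swap-out a x-out

      ¬c′ : ¬ Coloured C′ x y₀
      ¬c′ (a , e) = ¬c (a , trans (sym (x-same a)) e)

      ≢α : ∀ {bs y b} → Path C x y₀ bs y → b ∈ bs → b ≢ α
      ≢α p i refl = nothing≢just αx (proj₂ (path-present p i))

      avoiding : ∀ {bs y} → Path C x y₀ bs y → β ∉ bs → Path C′ x y₀ bs y
      avoiding p β∉ = path-transport (λ i v → W.swap-other (≢α p i) (λ { refl → β∉ i }) v) p

      finish : ∀ {bs y} → Path C′ x y₀ bs y → ¬ Hit y → N C β y ≡ nothing → Solved C x y₀
      finish {bs} {y} p ¬h βy =
        let C₃ , ext , c = shift bs p (trans (x-same α) αx) (trans (W.swap-in (cong not (S-false ¬h))) βy) e₀ ¬c′
        in C₃ , (λ q → ext (W.swap-⊑ q)) , c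

      -- `y₁` is the fan vertex just before the `β`-coloured edge at `x`, hence it misses `β`. If it
      -- lies on the chain, it still misses `β` after the exchange off the chain, and the fan
      -- survives as a whole.
      record Earlier (bs : List (Fin k)) (y : Fin n) : Set where
        field
          {bs₁}  : List (Fin k)
          {y₁}   : Fin n
          path   : Path C x y₀ bs₁ y₁
          β∉     : β ∉ bs₁
          βy₁    : N C β y₁ ≡ nothing
          differ : ∀ {b} → b ∉ bs₁ → N C b x ≡ just y₁ → ⊥
          sub∈   : ∀ {b} → b ∈ bs₁ → b ∈ bs
          last∉  : ∀ {b cs} → bs ≡ b ∷ cs → b ∉ cs → b ∉ bs₁
          whole  : Hit y₁ → Path C′ x y₀ bs y

      outside : ∀ {bs y b} → Path C x y₀ bs y → b ∉ bs → N C b x ≡ just y → ⊥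
      outside [] _ e = ¬c (_ , e)
      outside (snoc p _ f _) b∉ e = b∉ (here (uniq C e f))

      earlier : ∀ {bs y} → β ∈ bs → Path C x y₀ bs y → Earlier bs y
      earlier (here refl) (snoc {y = y₁} p m e β∉) = record
        { path = p ; β∉ = β∉ ; βy₁ = m ; differ = outside p ; sub∈ = there ; last∉ = λ { refl h → h }
        ; whole = λ h → snoc (avoiding p β∉) (trans (W.swap-out _ (cong not (S-true h))) m)
                          (trans (x-same _) e) β∉ }
      earlier (there i) (snoc {bs} {y = y′} {β = b} p m e b∉) = record
        { Earlier r ; sub∈ = there ∘ Earlier.sub∈ r ; last∉ = λ { refl h j → h (Earlier.sub∈ r j) }
        ; whole = λ h → snoc (Earlier.whole r h) (trans (W.swap-other b≢α b≢β y′) m) (trans (x-same _) e) b∉ }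
        where
        r = earlier i p
        b≢α : b ≢ α
        b≢α refl = nothing≢just αx e
        b≢β : b ≢ β
        b≢β refl = b∉ i

      -- Both `y₁` and `y` miss `β`, so by `one-end` at most one of them is on the chain from `x`.
      -- After the exchange the other one misses `α`, and the fan up to that vertex can be rotated.
      kempe : ∀ {bs y} → Path C x y₀ bs y → β ∈ bs → N C β y ≡ nothing → Solved C x y₀
      kempe {bs} {y} p i βy with earlier i p
      ... | r with Hit? (Earlier.y₁ r) | Hit? y
      ...   | no ¬h | _ = finish (avoiding (Earlier.path r) (Earlier.β∉ r)) ¬h (Earlier.βy₁ r)
      ...   | yes h | no ¬h = finish (Earlier.whole r h) ¬h βy
      ...   | yes h | yes h′ = ⊥-elim (distinct p i (one-end
              (λ { refl → E-irr (path-adj e₀ (Earlier.path r)) }) (λ { refl → E-irr (path-adj e₀ p) })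
              (Earlier.βy₁ r) βy h h′))
        where
        distinct : Path C x y₀ bs y → β ∈ bs → Earlier.y₁ r ≢ y
        distinct (snoc _ _ e b∉) (here refl) refl = Earlier.differ r (Earlier.β∉ r) e
        distinct (snoc _ _ e b∉) (there j) refl = Earlier.differ r (Earlier.last∉ r refl b∉) e

    -- Every extension of the fan uses up a new colour. So the search ends, either with a colour
    -- missing at both `x` and the last vertex, or with a repeated colour, which is the case of
    -- `kempe`.
    explore : ∀ C {x y₀} → E x y₀ → ¬ Coloured C x y₀ → ∀ {α} → N C α x ≡ nothing →
              ∀ m bs {y} → Path C x y₀ bs y → cnt (λ a → ¬? (DecMem._∈?_ Fin._≟_ a bs)) ≤ m → Solved C x y₀
    explore C {x} e ¬c αx m bs {y} p le with μ C y
    ... | β , βy with just≢? (N C β x)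
    ...   | inj₁ βx = shift bs p βx βy e ¬c
    ...   | inj₂ (y′ , βx) with DecMem._∈?_ Fin._≟_ β bs
    ...     | yes i = kempe C e ¬c αx (y′ , βx) p i βy
    ...     | no β∉ with ≤-trans fewer le
      where
      fewer : suc (cnt (λ a → ¬? (DecMem._∈?_ Fin._≟_ a (β ∷ bs)))) ≤ cnt (λ a → ¬? (DecMem._∈?_ Fin._≟_ a bs))
      fewer = cnt<-witness _ _ β (λ a h i → h (there i)) β∉ (λ h → h (here refl))
    ...       | s≤s le′ = explore C e ¬c αx _ (β ∷ bs) (snoc p βy βx β∉) le′

    solve : ∀ C {x y} → E x y → ¬ Coloured C x y → Solved C x y
    solve C {x} e ¬c = explore C e ¬c (proj₂ (μ C x)) _ [] [] ≤-refl

    open Extend solve E? public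

  module König (E? : ∀ x y → Dec (E x y)) (deg : ∀ v → cnt (E? v) ≤ k)
               (side : Fin n → Bool) (bip : ∀ {x y} → E x y → side x ≡ not (side y)) where

    -- If `y` were on the chain from `x`, it would be its end, entered along `α` and so after an
    -- even number of edges; it would lie on the side of `x`, contrary to the edge `xy`. Hence the
    -- exchange off the chain frees `α` at `y`.
    solve : ∀ C {x y} → E x y → ¬ Coloured C x y → Solved C x y
    solve C {x} {y} e ¬c = go (just≢? (N C α y))
      where
      free : ∀ {u v} → E u v → ¬ Coloured C u v → ∃[ a ] N C a u ≡ nothing
      free {u} {v} e ¬c = missing C u (λ w → E? u w ×-dec ¬? (w Fin.≟ v))
        (λ f → sub C f , λ { refl → ¬c (_ , f) }) (subst (_≤ k) (cnt-remove (E? u) v e) (deg u))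
      α = proj₁ (free e ¬c)
      αx = proj₂ (free e ¬c)
      ¬c′ : ¬ Coloured C y x
      ¬c′ (a , f) = ¬c (a , inv C f)
      β = proj₁ (free (E-sym e) ¬c′)
      βy = proj₂ (free (E-sym e) ¬c′)
      open Chain C α β x αx
      module W = Complement
      toggle : ∀ b → not (if b then side x else not (side x)) ≡ (if not b then side x else not (side x))
      toggle true  = refl
      toggle false = Bool.not-involutive (side x)
      side-of : ∀ t {v b} → z t ≡ just (v , b) → side v ≡ (if b then side x else not (side x))
      side-of zero refl = refl
      side-of (suc t) {v} {b} f = let v′ , p , g = pred-just t f in
        trans (bip (E-sym (sub C g))) (trans (cong not (side-of t p))
          (trans (toggle (not b)) (cong (λ b → if b then side x else not (side x)) (Bool.not-involutive b))))
      not-≢ : ∀ b → b ≢ not b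
      not-≢ true ()
      not-≢ false ()
      y-out : S y ≡ false
      y-out = S-false (λ h → let t , f , _ = end-of-chain (λ { refl → E-irr e }) βy h in
        not-≢ (side y) (trans (side-of t f) (bip e)))
      go : N C α y ≡ nothing ⊎ (∃[ u ] N C α y ≡ just u) → Solved C x y
      go (inj₁ αy) = let C′ , ext , c , _ = add-edge C αx αy e ¬c in C′ , ext , (α , c)
      go (inj₂ _)  = let C′ , ext , c , _ = add-edge W.swapped (trans (W.swap-out α x-out) αx)
                                               (trans (W.swap-in (cong not y-out)) βy) e
                                               (λ (a , f) → ¬c (a , trans (sym (W.swap-out a x-out)) f))
                    in C′ , (λ q → ext (W.swap-⊑ q)) , (α , c)

    open Extend solve E? public

-- Edge colourings that are proper only within blocks

ProperOn : ∀ {n} → (Fin n → Fin n → Set) → ℕ → (Fin n → Fin n → ℕ) → Set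
ProperOn E k c = (∀ {x y} → E x y → c x y < k) × (∀ {x y} → E x y → c x y ≡ c y x) ×
                 (∀ {x y w} → E x y → E x w → y ≢ w → c x y ≢ c x w)

module Graphs {n : ℕ} (E : Fin n → Fin n → Set) (E? : ∀ x y → Dec (E x y))
              (E-sym : ∀ {x y} → E x y → E y x) (E-irr : ∀ {x} → ¬ E x x) where

  abstract
    vizing : ∀ k → (∀ v → cnt (E? v) ≤ k) → Σ (Fin n → Fin n → ℕ) (ProperOn E (suc k))
    vizing k deg = PartialColouring.Vizing.colouring E E-sym E-irr E? (λ v → s≤s (deg v))

  BlockProper : ℕ → (Fin n → Fin n → ℕ) → (Fin n → Fin n → ℕ) → Set
  BlockProper k β c = (∀ {v u} → E v u → c v u < k) × (∀ {v u} → E v u → c v u ≡ c u v) ×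
    (∀ {v u w} → E v u → E v w → u ≢ w → β v u ≡ β v w → c v u ≢ c v w)

  -- Every vertex v is split into h copies, the edge vu being attached to the copy β v u of v.
  module Split (q h : ℕ) (β : Fin n → Fin n → ℕ) (β< : ∀ v u → β v u < h)
               (fibre : ∀ v j → cnt (λ u → E? v u ×-dec (β v u ≟ j)) ≤ q) where

    vertex : Fin (n * h) → Fin n
    vertex x = proj₁ (remQuot {n} h x)

    copy : Fin (n * h) → ℕ
    copy x = toℕ (proj₂ (remQuot {n} h x))

    E′ : Fin (n * h) → Fin (n * h) → Set
    E′ x y = E (vertex x) (vertex y) × β (vertex x) (vertex y) ≡ copy x × β (vertex y) (vertex x) ≡ copy y

    E′? : ∀ x y → Dec (E′ x y)
    E′? x y = E? _ _ ×-dec (β (vertex x) (vertex y) ≟ copy x) ×-dec (β (vertex y) (vertex x) ≟ copy y)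

    E′-sym : ∀ {x y} → E′ x y → E′ y x
    E′-sym (e , p , q) = E-sym e , q , p

    deg′ : ∀ x → cnt (E′? x) ≤ q
    deg′ x = ≤-trans (cnt-inj (E′? x) (λ u → E? (vertex x) u ×-dec (β (vertex x) u ≟ copy x)) vertex
        (λ y (e , p , _) → e , p) inj) (fibre (vertex x) (copy x))
      where
      inj : ∀ y w → E′ x y → E′ x w → vertex y ≡ vertex w → y ≡ w
      inj y w (_ , _ , p) (_ , _ , q) e = begin
        y ≡⟨ Fin.combine-remQuot {n} h y ⟨
        uncurry combine (remQuot {n} h y) ≡⟨ cong (uncurry combine) (cong₂ _,_ e
            (toℕ-injective (trans (sym p) (trans (cong (λ z → β z (vertex x)) e) q)))) ⟩
        uncurry combine (remQuot {n} h w) ≡⟨ Fin.combine-remQuot {n} h w ⟩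
        w ∎
        where open ≡-Reasoning

    node : Fin n → Fin n → Fin (n * h)
    node v u = combine v (fromℕ< (β< v u))

    vertex-node : ∀ v u → vertex (node v u) ≡ v
    vertex-node v u = cong proj₁ (Fin.remQuot-combine v (fromℕ< (β< v u)))

    copy-node : ∀ v u → copy (node v u) ≡ β v u
    copy-node v u = trans (cong (toℕ ∘ proj₂) (Fin.remQuot-combine v (fromℕ< (β< v u)))) (toℕ-fromℕ< (β< v u))

    node-edge : ∀ {v u} → E v u → E′ (node v u) (node u v)
    node-edge {v} {u} e rewrite vertex-node v u | vertex-node u v | copy-node v u | copy-node u v = e , refl , refl

    unsplit : ∀ {k} → Σ (Fin (n * h) → Fin (n * h) → ℕ) (ProperOn E′ k) →
              Σ (Fin n → Fin n → ℕ) (BlockProper k β)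
    unsplit (c , c< , c-sym , c-proper) = (λ v u → c (node v u) (node u v)) , c< ∘ node-edge ,
      c-sym ∘ node-edge ,
      λ {v} {u} {w} e f u≢w same eq →
        let s : node v u ≡ node v w
            s = cong (combine v) (toℕ-injective (trans (toℕ-fromℕ< (β< v u)) (trans same (sym (toℕ-fromℕ< (β< v w))))))
        in c-proper (node-edge e) (subst (λ z → E′ z (node w v)) (sym s) (node-edge f))
             (λ q → u≢w (trans (sym (vertex-node u v)) (trans (cong vertex q) (vertex-node w v))))
             (trans eq (cong (λ z → c z (node w v)) (sym s)))

    abstract
      split-vizing : Σ (Fin n → Fin n → ℕ) (BlockProper (suc q) β)
      split-vizing = unsplit (PartialColouring.Vizing.colouring E′ E′-sym (λ (e , _) → E-irr e) E′?
                               (λ x → s≤s (deg′ x)))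

      split-könig : (side : ℕ → Bool) → (∀ {v u} → E v u → side (β v u) ≡ not (side (β u v))) →
                    Σ (Fin n → Fin n → ℕ) (BlockProper q β)
      split-könig side bip = unsplit (PartialColouring.König.colouring E′ E′-sym (λ (e , _) → E-irr e) E′?
        deg′ (side ∘ copy) (λ (e , p , q) → trans (cong side (sym p)) (trans (bip e) (cong (not ∘ side) q))))

module Lex {n : ℕ} (a : Fin n → ℕ) where

  κ : Fin n → ℕ
  κ u = a u * n + toℕ u

  κ-< : ∀ {u w} → a u < a w → κ u < κ w
  κ-< {u} {w} lt = begin-strict
    a u * n + toℕ u <⟨ +-monoʳ-< (a u * n) (toℕ<n u) ⟩
    a u * n + n ≡⟨ +-comm (a u * n) n ⟩
    suc (a u) * n ≤⟨ *-monoˡ-≤ n lt ⟩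
    a w * n ≤⟨ m≤m+n _ _ ⟩
    κ w ∎
    where open ≤-Reasoning

  κ-≤ : ∀ {u w} → κ u < κ w → a u ≤ a w
  κ-≤ lt = ≮⇒≥ (λ gt → <-asym lt (κ-< gt))

  κ-inj : ∀ u w → κ u ≡ κ w → u ≡ w
  κ-inj u w e with <-cmp (a u) (a w)
  ... | tri< lt _ _ = contradiction e (<⇒≢ (κ-< lt))
  ... | tri> _ _ gt = contradiction (sym e) (<⇒≢ (κ-< gt))
  ... | tri≈ _ s _  = toℕ-injective (+-cancelˡ-≡ (a u * n) _ _ (trans e (cong (λ z → z * n + toℕ w) (sym s))))

digit-inj : ∀ k .{{_ : NonZero k}} {a b c d} → b < k → d < k → a * k + b ≡ c * k + d → a ≡ c × b ≡ d
digit-inj k {a} {b} {c} {d} b< d< e = quot , +-cancelˡ-≡ (a * k) b d (trans e (cong (λ z → z * k + d) (sym quot)))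
  where
  div : ∀ a {b} → b < k → (a * k + b) / k ≡ a
  div a {b} b< = trans (+-distrib-/-∣ˡ b (divides-refl a)) (trans (cong₂ _+_ (m*n/n≡m a k) (m<n⇒m/n≡0 b<)) (+-identityʳ a))
  quot : a ≡ c
  quot = trans (sym (div a b<)) (trans (cong (_/ k) e) (div c d<))

-- A total colouring extending given vertex colours

module TotalColouring {n : ℕ} (E : Fin n → Fin n → Set) (E? : ∀ x y → Dec (E x y))
    (E-sym : ∀ {x y} → E x y → E y x) (E-irr : ∀ {x} → ¬ E x x)
    (D : ℕ) .{{_ : NonZero D}} (deg : ∀ v → cnt (E? v) ≤ D * D)
    (cv : Fin n → ℕ) (cv< : ∀ v → cv v < suc D * suc D) where

  cl : Fin n → ℕ
  cl u = cv u / suc D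

  cl≤ : ∀ u → cl u ≤ D
  cl≤ u = ≤-pred (m<n*o⇒m/o<n (cv< u))

  open Lex cl
  module R v = Rank (E? v) κ κ-inj

  β : Fin n → Fin n → ℕ
  β v u = R.rank v u / D

  β< : ∀ v u → β v u < suc n
  β< v u = s≤s (≤-trans (m/n≤m _ D) (R.rank≤n v u))

  β<D : ∀ {v u} → E v u → β v u < D
  β<D {v} e = m<n*o⇒m/o<n (<-≤-trans (R.rank<cnt v e) (deg v))

  split = Graphs.Split.split-vizing E E? E-sym E-irr D (suc n) β β< (λ v j → R.block-≤ v D j)
  g = proj₁ split

  g< : ∀ {v u} → E v u → g v u < suc D
  g< = proj₁ (proj₂ split)

  g-sym : ∀ {v u} → E v u → g v u ≡ g u v
  g-sym = proj₁ (proj₂ (proj₂ split))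

  same-block : ∀ {v u w} → E v u → E v w → β v u ≡ β v w → g v u ≡ g v w → u ≡ w
  same-block {v} {u} {w} e f p q = decidable-stable (u Fin.≟ w) (λ ¬r → proj₂ (proj₂ (proj₂ split)) e f ¬r p q)

  -- The palette of group `i` consists of the vertex colours of class `i`, so an edge can clash with
  -- the colour of an end only if its group is the class of that end. Such edges are moved to fresh
  -- colours from `Q` on.
  Bad : Fin n → Fin n → Set
  Bad x y = E x y × (g x y ≡ cl x ⊎ g x y ≡ cl y)

  Bad? : ∀ x y → Dec (Bad x y)
  Bad? x y = E? x y ×-dec ((g x y ≟ cl x) ⊎-dec (g x y ≟ cl y))

  Bad-sym : ∀ {x y} → Bad x y → Bad y x
  Bad-sym (e , inj₁ p) = E-sym e , inj₂ (trans (sym (g-sym e)) p)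
  Bad-sym (e , inj₂ p) = E-sym e , inj₁ (trans (sym (g-sym e)) p)

  -- Along the edges at v sorted by the class of the other end, the pair (block, class) is monotone,
  -- and each such pair contains at most one edge whose group equals that class.
  deg-bad : ∀ v → cnt (Bad? v) ≤ 3 * D
  deg-bad v = begin
    cnt (Bad? v) ≤⟨ cnt-mono (Bad? v) (λ u → own? u ⊎-dec other? u)
                             (λ { u (e , inj₁ p) → inj₁ (e , p) ; u (e , inj₂ p) → inj₂ (e , p) }) ⟩
    cnt (λ u → own? u ⊎-dec other? u) ≤⟨ cnt-⊎ own? other? ⟩
    cnt own? + cnt other? ≤⟨ +-mono-≤
        (cnt-bound own? (β v) D (λ u (e , _) → β<D e) (λ u w (e , p) (f , q) s → same-block e f s (trans p (sym q))))
        -- As both coordinates grow together, the pair is determined by its sum, which takes at most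
        -- `2 * D` values.
        (cnt-bound other? (λ u → β v u + cl u) (2 * D)
          (λ u (e , _) → <-≤-trans (+-mono-<-≤ (β<D e) (cl≤ u)) (+-monoʳ-≤ D (≤-reflexive (sym (+-identityʳ D)))))
          inj) ⟩
    D + 2 * D ≡⟨⟩
    3 * D ∎
    where
    open ≤-Reasoning
    own? : ∀ u → Dec (E v u × g v u ≡ cl v)
    own? u = E? v u ×-dec (g v u ≟ cl v)
    other? : ∀ u → Dec (E v u × g v u ≡ cl u)
    other? u = E? v u ×-dec (g v u ≟ cl u)
    squeeze : ∀ {a b c d} → a ≤ c → b ≤ d → a + b ≡ c + d → a ≡ c × b ≡ d
    squeeze {a} {b} {c} {d} p q e = ac , +-cancelˡ-≡ a b d (trans e (cong (_+ d) (sym ac)))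
      where
      ac : a ≡ c
      ac = ≤-antisym p (+-cancelʳ-≤ d c a (≤-trans (≤-reflexive (sym e)) (+-monoʳ-≤ a q)))
    ordered : ∀ {u w} → E v u → g v u ≡ cl u → E v w → g v w ≡ cl w → κ u < κ w →
              β v u + cl u ≡ β v w + cl w → u ≡ w
    ordered e p f q lt s = let s₁ , s₂ = squeeze (/-monoˡ-≤ D (<⇒≤ (R.rank-mono v e lt))) (κ-≤ lt) s in
      same-block e f s₁ (trans p (trans s₂ (sym q)))
    inj : ∀ u w → E v u × g v u ≡ cl u → E v w × g v w ≡ cl w → β v u + cl u ≡ β v w + cl w → u ≡ w
    inj u w (e , p) (f , q) s with <-cmp (κ u) (κ w)
    ... | tri< lt _ _ = ordered e p f q lt s
    ... | tri≈ _ t _  = κ-inj u w t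
    ... | tri> _ _ gt = sym (ordered f q e p gt (sym s))

  Good : ℕ → Fin n → Fin n → Set
  Good i x y = E x y × g x y ≡ i

  Good? : ∀ i x y → Dec (Good i x y)
  Good? i x y = E? x y ×-dec (g x y ≟ i)

  -- A vertex has at most `D` blocks and the groups within a block are distinct, so each group has
  -- maximum degree at most `D` and fits into its own palette of size `suc D`.
  good : ∀ i → Σ (Fin n → Fin n → ℕ) (ProperOn (Good i) (suc D))
  good i = Graphs.vizing (Good i) (Good? i) (λ (e , p) → E-sym e , trans (sym (g-sym e)) p)
    (λ (e , _) → E-irr e) D
    (λ v → cnt-bound (Good? i v) (β v) D (λ u (e , _) → β<D e)
      (λ u w (e , p) (f , q) s → same-block e f s (trans p (sym q))))

  bad : Σ (Fin n → Fin n → ℕ) (ProperOn Bad (suc (3 * D)))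
  bad = Graphs.vizing Bad Bad? Bad-sym (λ (e , _) → E-irr e) (3 * D) deg-bad

  Q = suc D * suc D

  c : Fin n → Fin n → ℕ
  c x y = ifDec (Bad? x y) (Q + proj₁ bad x y) (g x y * suc D + proj₁ (good (g x y)) x y)

  c-bad : ∀ {x y} → Bad x y → c x y ≡ Q + proj₁ bad x y
  c-bad {x} {y} b = ifDec-yes (Bad? x y) b

  c-good : ∀ {x y} → ¬ Bad x y → c x y ≡ g x y * suc D + proj₁ (good (g x y)) x y
  c-good {x} {y} b = ifDec-no (Bad? x y) b

  good< : ∀ {x y} → E x y → proj₁ (good (g x y)) x y < suc D
  good< {x} {y} e = proj₁ (proj₂ (good (g x y))) (e , refl)

  c-good< : ∀ {x y} → E x y → ¬ Bad x y → c x y < Q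
  c-good< {x} {y} e b = begin-strict
    c x y ≡⟨ c-good b ⟩
    g x y * suc D + proj₁ (good (g x y)) x y <⟨ +-monoʳ-< (g x y * suc D) (good< e) ⟩
    g x y * suc D + suc D ≡⟨ +-comm (g x y * suc D) (suc D) ⟩
    suc (g x y) * suc D ≤⟨ *-monoˡ-≤ (suc D) (g< e) ⟩
    Q ∎
    where open ≤-Reasoning

  c-bad≥ : ∀ {x y} → Bad x y → Q ≤ c x y
  c-bad≥ b = subst (Q ≤_) (sym (c-bad b)) (m≤m+n _ _)

  c-avoids : ∀ {x y} → E x y → c x y ≢ cv x
  c-avoids {x} {y} e eq = go (Bad? x y)
    where
    go : Dec (Bad x y) → ⊥
    go (yes b) = contradiction (cv< x) (≤⇒≯ (subst (Q ≤_) eq (c-bad≥ b)))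
    go (no b)  = b (e , inj₁ (proj₁ (digit-inj (suc D) (good< e) (m%n<n (cv x) (suc D))
      (trans (sym (c-good b)) (trans eq (trans (m≡m%n+[m/n]*n (cv x) (suc D)) (+-comm (cv x % suc D) _)))))))

  c-proper : ProperOn E (Q + suc (3 * D)) c
  c-proper = bound , symm , prop
    where
    bound : ∀ {x y} → E x y → c x y < Q + suc (3 * D)
    bound {x} {y} e = go (Bad? x y)
      where
      go : Dec (Bad x y) → c x y < Q + suc (3 * D)
      go (yes b) = subst (_< Q + suc (3 * D)) (sym (c-bad b)) (+-monoʳ-< Q (proj₁ (proj₂ bad) b))
      go (no b)  = <-≤-trans (c-good< e b) (m≤m+n Q _)
    symm : ∀ {x y} → E x y → c x y ≡ c y x
    symm {x} {y} e = go (Bad? x y)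
      where
      gs = g-sym e
      go : Dec (Bad x y) → c x y ≡ c y x
      go (yes b) = trans (c-bad b) (trans (cong (Q +_) (proj₁ (proj₂ (proj₂ bad)) b)) (sym (c-bad (Bad-sym b))))
      go (no b)  = trans (c-good b) (trans
        (cong₂ (λ s t → s * suc D + t) gs (trans (proj₁ (proj₂ (proj₂ (good (g x y)))) (e , refl))
          (cong (λ i → proj₁ (good i) y x) gs)))
        (sym (c-good (b ∘ Bad-sym))))
    prop : ∀ {x y w} → E x y → E x w → y ≢ w → c x y ≢ c x w
    prop {x} {y} {w} e f y≢w eq = go (Bad? x y) (Bad? x w)
      where
      go : Dec (Bad x y) → Dec (Bad x w) → ⊥
      go (yes b) (yes b′) = proj₂ (proj₂ (proj₂ bad)) b b′ y≢w
        (+-cancelˡ-≡ Q _ _ (trans (sym (c-bad b)) (trans eq (c-bad b′))))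
      go (yes b) (no b′) = <-irrefl refl (<-≤-trans (c-good< f b′) (subst (Q ≤_) eq (c-bad≥ b)))
      go (no b) (yes b′) = <-irrefl refl (<-≤-trans (c-good< e b) (subst (Q ≤_) (sym eq) (c-bad≥ b′)))
      go (no b) (no b′) =
        let p , q = digit-inj (suc D) (good< e) (good< f) (trans (sym (c-good b)) (trans eq (c-good b′))) in
        proj₂ (proj₂ (proj₂ (good (g x y)))) (e , refl) (f , sym p) y≢w
          (trans q (cong (λ i → proj₁ (good i) x w) (sym p)))

  total-colouring : Σ (Fin n → Fin n → ℕ) λ c → ProperOn E (Q + suc (3 * D)) c × (∀ {x y} → E x y → c x y ≢ cv x)
  total-colouring = c , c-proper , c-avoids

-- Selection of the alterable edges

-- Closing the gap left by the window of colours from `a` to below `a + w` makes room for at most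
-- `(K ∸ w) * m` labels outside it. Applied to completely filled blocks, it forces the colours of
-- the window to occur.
interval-count : ∀ {n} {T : Fin n → Set} (T? : Decidable T) (s β : Fin n → ℕ) (K m a w : ℕ) → a + w ≤ K →
  (∀ u → T u → s u < K) → (∀ u → T u → β u < m) →
  (∀ u v → T u → T v → s u ≡ s v → β u ≡ β v → u ≡ v) →
  cnt T? ≤ cnt (λ u → T? u ×-dec ((a ≤? s u) ×-dec (s u <? a + w))) + (K ∸ w) * m
interval-count {n} {T} T? s β K m a w aw s< β< inj = ≤-trans (≤-reflexive (cnt-split T? I?))
  (+-monoʳ-≤ (cnt (λ u → T? u ×-dec I? u)) (cnt-bound _ (λ u → relabel (s u) * m + β u) ((K ∸ w) * m) bound inj′))
  where
  I? : ∀ u → Dec (a ≤ s u × s u < a + w)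
  I? u = (a ≤? s u) ×-dec (s u <? a + w)
  relabel : ℕ → ℕ
  relabel x = ifDec (x <? a) x (x ∸ w)
  Out : ℕ → Set
  Out x = ¬ (a ≤ x × x < a + w)
  relabel-cases : ∀ {x} → Out x → (x < a × relabel x ≡ x) ⊎ (a + w ≤ x × relabel x ≡ x ∸ w)
  relabel-cases {x} o with x <? a
  ... | yes p = inj₁ (p , refl)
  ... | no ¬p = inj₂ (≮⇒≥ (λ q → o (≮⇒≥ ¬p , q)) , refl)
  a≤K∸w : a ≤ K ∸ w
  a≤K∸w = m+n≤o⇒m≤o∸n a aw
  relabel< : ∀ {x} → x < K → Out x → relabel x < K ∸ w
  relabel< {x} x< o with relabel-cases o
  ... | inj₁ (p , e) = subst (_< K ∸ w) (sym e) (<-≤-trans p a≤K∸w)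
  ... | inj₂ (p , e) = subst (_< K ∸ w) (sym e) (∸-monoˡ-< x< (≤-trans (m≤n+m w a) p))
  relabel-inj : ∀ {x y} → Out x → Out y → relabel x ≡ relabel y → x ≡ y
  relabel-inj {x} {y} o o′ r with relabel-cases o | relabel-cases o′
  ... | inj₁ (p , e) | inj₁ (q , f) = trans (sym e) (trans r f)
  ... | inj₂ (p , e) | inj₂ (q , f) = ∸-cancelʳ-≡ (≤-trans (m≤n+m w a) p) (≤-trans (m≤n+m w a) q) (trans (sym e) (trans r f))
  ... | inj₁ (p , e) | inj₂ (q , f) = contradiction (trans (sym e) (trans r f)) (<⇒≢ (<-≤-trans p (m+n≤o⇒m≤o∸n a q)))
  ... | inj₂ (p , e) | inj₁ (q , f) = contradiction (sym (trans (sym e) (trans r f))) (<⇒≢ (<-≤-trans q (m+n≤o⇒m≤o∸n a p)))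
  bound : ∀ u → T u × Out (s u) → relabel (s u) * m + β u < (K ∸ w) * m
  bound u (t , o) = begin-strict
    relabel (s u) * m + β u <⟨ +-monoʳ-< _ (β< u t) ⟩
    relabel (s u) * m + m ≡⟨ +-comm _ m ⟩
    suc (relabel (s u)) * m ≤⟨ *-monoˡ-≤ m (relabel< (s< u t) o) ⟩
    (K ∸ w) * m ∎
    where open ≤-Reasoning
  inj′ : ∀ u v → T u × Out (s u) → T v × Out (s v) → relabel (s u) * m + β u ≡ relabel (s v) * m + β v → u ≡ v
  inj′ u v (t , o) (t′ , o′) e =
    let p , q = digit-inj m {{>-nonZero (≤-<-trans z≤n (β< u t))}} (β< u t) (β< v t′) e
    in inj u v t t′ (relabel-inj o o′ p) q

abstract
  -- The factor 5 instead of 4 pays for the earlier neighbours lost to `S₂`: by `mostly` at least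
  -- 9/10 of them remain, and 4/5 is less than (9/10)², which is the estimate in `root-small`.
  fifth-root : ∀ m → ∃[ p ] 5 * (p * p) ≤ m × m < 5 * (suc p * suc p)
  fifth-root zero = 0 , z≤n , s≤s z≤n
  fifth-root (suc m) with fifth-root m
  ... | p , lo , hi with suc m <? 5 * (suc p * suc p)
  ...   | yes lt = p , m≤n⇒m≤1+n lo , lt
  ...   | no ¬lt = suc p , ≮⇒≥ ¬lt , <-≤-trans (s≤s hi)
    (*-monoʳ-< 5 (*-mono-< (n<1+n (suc p)) (n<1+n (suc p))))

module Arithmetic where
  open ≤-Reasoning
  open +-*-Solver

  square-< : ∀ {a b} → a < b → a * a < b * b
  square-< lt = *-mono-< lt lt

  square-≤ : ∀ {a b} → a ≤ b → a * a ≤ b * b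
  square-≤ le = *-mono-≤ le le

  -- The origin of the degree threshold: 14² = 4 · 49, and 49 exceeds 5 · 3² = 45, which is what
  -- `root≥3` needs. A threshold of 13 would give only 43.
  many-back : ∀ {D d b} .{{_ : NonZero D}} → 14 * D ≤ d → d * d ≤ 4 * b * (D * D) → 49 ≤ b
  many-back {D} {d} {b} p q = *-cancelˡ-≤ 4 (*-cancelʳ-≤ 196 (4 * b) (D * D) {{m*n≢0 D D}} (begin
    196 * (D * D) ≡⟨ solve 1 (λ D → con 196 :* (D :* D) := (con 14 :* D) :* (con 14 :* D)) refl D ⟩
    (14 * D) * (14 * D) ≤⟨ square-≤ p ⟩
    d * d ≤⟨ q ⟩
    4 * b * (D * D) ∎))

  root≥3 : ∀ {b p} → 49 ≤ b → b < 5 * (suc p * suc p) → 3 ≤ p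
  root≥3 {b} {p} le lt with 3 ≤? p
  ... | yes q = q
  ... | no ¬q = contradiction (<-≤-trans lt (≤-trans (*-monoʳ-≤ 5 (square-≤ (≰⇒> ¬q))) (m≤n+m 45 4))) (≤⇒≯ le)

  -- Here d² is at most 20(p + 1)²D², and p ≥ 3 bounds (p + 1)² by 16p²/9. Since 320/9 < 36, the
  -- factor 6 suffices.
  degree-root : ∀ {D d b p} → d * d ≤ 4 * b * (D * D) → b < 5 * (suc p * suc p) → 3 ≤ p → d ≤ 6 * D * p
  degree-root {D} {d} {b} {p} q lt p≥3 = ≮⇒≥ λ gt → <-irrefl refl (begin-strict
    9 * (d * d) ≤⟨ *-monoʳ-≤ 9 q ⟩
    9 * (4 * b * (D * D)) ≤⟨ *-monoʳ-≤ 9 (*-monoˡ-≤ (D * D) (*-monoʳ-≤ 4 (<⇒≤ lt))) ⟩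
    9 * (4 * (5 * (suc p * suc p)) * (D * D)) ≡⟨ solve 2 (λ D s → con 9 :* (con 4 :* (con 5 :* (s :* s)) :* (D :* D))
                                                       := con 20 :* ((con 3 :* s) :* (con 3 :* s)) :* (D :* D)) refl D (suc p) ⟩
    20 * ((3 * suc p) * (3 * suc p)) * (D * D) ≤⟨ *-monoˡ-≤ (D * D) (*-monoʳ-≤ 20 (square-≤ three)) ⟩
    20 * ((4 * p) * (4 * p)) * (D * D) ≡⟨ solve 2 (λ D p → con 20 :* ((con 4 :* p) :* (con 4 :* p)) :* (D :* D)
                                                       := con 320 :* (D :* p :* (D :* p))) refl D p ⟩
    320 * (D * p * (D * p)) ≤⟨ *-monoˡ-≤ (D * p * (D * p)) (m≤n+m 320 4) ⟩
    324 * (D * p * (D * p)) ≡⟨ solve 2 (λ D p → con 324 :* (D :* p :* (D :* p))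
                                                       := con 9 :* ((con 6 :* D :* p) :* (con 6 :* D :* p))) refl D p ⟩
    9 * ((6 * D * p) * (6 * D * p)) <⟨ *-monoʳ-< 9 (square-< gt) ⟩
    9 * (d * d) ∎)
    where
    three : 3 * suc p ≤ 4 * p
    three = begin
      3 * suc p ≡⟨ *-suc 3 p ⟩
      3 + 3 * p ≤⟨ +-monoˡ-≤ (3 * p) p≥3 ⟩
      p + 3 * p ≡⟨⟩
      4 * p ∎

  root≤ : ∀ {D b p} → 5 * (p * p) ≤ b → b ≤ D * D → 20 * p ≤ 9 * D
  root≤ {D} {b} {p} lo le = ≮⇒≥ λ gt → <-irrefl refl (begin-strict
    80 * (D * D) ≤⟨ *-monoˡ-≤ (D * D) (m≤n+m 80 1) ⟩
    81 * (D * D) ≡⟨ solve 1 (λ D → con 81 :* (D :* D) := (con 9 :* D) :* (con 9 :* D)) refl D ⟩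
    (9 * D) * (9 * D) <⟨ square-< gt ⟩
    (20 * p) * (20 * p) ≡⟨ solve 1 (λ p → (con 20 :* p) :* (con 20 :* p) := con 80 :* (con 5 :* (p :* p))) refl p ⟩
    80 * (5 * (p * p)) ≤⟨ *-monoʳ-≤ 80 (≤-trans lo le) ⟩
    80 * (D * D) ∎)

  groups≤ : ∀ {h b p} .{{_ : NonZero p}} → h * p ≤ b → b < 5 * (suc p * suc p) → h ≤ 5 * p + 15
  groups≤ {h} {b} {p} le lt = <⇒≤ (*-cancelʳ-< p h (5 * p + 15) (begin-strict
    h * p ≤⟨ le ⟩
    b <⟨ lt ⟩
    5 * (suc p * suc p) ≡⟨ solve 1 (λ p → con 5 :* ((con 1 :+ p) :* (con 1 :+ p)) := con 5 :* (p :* p) :+ con 10 :* p :+ con 5) refl p ⟩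
    5 * (p * p) + 10 * p + 5 ≤⟨ +-monoʳ-≤ (5 * (p * p) + 10 * p) (*-monoʳ-≤ 5 (>-nonZero⁻¹ p)) ⟩
    5 * (p * p) + 10 * p + 5 * p ≡⟨ solve 1 (λ p → con 5 :* (p :* p) :+ con 10 :* p :+ con 5 :* p := (con 5 :* p :+ con 15) :* p) refl p ⟩
    (5 * p + 15) * p ∎))

  next-multiple : ∀ d D .{{_ : NonZero D}} → d < suc (d / D) * D
  next-multiple d D = begin-strict
    d ≡⟨ m≡m%n+[m/n]*n d D ⟩
    d % D + d / D * D <⟨ +-monoˡ-< (d / D * D) (m%n<n d D) ⟩
    D + d / D * D ∎

  enough-general : ∀ {b h₁ h₂ p b′} → 4 * b * (p * p) ≤ b′ * b′ → b′ < suc h₁ * p → b′ < suc h₂ * p →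
                   4 * b < suc h₁ * suc h₂
  enough-general {b} {h₁} {h₂} {p} {b′} le l₁ l₂ = *-cancelʳ-< (p * p) (4 * b) (suc h₁ * suc h₂) (begin-strict
    4 * b * (p * p) ≤⟨ le ⟩
    b′ * b′ <⟨ *-mono-< l₁ l₂ ⟩
    (suc h₁ * p) * (suc h₂ * p) ≡⟨ solve 3 (λ s t p → (s :* p) :* (t :* p) := s :* t :* (p :* p)) refl (suc h₁) (suc h₂) p ⟩
    suc h₁ * suc h₂ * (p * p) ∎)

  -- With D ≥ 240 the loss is at most b/60 + 4, and b ≥ 49 makes this smaller than b/10.
  mostly : ∀ {D b b′} → 240 ≤ D → .{{_ : NonZero D}} → 49 ≤ b → b ≤ b′ + 4 * suc (b / D) → 9 * b ≤ 10 * b′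
  mostly {D} {b} {b′} D≥ b≥ le = +-cancelʳ-≤ b (9 * b) (10 * b′) (begin
    9 * b + b ≡⟨ +-comm (9 * b) b ⟩
    10 * b ≤⟨ *-monoʳ-≤ 10 le ⟩
    10 * (b′ + 4 * suc (b / D)) ≡⟨ solve 2 (λ x y → con 10 :* (x :+ con 4 :* (con 1 :+ y)) := con 10 :* x :+ (con 40 :* y :+ con 40)) refl b′ (b / D) ⟩
    10 * b′ + (40 * (b / D) + 40) ≤⟨ +-monoʳ-≤ (10 * b′) (*-cancelˡ-≤ 6 (begin
       6 * (40 * (b / D) + 40) ≡⟨ solve 1 (λ y → con 6 :* (con 40 :* y :+ con 40) := con 240 :* y :+ con 240) refl (b / D) ⟩
       240 * (b / D) + 240 ≤⟨ +-mono-≤ (≤-trans (*-monoˡ-≤ (b / D) D≥) (≤-trans (≤-reflexive (*-comm D (b / D))) (m/n*n≤m b D)))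
                                              (≤-trans (m≤n+m 240 5) (*-monoʳ-≤ 5 b≥)) ⟩
       b + 5 * b ≡⟨⟩
       6 * b ∎)) ⟩
    10 * b′ + b ∎)

  root-small : ∀ {b b′ p} → 5 * (p * p) ≤ b → 9 * b ≤ 10 * b′ → 4 * b * (p * p) ≤ b′ * b′
  root-small {b} {b′} {p} lo le = *-cancelˡ-≤ 100 (begin
    100 * (4 * b * (p * p)) ≡⟨ solve 2 (λ b p → con 100 :* (con 4 :* b :* (p :* p)) := con 80 :* b :* (con 5 :* (p :* p))) refl b p ⟩
    80 * b * (5 * (p * p)) ≤⟨ *-monoʳ-≤ (80 * b) lo ⟩
    80 * b * b ≤⟨ *-monoˡ-≤ b (*-monoˡ-≤ b (m≤n+m 80 1)) ⟩
    81 * b * b ≡⟨ solve 1 (λ b → con 81 :* b :* b := (con 9 :* b) :* (con 9 :* b)) refl b ⟩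
    (9 * b) * (9 * b) ≤⟨ square-≤ le ⟩
    (10 * b′) * (10 * b′) ≡⟨ solve 1 (λ b → (con 10 :* b) :* (con 10 :* b) := con 100 :* (b :* b)) refl b′ ⟩
    100 * (b′ * b′) ∎)

  by-degree : ∀ {D d b} .{{_ : NonZero D}} → 4 * b * (D * D) < d * d → 4 * b < suc (d / D) * suc (d / D)
  by-degree {D} {d} {b} lt = enough-general {b} {d / D} {d / D} {D} {d} (<⇒≤ lt) (next-multiple d D) (next-multiple d D)

  -- `h` stands for the arcs leaving a vertex, `6 * D` for those entering it, and the last summand
  -- for one rounding error per group size. Together they are at most 8.7 D + 16.
  total-degree : ∀ {D p h} → 240 ≤ D → 20 * p ≤ 9 * D → h ≤ 5 * p + 15 →
                 h + (6 * D + suc (9 * D / 20)) ≤ 9 * D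
  total-degree {D} {p} {h} D≥ p≤ h≤ = *-cancelˡ-≤ 20 (begin
    20 * (h + (6 * D + suc X)) ≤⟨ *-monoʳ-≤ 20 (+-monoˡ-≤ (6 * D + suc X) h≤) ⟩
    20 * (5 * p + 15 + (6 * D + suc X)) ≡⟨ solve 3 (λ p D X → con 20 :* (con 5 :* p :+ con 15 :+ (con 6 :* D :+ (con 1 :+ X)))
                                                 := con 5 :* (con 20 :* p) :+ X :* con 20 :+ (con 120 :* D :+ con 320)) refl p D X ⟩
    5 * (20 * p) + X * 20 + (120 * D + 320) ≤⟨ +-mono-≤ (+-mono-≤ (*-monoʳ-≤ 5 p≤) (m/n*n≤m (9 * D) 20))
                                                 (+-monoʳ-≤ (120 * D) (≤-trans (m≤n+m 320 400) (*-monoʳ-≤ 3 D≥))) ⟩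
    5 * (9 * D) + 9 * D + (120 * D + 3 * D) ≤⟨ ≤-reflexive (solve 1 (λ D → con 5 :* (con 9 :* D) :+ con 9 :* D :+ (con 120 :* D :+ con 3 :* D) := con 177 :* D) refl D) ⟩
    177 * D ≤⟨ *-monoˡ-≤ D (m≤n+m 177 3) ⟩
    180 * D ≡⟨ *-assoc 20 9 D ⟩
    20 * (9 * D) ∎)
    where X = 9 * D / 20

module Selection {n : ℕ} (E : Fin n → Fin n → Set) (E? : ∀ x y → Dec (E x y))
    (E-sym : ∀ {x y} → E x y → E y x) (E-irr : ∀ {x} → ¬ E x x)
    (D : ℕ) .{{_ : NonZero D}} (D≥ : 240 ≤ D) (deg≤ : ∀ v → cnt (E? v) ≤ D * D) where

  deg : Fin n → ℕ
  deg v = cnt (E? v)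

  -- An inner vertex still receives colours in the last greedy phase, which also separates it from
  -- its high neighbours. It is therefore left out of `Back`, and its cell need not be avoided.
  High Low Inner : Fin n → Set
  High v  = 14 * D ≤ deg v
  Low v   = ¬ High v
  Inner x = Low x × ∃[ z ] E x z × Low z

  abstract
    High? : ∀ v → Dec (High v)
    High? v = 14 * D ≤? deg v

  abstract
    Inner? : ∀ x → Dec (Inner x)
    Inner? x = ¬? (High? x) ×-dec any? (λ z → E? x z ×-dec ¬? (High? z))

  open Lex deg public

  Back : Fin n → Fin n → Set
  Back v u = E v u × ¬ Inner u × κ u < κ v

  abstract
    Back? : ∀ v u → Dec (Back v u)
    Back? v u = E? v u ×-dec ¬? (Inner? u) ×-dec (κ u <? κ v)

  b : Fin n → ℕ
  b v = cnt (Back? v)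

  Outer : Fin n → Fin n → Set
  Outer v u = E v u × (High v ⊎ High u)

  abstract
    Outer? : ∀ v u → Dec (Outer v u)
    Outer? v u = E? v u ×-dec (High? v ⊎-dec High? u)

  Outer-sym : ∀ {v u} → Outer v u → Outer u v
  Outer-sym (e , inj₁ h) = E-sym e , inj₂ h
  Outer-sym (e , inj₂ h) = E-sym e , inj₁ h

  Outer-deg : ∀ v → cnt (Outer? v) ≤ D * D
  Outer-deg v = ≤-trans (cnt-mono (Outer? v) (E? v) (λ _ → proj₁)) (deg≤ v)

  -- Sorting the earlier neighbours first keeps them in few blocks, so S₂ uses up only few of them.
  late : Fin n → Fin n → ℕ
  late v u = 1 ∸ bit (Back? v u)

  module κ₂ v = Lex (late v)
  module R₂ v = Rank (Outer? v) (κ₂.κ v) (κ₂.κ-inj v)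

  β₂ : Fin n → Fin n → ℕ
  β₂ v u = R₂.rank v u / D

  abstract
    split₂ : Σ (Fin n → Fin n → ℕ) (Graphs.BlockProper Outer Outer? Outer-sym (λ (e , _) → E-irr e) (suc D) β₂)
    split₂ = Graphs.Split.split-vizing Outer Outer? Outer-sym (λ (e , _) → E-irr e) D (suc n) β₂
      (λ v u → s≤s (≤-trans (m/n≤m _ D) (R₂.rank≤n v u)))
      (λ v j → R₂.block-≤ v D j)

  s₂ : Fin n → Fin n → ℕ
  s₂ = proj₁ split₂

  s₂-sym : ∀ {v u} → Outer v u → s₂ v u ≡ s₂ u v
  s₂-sym = proj₁ (proj₂ (proj₂ split₂))

  s₂-inj : ∀ {v u w} → Outer v u → Outer v w → s₂ v u ≡ s₂ v w → β₂ v u ≡ β₂ v w → u ≡ w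
  s₂-inj {v} {u} {w} e f p q = decidable-stable (u Fin.≟ w) (λ ¬r → proj₂ (proj₂ (proj₂ split₂)) e f ¬r q p)

  β₂<D : ∀ {v u} → Outer v u → β₂ v u < D
  β₂<D {v} e = m<n*o⇒m/o<n (<-≤-trans (R₂.rank<cnt v e) (Outer-deg v))

  -- Selected edges which both ends may alter, in steps of size 1 for k = 0 and of size M for k = 1.
  S₂ : ℕ → Fin n → Fin n → Set
  S₂ k v u = Outer v u × s₂ v u / 2 ≡ k

  abstract
    S₂? : ∀ k v u → Dec (S₂ k v u)
    S₂? k v u = Outer? v u ×-dec (s₂ v u / 2 ≟ k)

  S₂-sym : ∀ {k v u} → S₂ k v u → S₂ k u v
  S₂-sym (e , p) = Outer-sym e , trans (cong (_/ 2) (sym (s₂-sym e))) p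

  halves : ∀ {x y} → x / 2 ≡ y / 2 → x % 2 ≡ y % 2 → x ≡ y
  halves {x} {y} p q = trans (m≡m%n+[m/n]*n x 2) (trans (cong₂ (λ r s → r + s * 2) q p) (sym (m≡m%n+[m/n]*n y 2)))

  S₂-deg : ∀ k v → cnt (S₂? k v) ≤ 2 * D
  S₂-deg k v = cnt-bound (S₂? k v) (λ u → s₂ v u % 2 * D + β₂ v u) (2 * D)
    (λ u (e , _) → begin-strict
      s₂ v u % 2 * D + β₂ v u <⟨ +-monoʳ-< (s₂ v u % 2 * D) (β₂<D e) ⟩
      s₂ v u % 2 * D + D ≡⟨ +-comm (s₂ v u % 2 * D) D ⟩
      suc (s₂ v u % 2) * D ≤⟨ *-monoˡ-≤ D (m%n<n (s₂ v u) 2) ⟩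
      2 * D ∎)
    (λ u w (e , p) (f , q) r → let r₁ , r₂ = digit-inj D (β₂<D e) (β₂<D f) r in
      s₂-inj e f (halves (trans p (sym q)) r₁) r₂)
    where open ≤-Reasoning

  -- A full block of `D` edges shows all but one of the `suc D` colours, hence at least one of any
  -- two. This is why each `S₂ k` is made of two colours of Vizing's colouring.
  S₂-own : ∀ k → k < 2 → ∀ v → High v → deg v / D ≤ cnt (S₂? k v)
  S₂-own k k<2 v hv = +-cancelʳ-≤ ((suc D ∸ 2) * m) m _ (begin
    m + (suc D ∸ 2) * m ≡⟨ cong (λ z → z * m) (m+[n∸m]≡n {1} {D} (>-nonZero⁻¹ D)) ⟩
    D * m ≡⟨ *-comm D m ⟩
    m * D ≤⟨ R₂.cnt-rank≥ v (m * D) (begin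
                                            m * D ≤⟨ m/n*n≤m (deg v) D ⟩
                                            deg v ≤⟨ cnt-mono (E? v) (Outer? v) (λ u e → e , inj₁ hv) ⟩
                                            cnt (Outer? v) ∎) ⟩
    cnt T? ≤⟨ interval-count T? (s₂ v) (β₂ v) (suc D) m (2 * k) 2 room
                                            (λ u (e , _) → proj₁ (proj₂ split₂) e)
                                            (λ u (_ , r) → m<n*o⇒m/o<n r)
                                            (λ u w (e , _) (f , _) → s₂-inj e f) ⟩
    cnt J? + (suc D ∸ 2) * m ≤⟨ +-monoˡ-≤ ((suc D ∸ 2) * m) (cnt-mono J? (S₂? k v) sub) ⟩
    cnt (S₂? k v) + (suc D ∸ 2) * m ∎)
    where
    open ≤-Reasoning
    m = deg v / D
    T? : ∀ u → Dec (Outer v u × R₂.rank v u < m * D)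
    T? u = Outer? v u ×-dec (R₂.rank v u <? m * D)
    J? : ∀ u → Dec ((Outer v u × R₂.rank v u < m * D) × (2 * k ≤ s₂ v u × s₂ v u < 2 * k + 2))
    J? u = T? u ×-dec ((2 * k ≤? s₂ v u) ×-dec (s₂ v u <? 2 * k + 2))
    room : 2 * k + 2 ≤ suc D
    room = ≤-trans (+-monoˡ-≤ 2 (*-monoʳ-≤ 2 (≤-pred k<2))) (≤-trans (m≤n+m 4 236) (m≤n⇒m≤1+n D≥))
    sub : ∀ u → (Outer v u × R₂.rank v u < m * D) × (2 * k ≤ s₂ v u × s₂ v u < 2 * k + 2) → S₂ k v u
    sub u ((e , _) , lo , hi) = e , ≤-antisym
      (≤-pred (m<n*o⇒m/o<n (<-≤-trans hi (≤-reflexive (trans (+-comm (2 * k) 2) (cong (2 +_) (*-comm 2 k)))))))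
      (≤-trans (≤-reflexive (trans (sym (m*n/n≡m k 2)) (cong (_/ 2) (*-comm k 2)))) (/-monoˡ-≤ 2 lo))

  abstract
    S₂′? : ∀ v u → Dec (S₂ 0 v u ⊎ S₂ 1 v u)
    S₂′? v u = S₂? 0 v u ⊎-dec S₂? 1 v u

  S₂-back : ∀ v → High v → cnt (λ u → Back? v u ×-dec S₂′? v u) ≤ 4 * suc (b v / D)
  S₂-back v hv = cnt-bound _ (λ u → s₂ v u * suc (b v / D) + β₂ v u) (4 * suc (b v / D))
    (λ u (bk , s) → begin-strict
      s₂ v u * suc (b v / D) + β₂ v u <⟨ +-monoʳ-< (s₂ v u * suc (b v / D)) (early u bk) ⟩
      s₂ v u * suc (b v / D) + suc (b v / D) ≡⟨ +-comm (s₂ v u * suc (b v / D)) _ ⟩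
      suc (s₂ v u) * suc (b v / D) ≤⟨ *-monoˡ-≤ (suc (b v / D)) (small u s) ⟩
      4 * suc (b v / D) ∎)
    (λ u w (bk , s) (bk′ , s′) r → let r₁ , r₂ = digit-inj (suc (b v / D)) (early u bk) (early w bk′) r in
      s₂-inj (outer u bk) (outer w bk′) r₁ r₂)
    where
    open ≤-Reasoning
    outer : ∀ u → Back v u → Outer v u
    outer u (e , _) = e , inj₁ hv
    small : ∀ u → S₂ 0 v u ⊎ S₂ 1 v u → suc (s₂ v u) ≤ 4
    small u (inj₁ (_ , p)) = ≤-trans (m/n≡0⇒m<n {s₂ v u} {2} p) (m≤n+m 2 2)
    small u (inj₂ (_ , p)) = ≰⇒> λ le → case ≤-trans (/-monoˡ-≤ 2 le) (≤-reflexive p) of λ { (s≤s ()) }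
    early : ∀ u → Back v u → β₂ v u < suc (b v / D)
    early u bk = s≤s (/-monoˡ-≤ D (R₂.rank-bound v (Back? v)
      (λ w _ lt → decidable-stable (Back? v w) λ ¬bk → <-irrefl refl (begin-strict
        0 ≡⟨ cong (1 ∸_) (bit-yes (Back? v u) bk) ⟨
        late v u <⟨ ≤-reflexive (cong suc (cong (1 ∸_) (bit-yes (Back? v u) bk))) ⟩
        1 ≡⟨ cong (1 ∸_) (bit-no (Back? v w) ¬bk) ⟨
        late v w ≤⟨ κ₂.κ-≤ v lt ⟩
        late v u ≡⟨ cong (1 ∸_) (bit-yes (Back? v u) bk) ⟩
        0 ∎))))

  root : Fin n → ℕ
  root v = proj₁ (fifth-root (b v))

  -- The size of the owner groups of v; the successor only serves to make it visibly nonzero.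
  p⁻ p : Fin n → ℕ
  p⁻ v = pred (root v)
  p v = suc (p⁻ v)

  -- For the other high vertices, S₂ alone contains enough edges.
  Needy : Fin n → Set
  Needy v = High v × deg v * deg v ≤ 4 * b v * (D * D)

  abstract
    Needy? : ∀ v → Dec (Needy v)
    Needy? v = High? v ×-dec (deg v * deg v ≤? 4 * b v * (D * D))

  needy-b : ∀ {v} → Needy v → 49 ≤ b v
  needy-b {v} (h , le) = Arithmetic.many-back {D} {deg v} {b v} h le

  needy-root : ∀ {v} → Needy v → 3 ≤ root v
  needy-root {v} nv = Arithmetic.root≥3 (needy-b nv) (proj₂ (proj₂ (fifth-root (b v))))

  p≡root : ∀ {v} → Needy v → p v ≡ root v
  p≡root {v} nv = suc-pred (root v) {{>-nonZero (≤-trans (s≤s z≤n) (needy-root nv))}}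

  p-lo : ∀ {v} → Needy v → 5 * (p v * p v) ≤ b v
  p-lo {v} nv = subst (λ z → 5 * (z * z) ≤ b v) (sym (p≡root nv)) (proj₁ (proj₂ (fifth-root (b v))))

  p-hi : ∀ {v} → Needy v → b v < 5 * (suc (p v) * suc (p v))
  p-hi {v} nv = subst (λ z → b v < 5 * (suc z * suc z)) (sym (p≡root nv)) (proj₂ (proj₂ (fifth-root (b v))))

  deg≤p : ∀ {v} → Needy v → deg v ≤ 6 * D * p v
  deg≤p {v} nv = Arithmetic.degree-root {D} {deg v} {b v} {p v} (proj₂ nv) (p-hi nv) (subst (3 ≤_) (sym (p≡root nv)) (needy-root nv))

  b≤ : ∀ v → b v ≤ D * D
  b≤ v = ≤-trans (cnt-mono (Back? v) (E? v) (λ _ → proj₁)) (deg≤ v)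

  p≤ : ∀ {v} → Needy v → 20 * p v ≤ 9 * D
  p≤ {v} nv = Arithmetic.root≤ {D} {b v} {p v} (p-lo nv) (b≤ v)

  Cand : Fin n → Fin n → Set
  Cand v u = Back v u × ¬ (S₂ 0 v u ⊎ S₂ 1 v u)

  abstract
    Cand? : ∀ v u → Dec (Cand v u)
    Cand? v u = Back? v u ×-dec ¬? (S₂′? v u)

  module R₁ v = Rank (Cand? v) toℕ (λ _ _ → toℕ-injective)

  h : Fin n → ℕ
  h v = cnt (Cand? v) / p v

  -- The incomplete last group is dropped: every group then has exactly `p v` edges, and a colouring
  -- with `p v` colours shows each colour in it exactly once.
  Arc : Fin n → Fin n → Set
  Arc v u = Needy v × Cand v u × R₁.rank v u < h v * p v

  abstract
    Arc? : ∀ v u → Dec (Arc v u)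
    Arc? v u = Needy? v ×-dec Cand? v u ×-dec (R₁.rank v u <? h v * p v)

  Arc-asym : ∀ {v u} → Arc v u → ¬ Arc u v
  Arc-asym (_ , ((_ , _ , lt) , _) , _) (_ , ((_ , _ , gt) , _) , _) = <-asym lt gt

  group : Fin n → Fin n → ℕ
  group v u = R₁.rank v u / p v

  group<h : ∀ {v u} → Arc v u → group v u < h v
  group<h (_ , _ , lt) = m<n*o⇒m/o<n lt

  -- The arcs whose owner uses groups of size suc k form a bipartite graph between owner groups and
  -- blocks of incoming arcs.
  module Level (k : ℕ) where

    abstract
      In? : ∀ u v → Dec (Arc v u × p⁻ v ≡ k)
      In? u v = Arc? v u ×-dec (p⁻ v ≟ k)

    module Rᵢ u = Rank (In? u) toℕ (λ _ _ → toℕ-injective)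

    F : Fin n → Fin n → Set
    F x y = (Arc x y × p⁻ x ≡ k) ⊎ (Arc y x × p⁻ y ≡ k)

    abstract
      F? : ∀ x y → Dec (F x y)
      F? x y = In? y x ⊎-dec In? x y

    F-sym : ∀ {x y} → F x y → F y x
    F-sym (inj₁ a) = inj₂ a
    F-sym (inj₂ a) = inj₁ a

    F-irr : ∀ {x} → ¬ F x x
    F-irr (inj₁ ((_ , ((e , _) , _) , _) , _)) = E-irr e
    F-irr (inj₂ ((_ , ((e , _) , _) , _) , _)) = E-irr e

    chunk : Fin n → Fin n → ℕ
    chunk u v = Rᵢ.rank u v / suc k

    -- Even copies of a vertex carry its owner groups and odd copies its blocks of incoming arcs, so
    -- the parity of the copy is the bipartition to which König's theorem is applied.
    β : Fin n → Fin n → ℕ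
    β x y = ifDec (Arc? x y) (R₁.rank x y / suc k * 2) (suc (chunk x y * 2))

    β-owner : ∀ {x y} → Arc x y → β x y ≡ R₁.rank x y / suc k * 2
    β-owner {x} {y} a = ifDec-yes (Arc? x y) a

    β-other : ∀ {x y} → Arc y x → β x y ≡ suc (chunk x y * 2)
    β-other {x} {y} a = ifDec-no (Arc? x y) (Arc-asym a)

    even : ℕ → Bool
    even zero    = true
    even (suc m) = not (even m)

    even-double : ∀ m → even (m * 2) ≡ true
    even-double zero    = refl
    even-double (suc m) = trans (Bool.not-involutive (even (m * 2))) (even-double m)

    even-owner : ∀ {x y} → Arc x y → even (β x y) ≡ true
    even-owner {x} {y} a = trans (cong even (β-owner a)) (even-double (R₁.rank x y / suc k))

    even-other : ∀ {x y} → Arc y x → even (β x y) ≡ false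
    even-other {x} {y} a = trans (cong even (β-other a)) (cong not (even-double (chunk x y)))

    bip : ∀ {x y} → F x y → even (β x y) ≡ not (even (β y x))
    bip (inj₁ (a , _)) = trans (even-owner a) (sym (cong not (even-other a)))
    bip (inj₂ (a , _)) = trans (even-other a) (sym (cong not (even-owner a)))

    β< : ∀ x y → β x y < 2 + n * 2
    β< x y with Arc? x y
    ... | yes _ = ≤-trans (s≤s (*-monoˡ-≤ 2 (≤-trans (m/n≤m _ (suc k)) (R₁.rank≤n x y)))) (n≤1+n _)
    ... | no _  = s≤s (s≤s (*-monoˡ-≤ 2 (≤-trans (m/n≤m _ (suc k)) (Rᵢ.rank≤n x y))))

    fibre : ∀ x j → cnt (λ y → F? x y ×-dec (β x y ≟ j)) ≤ suc k
    fibre x j = go (even j) refl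
      where
      go : ∀ t → even j ≡ t → cnt (λ y → F? x y ×-dec (β x y ≟ j)) ≤ suc k
      go true ev = ≤-trans (cnt-mono _ (λ y → Cand? x y ×-dec (R₁.rank x y / suc k ≟ j / 2)) own) (R₁.block-≤ x (suc k) (j / 2))
        where
        own : ∀ y → F x y × β x y ≡ j → Cand x y × R₁.rank x y / suc k ≡ j / 2
        own y (inj₁ (a , _) , e) = proj₁ (proj₂ a) ,
          trans (sym (m*n/n≡m (R₁.rank x y / suc k) 2)) (cong (_/ 2) (trans (sym (β-owner a)) e))
        own y (inj₂ (a , _) , e) = contradiction (trans (sym ev) (trans (cong even (sym e)) (even-other a))) (λ ())
      go false ev = ≤-trans (cnt-mono _ (λ y → In? x y ×-dec (chunk x y ≟ pred j / 2)) other) (Rᵢ.block-≤ x (suc k) (pred j / 2))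
        where
        other : ∀ y → F x y × β x y ≡ j → (Arc y x × p⁻ y ≡ k) × chunk x y ≡ pred j / 2
        other y (inj₁ (a , _) , e) = contradiction (trans (sym ev) (trans (cong even (sym e)) (even-owner a))) (λ ())
        other y (inj₂ (a , q) , e) = (a , q) ,
          trans (sym (m*n/n≡m (chunk x y) 2)) (cong (_/ 2) (cong pred (trans (sym (β-other a)) e)))

    abstract
      split₁ : Σ (Fin n → Fin n → ℕ) (Graphs.BlockProper F F? F-sym F-irr (suc k) β)
      split₁ = Graphs.Split.split-könig F F? F-sym F-irr (suc k) (2 + n * 2) β β< fibre even bip

    s : Fin n → Fin n → ℕ
    s = proj₁ split₁

    s< : ∀ {v u} → F v u → s v u < suc k
    s< = proj₁ (proj₂ split₁)

    s-sym : ∀ {v u} → F v u → s v u ≡ s u v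
    s-sym = proj₁ (proj₂ (proj₂ split₁))

    s-inj : ∀ {v u w} → F v u → F v w → s v u ≡ s v w → β v u ≡ β v w → u ≡ w
    s-inj {v} {u} {w} e f p q = decidable-stable (u Fin.≟ w) (λ ¬r → proj₂ (proj₂ (proj₂ split₁)) e f ¬r q p)

  s₁ : Fin n → Fin n → ℕ
  s₁ v u = Level.s (p⁻ v) v u

  s₁-inj : ∀ {v u w} → Arc v u → Arc v w → s₁ v u ≡ s₁ v w → group v u ≡ group v w → u ≡ w
  s₁-inj {v} a a′ p q = Level.s-inj (p⁻ v) (inj₁ (a , refl)) (inj₁ (a′ , refl)) p
    (trans (Level.β-owner (p⁻ v) a) (trans (cong (_* 2) q) (sym (Level.β-owner (p⁻ v) a′))))

  -- Selected edges which only the later end v may alter.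
  S₁ : ℕ → Fin n → Fin n → Set
  S₁ k v u = Arc v u × s₁ v u ≡ k

  abstract
    S₁? : ∀ k v u → Dec (S₁ k v u)
    S₁? k v u = Arc? v u ×-dec (s₁ v u ≟ k)

  S₁-own≤ : ∀ k v → cnt (S₁? k v) ≤ h v
  S₁-own≤ k v = cnt-bound (S₁? k v) (group v) (h v) (λ u (a , _) → group<h a)
    (λ u w (a , e) (a′ , e′) r → s₁-inj a a′ (trans e (sym e′)) r)

  -- König's theorem needs no extra colour, so in contrast to `S₂` a single colour already meets
  -- every full group.
  S₁-own≥ : ∀ k → k < 2 → ∀ {v} → Needy v → h v ≤ cnt (S₁? k v)
  S₁-own≥ k k<2 {v} nv = +-cancelʳ-≤ (p⁻ v * h v) (h v) _ (begin
    p v * h v ≡⟨ *-comm (p v) (h v) ⟩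
    h v * p v ≤⟨ R₁.cnt-rank≥ v (h v * p v) (m/n*n≤m (cnt (Cand? v)) (p v)) ⟩
    cnt T? ≤⟨ interval-count T? (s₁ v) (group v) (p v) (h v) k 1 room
                                     (λ u t → Level.s< (p⁻ v) (inj₁ (arc t , refl)))
                                     (λ u t → group<h (arc t)) (λ u w t t′ → s₁-inj (arc t) (arc t′)) ⟩
    cnt J? + p⁻ v * h v ≤⟨ +-monoˡ-≤ (p⁻ v * h v) (cnt-mono J? (S₁? k v)
                                     (λ u (t , lo , hi) → arc t , ≤-antisym (≤-pred (≤-trans hi (≤-reflexive (+-comm k 1)))) lo)) ⟩
    cnt (S₁? k v) + p⁻ v * h v ∎)
    where
    open ≤-Reasoning
    T? : ∀ u → Dec (Cand v u × R₁.rank v u < h v * p v)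
    T? u = Cand? v u ×-dec (R₁.rank v u <? h v * p v)
    arc : ∀ {u} → Cand v u × R₁.rank v u < h v * p v → Arc v u
    arc t = nv , t
    J? : ∀ u → Dec ((Cand v u × R₁.rank v u < h v * p v) × (k ≤ s₁ v u × s₁ v u < k + 1))
    J? u = T? u ×-dec ((k ≤? s₁ v u) ×-dec (s₁ v u <? k + 1))
    room : k + 1 ≤ p v
    room = ≤-trans (≤-reflexive (+-comm k 1)) (≤-trans k<2 (≤-trans (n≤1+n 2) (subst (3 ≤_) (sym (p≡root nv)) (needy-root nv))))

  levels : ℕ
  levels = suc (9 * D / 20)

  level< : ∀ {v} → Needy v → p⁻ v < levels
  level< {v} nv = s≤s (≤-trans (n≤1+n (p⁻ v)) (*-cancelʳ-≤′ (p≤ nv)))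
    where
    *-cancelʳ-≤′ : 20 * p v ≤ 9 * D → p v ≤ 9 * D / 20
    *-cancelʳ-≤′ le = ≤-trans (≤-reflexive (trans (sym (m*n/n≡m (p v) 20)) (cong (_/ 20) (*-comm (p v) 20)))) (/-monoˡ-≤ 20 le)

  -- At each level `u` loses one edge per block of incoming arcs. Full blocks are counted by `X`,
  -- and the incomplete ones cost one per level. Arcs of level `i` enter `u` only if `deg u` is at
  -- most `6 * D * suc i`, so `deg u * X χ` is at most `6 * D * f χ`; summing over the levels, where
  -- the `f χ` add up to at most `deg u`, and cancelling `deg u` bounds the full blocks by `6 * D`.
  S₁-load : ∀ k u → cnt (λ v → S₁? k v u) ≤ 6 * D + levels
  S₁-load k u = begin
    cnt (λ v → S₁? k v u) ≡⟨ cnt-fibre (λ v → S₁? k v u) p⁻ levels (λ v ((nv , _) , _) → level< nv) ⟩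
    sum {levels} (λ χ → cnt (λ v → S₁? k v u ×-dec (p⁻ v ≟ toℕ χ))) ≤⟨ sum-mono {levels} (λ χ → one (toℕ χ)) ⟩
    sum {levels} (λ χ → X χ + 1) ≡⟨ ∑-distrib-+ {levels} X (λ _ → 1) ⟩
    sum X + sum {levels} (λ _ → 1) ≤⟨ +-mono-≤ X≤ (≤-trans (sum-bound {levels} {h = 1} (λ _ → ≤-refl)) (≤-reflexive (*-identityʳ levels))) ⟩
    6 * D + levels ∎
    where
    open ≤-Reasoning
    f : Fin levels → ℕ
    f χ = cnt (Level.In? (toℕ χ) u)
    X : Fin levels → ℕ
    X χ = f χ / suc (toℕ χ)
    one : ∀ i → cnt (λ v → S₁? k v u ×-dec (p⁻ v ≟ i)) ≤ cnt (Level.In? i u) / suc i + 1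
    one i = cnt-bound _ (Level.chunk i u) _
      (λ v ((a , _) , e) → ≤-trans (s≤s (/-monoˡ-≤ (suc i) (<⇒≤ (Level.Rᵢ.rank<cnt i u (a , e))))) (≤-reflexive (+-comm 1 _)))
      (λ { v w ((a , e) , refl) ((a′ , e′) , q) r → Level.s-inj i (inj₂ (a , refl)) (inj₂ (a′ , q))
         (trans (sym (Level.s-sym i (inj₁ (a , refl)))) (trans e (trans (sym e′)
           (trans (cong (λ z → Level.s z w u) q) (Level.s-sym i (inj₁ (a′ , q)))))))
         (trans (Level.β-other i a) (trans (cong (λ z → suc (z * 2)) r) (sym (Level.β-other i a′)))) })
    weigh : ∀ χ → deg u * X χ ≤ 6 * D * f χ
    weigh χ = go (any? (Level.In? (toℕ χ) u))
      where
      go : Dec (∃[ v ] Arc v u × p⁻ v ≡ toℕ χ) → deg u * X χ ≤ 6 * D * f χ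
      go (no none) = ≤-trans (≤-reflexive (trans (cong (deg u *_) (trans (cong (_/ suc (toℕ χ))
                      (cnt-none (Level.In? (toℕ χ) u) (λ v a → none (v , a)))) (0/n≡0 (suc (toℕ χ))))) (*-zeroʳ (deg u)))) z≤n
      go (yes (v , (nv , ((_ , _ , lt) , _) , _) , e)) = begin
        deg u * X χ ≤⟨ *-monoˡ-≤ (X χ) (≤-trans (κ-≤ lt) (deg≤p nv)) ⟩
        6 * D * p v * X χ ≡⟨ cong (λ z → 6 * D * suc z * X χ) e ⟩
        6 * D * suc (toℕ χ) * X χ ≡⟨ *-assoc (6 * D) (suc (toℕ χ)) (X χ) ⟩
        6 * D * (suc (toℕ χ) * X χ) ≡⟨ cong (6 * D *_) (*-comm (suc (toℕ χ)) (X χ)) ⟩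
        6 * D * (X χ * suc (toℕ χ)) ≤⟨ *-monoʳ-≤ (6 * D) (m/n*n≤m (f χ) (suc (toℕ χ))) ⟩
        6 * D * f χ ∎
    Σf : sum f ≤ deg u
    Σf = begin
      sum f ≤⟨ sum-mono {levels} (λ χ → cnt-mono (Level.In? (toℕ χ) u) (λ v → Arc? v u ×-dec (p⁻ v ≟ toℕ χ)) (λ _ x → x)) ⟩
      sum {levels} (λ χ → cnt (λ v → Arc? v u ×-dec (p⁻ v ≟ toℕ χ))) ≡⟨ cnt-fibre (λ v → Arc? v u) p⁻ levels (λ v (nv , _) → level< nv) ⟨
      cnt (λ v → Arc? v u) ≤⟨ cnt-mono (λ v → Arc? v u) (E? u) (λ v (_ , ((e , _) , _) , _) → E-sym e) ⟩
      deg u ∎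
    X≤ : sum X ≤ 6 * D
    X≤ = go (deg u ≟ 0)
      where
      go : Dec (deg u ≡ 0) → sum X ≤ 6 * D
      go (no d≢0) = *-cancelˡ-≤ (deg u) {{≢-nonZero d≢0}} (begin
        deg u * sum X ≡⟨ sum-* {levels} (deg u) X ⟨
        sum {levels} (λ χ → deg u * X χ) ≤⟨ sum-mono {levels} weigh ⟩
        sum {levels} (λ χ → 6 * D * f χ) ≡⟨ sum-* {levels} (6 * D) f ⟩
        6 * D * sum f ≤⟨ *-monoʳ-≤ (6 * D) Σf ⟩
        6 * D * deg u ≡⟨ *-comm (6 * D) (deg u) ⟩
        deg u * (6 * D) ∎)
      go (yes d≡0) = ≤-trans (≤-reflexive (sum-zero {levels} (λ χ → trans (cong (_/ suc (toℕ χ))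
            (n≤0⇒n≡0 (≤-trans (cnt-mono (Level.In? (toℕ χ) u) (E? u) (λ v ((_ , ((e , _) , _) , _) , _) → E-sym e)) (≤-reflexive d≡0))))
            (0/n≡0 (suc (toℕ χ)))))) z≤n

  S₁-deg : ∀ k x → cnt (λ y → S₁? k x y ⊎-dec S₁? k y x) ≤ 9 * D
  S₁-deg k x = ≤-trans (cnt-⊎ (S₁? k x) (λ y → S₁? k y x)) (go (Needy? x))
    where
    go : Dec (Needy x) → cnt (S₁? k x) + cnt (λ y → S₁? k y x) ≤ 9 * D
    go (yes nx) = ≤-trans (+-mono-≤ (S₁-own≤ k x) (S₁-load k x)) (Arithmetic.total-degree {D} {p x} {h x} D≥ (p≤ nx)
      (Arithmetic.groups≤ {h x} {b x} {p x} (≤-trans (m/n*n≤m (cnt (Cand? x)) (p x)) (cnt-mono (Cand? x) (Back? x) (λ _ → proj₁))) (p-hi nx)))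
    go (no ¬nx) = ≤-trans (+-mono-≤ (≤-reflexive (cnt-none (S₁? k x) (λ y ((nx , _) , _) → ¬nx nx))) (S₁-load k x))
      (Arithmetic.total-degree {p = 0} D≥ z≤n z≤n)

  Own : ℕ → Fin n → Fin n → Set
  Own k v u = S₂ k v u ⊎ S₁ k v u

  abstract
    Own? : ∀ k v u → Dec (Own k v u)
    Own? k v u = S₂? k v u ⊎-dec S₁? k v u

  -- (m + 1)² sums are attainable at v, and the cell of each earlier neighbour excludes at most four of them.
  Enough : Fin n → Set
  Enough v = ∃[ m ] 4 * b v < suc m * suc m × m ≤ 2 * D × m ≤ cnt (Own? 0 v) × m ≤ cnt (Own? 1 v)

  enough : ∀ v → High v → Enough v
  enough v hv = go (deg v * deg v ≤? 4 * b v * (D * D))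
    where
    both : ∀ {m} → 4 * b v < suc m * suc m → (∀ k → k < 2 → m ≤ cnt (Own? k v)) → Enough v
    both {m} lt grow with m ≤? 2 * D
    ... | yes le = m , lt , le , grow 0 (s≤s z≤n) , grow 1 ≤-refl
    -- The number of unit shifts has to stay below the large step `2 * suc D`, so it is cut at
    -- `2 * D`; this suffices because `b v` is at most `D * D`.
    ... | no ¬le = 2 * D , ≤-<-trans (≤-trans (*-monoʳ-≤ 4 (b≤ v)) (≤-reflexive (square D)))
                     (*-mono-< (n<1+n (2 * D)) (n<1+n (2 * D))) , ≤-refl ,
                     ≤-trans (<⇒≤ (≰⇒> ¬le)) (grow 0 (s≤s z≤n)) , ≤-trans (<⇒≤ (≰⇒> ¬le)) (grow 1 ≤-refl)
      where
      open +-*-Solver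
      square : ∀ D → 4 * (D * D) ≡ (2 * D) * (2 * D)
      square = solve 1 (λ D → con 4 :* (D :* D) := (con 2 :* D) :* (con 2 :* D)) refl
    kept : b v ≤ cnt (Cand? v) + 4 * suc (b v / D)
    kept = ≤-trans (≤-reflexive (trans (cnt-split (Back? v) (S₂′? v)) (+-comm (cnt (λ u → Back? v u ×-dec S₂′? v u)) _)))
                   (+-mono-≤ (cnt-mono (λ u → Back? v u ×-dec ¬? (S₂′? v u)) (Cand? v) (λ _ c → c)) (S₂-back v hv))
    go : Dec (deg v * deg v ≤ 4 * b v * (D * D)) → Enough v
    go (no ¬le) = both {deg v / D} (Arithmetic.by-degree {D} {deg v} {b v} (≰⇒> ¬le))
      (λ k k<2 → ≤-trans (S₂-own k k<2 v hv) (cnt-mono (S₂? k v) (Own? k v) (λ _ → inj₁)))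
    go (yes le) = both {h v} (Arithmetic.enough-general {b v} {h v} {h v} {p v} {cnt (Cand? v)}
        (Arithmetic.root-small {b v} {cnt (Cand? v)} {p v} (p-lo nv) (Arithmetic.mostly {D} {b v} {cnt (Cand? v)} D≥ (needy-b nv) kept))
        (Arithmetic.next-multiple (cnt (Cand? v)) (p v)) (Arithmetic.next-multiple (cnt (Cand? v)) (p v)))
      (λ k k<2 → ≤-trans (S₁-own≥ k k<2 nv) (cnt-mono (S₁? k v) (Own? k v) (λ _ → inj₂)))
      where
      nv : Needy v
      nv = hv , le

-- Cells of sums and the alteration of one vertex

module Cells (m : ℕ) .{{_ : NonZero m}} where

  M = 2 * m

  -- This is `s / M`, divided in two steps to separate the last binary digit, which a unit step
  -- flips, from the residue modulo `m`, which neither kind of step changes. Adding `M` raises only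
  -- `coarse s`.
  coarse : ℕ → ℕ
  coarse s = s / 2 / m

  even-suc : ∀ s → s % 2 ≡ 0 → suc s / 2 ≡ s / 2
  even-suc s e = begin
    suc s / 2 ≡⟨ cong (λ z → suc z / 2) (trans (m≡m%n+[m/n]*n s 2) (cong (_+ s / 2 * 2) e)) ⟩
    (1 + s / 2 * 2) / 2 ≡⟨ +-distrib-/-∣ʳ 1 {s / 2 * 2} {2} (divides-refl (s / 2)) ⟩
    s / 2 * 2 / 2 ≡⟨ m*n/n≡m (s / 2) 2 ⟩
    s / 2 ∎
    where open ≡-Reasoning

  half-M : ∀ s → (M + s) / 2 ≡ m + s / 2
  half-M s = trans (+-distrib-/-∣ˡ s (divides m (*-comm 2 m))) (cong (_+ s / 2) (trans (cong (_/ 2) (*-comm 2 m)) (m*n/n≡m m 2)))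

  coarse-M : ∀ s → coarse (M + s) ≡ suc (coarse s)
  coarse-M s = trans (cong (_/ m) (half-M s)) (trans (+-distrib-/-∣ˡ (s / 2) (divides 1 (sym (*-identityˡ m)))) (cong (_+ coarse s) (n/n≡1 m)))

  -- A cell consists of four sums 2(r + qm) + β with given r, given ⌊q / 2⌋ and β < 2.
  abstract
    cell : ℕ → ℕ × ℕ
    cell s = s / 2 % m , coarse s / 2

    cell-fine : ∀ s → s % 2 ≡ 0 → cell (suc s) ≡ cell s
    cell-fine s e rewrite even-suc s e = refl

    cell-coarse : ∀ s → coarse s % 2 ≡ 0 → cell (M + s) ≡ cell s
    cell-coarse s e = cong₂ _,_ (trans (cong (_% m) (half-M s)) ([m+n]%n≡m%n′ (s / 2)))
      (trans (cong (_/ 2) (coarse-M s)) (even-suc (coarse s) e))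
      where
      [m+n]%n≡m%n′ : ∀ x → (m + x) % m ≡ x % m
      [m+n]%n≡m%n′ x = trans (cong (_% m) (+-comm m x)) ([m+n]%n≡m%n x m)

    member : ℕ × ℕ → ℕ → ℕ → ℕ
    member (r , e) α β = β + (r + (α + e * 2) * m) * 2

    members : ℕ × ℕ → List ℕ
    members c = member c 0 0 ∷ member c 0 1 ∷ member c 1 0 ∷ member c 1 1 ∷ []

    ∈-members : ∀ s → s ∈ members (cell s)
    ∈-members s = subst (_∈ members (cell s)) (sym whole) (pick (m%n<n (coarse s) 2) (m%n<n s 2))
      where
      whole : s ≡ member (cell s) (coarse s % 2) (s % 2)
      whole = trans (m≡m%n+[m/n]*n s 2) (cong (λ z → s % 2 + z * 2)
        (trans (m≡m%n+[m/n]*n (s / 2) m) (cong (λ z → s / 2 % m + z * m) (m≡m%n+[m/n]*n (coarse s) 2))))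
      pick : ∀ {α β} → α < 2 → β < 2 → member (cell s) α β ∈ members (cell s)
      pick {zero}  {zero}  _ _ = here refl
      pick {zero}  {suc zero}  _ _ = there (here refl)
      pick {suc zero} {zero} _ _ = there (there (here refl))
      pick {suc zero} {suc zero} _ _ = there (there (there (here refl)))
      pick {suc (suc _)} (s≤s (s≤s ())) _
      pick {zero} {suc (suc _)} _ (s≤s (s≤s ()))
      pick {suc zero} {suc (suc _)} _ (s≤s (s≤s ()))

    length-members : ∀ c → length (members c) ≡ 4
    length-members c = refl

  mod2 : ∀ s → s % 2 ≡ 0 ⊎ s % 2 ≡ 1
  mod2 s with s % 2 | m%n<n s 2
  ... | zero | _ = inj₁ refl
  ... | suc zero | _ = inj₂ refl
  ... | suc (suc _) | s≤s (s≤s ())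

  odd-pred : ∀ s → suc s % 2 ≡ 1 → s % 2 ≡ 0
  odd-pred s e with mod2 s
  ... | inj₁ z = z
  ... | inj₂ o = case trans (sym e) (trans (%-distribˡ-+ 1 s 2) (cong (λ z → (1 + z) % 2) o)) of λ ()

  -- s′ is s or s ± 1, the sign being prescribed by the parity of s; the −1 is on the left to avoid subtraction.
  fine-move : ∀ s s′ x → x ≤ 1 → s′ + 1 ≡ s + (1 ∸ s % 2 + x) → cell s′ ≡ cell s
  fine-move s s′ x x≤ eq with mod2 s
  fine-move s s′ zero x≤ eq | inj₁ e rewrite e = cong cell (+-cancelʳ-≡ 1 s′ s eq)
  fine-move s s′ (suc zero) x≤ eq | inj₁ e rewrite e =
    trans (cong cell (+-cancelʳ-≡ 1 s′ (suc s) (trans eq (+-suc s 1)))) (cell-fine s e)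
  fine-move s s′ zero x≤ eq | inj₂ o rewrite o =
    sym (trans (cong cell (sym s≡)) (cell-fine s′ (odd-pred s′ (trans (cong (_% 2) s≡) o))))
    where
    s≡ : suc s′ ≡ s
    s≡ = trans (+-comm 1 s′) (trans eq (+-identityʳ s))
  fine-move s s′ (suc zero) x≤ eq | inj₂ o rewrite o = cong cell (+-cancelʳ-≡ 1 s′ s eq)
  fine-move s s′ (suc (suc _)) (s≤s ()) eq | _

  coarse-move : ∀ s s′ x → x ≤ 1 → s′ + M * 1 ≡ s + M * (1 ∸ coarse s % 2 + x) → cell s′ ≡ cell s
  coarse-move s s′ x x≤ eq with mod2 (coarse s)
  coarse-move s s′ zero x≤ eq | inj₁ e rewrite e = cong cell (+-cancelʳ-≡ (M * 1) s′ s eq)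
  coarse-move s s′ (suc zero) x≤ eq | inj₁ e rewrite e =
    trans (cong cell (+-cancelʳ-≡ (M * 1) s′ (M + s) (trans eq
      (solve 2 (λ s M → s :+ M :* con 2 := (M :+ s) :+ M :* con 1) refl s M)))) (cell-coarse s e)
    where open +-*-Solver
  coarse-move s s′ zero x≤ eq | inj₂ o rewrite o =
    sym (trans (cong cell (sym s≡)) (cell-coarse s′ (odd-pred (coarse s′)
      (trans (cong (_% 2) (trans (sym (coarse-M s′)) (cong coarse s≡))) o))))
    where
    s≡ : M + s′ ≡ s
    s≡ = trans (trans (+-comm M s′) (cong (s′ +_) (sym (*-identityʳ M)))) (trans eq (trans (cong (s +_) (*-zeroʳ M)) (+-identityʳ s)))
  coarse-move s s′ (suc zero) x≤ eq | inj₂ o rewrite o = cong cell (+-cancelʳ-≡ (M * 1) s′ s eq)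
  coarse-move s s′ (suc (suc _)) (s≤s ()) eq | _

-- Every edge vu carries a multiple t v u * (y v u + y u v) of its step, where y v u is altered only by v.
module Process {n : ℕ} (m : ℕ) .{{_ : NonZero m}} (ω : Fin n → ℕ) (A t : Fin n → Fin n → ℕ)
    (O₀ O₁ : Fin n → Fin n → Set) (O₀? : ∀ v u → Dec (O₀ v u)) (O₁? : ∀ v u → Dec (O₁ v u))
    (O-irr : ∀ {v} → ¬ (O₀ v v ⊎ O₁ v v)) (O-disj : ∀ {v u} → O₀ v u → ¬ O₁ v u)
    (t₀ : ∀ {v u} → O₀ v u → t v u ≡ 1 × t u v ≡ 1)
    (t₁ : ∀ {v u} → O₁ v u → t v u ≡ 2 * m × t u v ≡ 2 * m) where

  open Cells m

  State = Fin n → Fin n → ℕ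

  term : State → Fin n → Fin n → ℕ
  term y v u = A v u + t v u * (y v u + y u v)

  abstract
    S : State → Fin n → ℕ
    S y v = ω v + sum (term y v)

    S-def : ∀ y v → S y v ≡ ω v + sum (term y v)
    S-def y v = refl

  O : Fin n → Fin n → Set
  O v u = O₀ v u ⊎ O₁ v u

  record Step (y : State) (v : Fin n) (F : List ℕ) : Set where
    field
      y′     : State
      rows   : ∀ {w u} → w ≢ v → y′ w u ≡ y w u
      others : ∀ {u} → ¬ O v u → y′ v u ≡ y v u
      small  : ∀ {u} → O v u → y′ v u ≤ 2
      avoids : S y′ v ∉ F
      cells  : ∀ {w} → w ≢ v → cell (S y′ w) ≡ cell (S y w)
      sums   : ∀ {w} → w ≢ v → ¬ O v w → S y′ w ≡ S y w

  module Move (y : State) (v : Fin n) (ready : ∀ {u} → O v u → y v u ≡ 1) where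

    module R₀ = Rank (O₀? v) toℕ (λ _ _ → toℕ-injective)
    module R₁ = Rank (O₁? v) toℕ (λ _ _ → toℕ-injective)

    -- An owned edge stands at 1. If the relevant parity at its other end is even, that sum may only
    -- rise, so the choices are 1 and 2; if it is odd, they are 0 and 1. `low` is the smaller
    -- choice, and edges that are not owned keep their value.
    low : Fin n → ℕ
    low u = ifDec (O₀? v u) (1 ∸ S y u % 2) (ifDec (O₁? v u) (1 ∸ coarse (S y u) % 2) (y v u))

    low₀ : ∀ {u} → O₀ v u → low u ≡ 1 ∸ S y u % 2
    low₀ {u} o = ifDec-yes (O₀? v u) o

    low₁ : ∀ {u} → O₁ v u → low u ≡ 1 ∸ coarse (S y u) % 2
    low₁ {u} o = trans (ifDec-no (O₀? v u) (λ o₀ → O-disj o₀ o)) (ifDec-yes (O₁? v u) o)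

    low-other : ∀ {u} → ¬ O v u → low u ≡ y v u
    low-other {u} ¬o = trans (ifDec-no (O₀? v u) (¬o ∘ inj₁)) (ifDec-no (O₁? v u) (¬o ∘ inj₂))

    C : ℕ
    C = ω v + sum (λ u → A v u + t v u * (low u + y u v))

    module Choice (i j : ℕ) (i≤ : i ≤ cnt (O₀? v)) (j≤ : j ≤ cnt (O₁? v)) where

      Q₀? : ∀ u → Dec (O₀ v u × R₀.rank u < i)
      Q₀? u = O₀? v u ×-dec (R₀.rank u <? i)

      Q₁? : ∀ u → Dec (O₁ v u × R₁.rank u < j)
      Q₁? u = O₁? v u ×-dec (R₁.rank u <? j)

      cnt-Q₀ : cnt Q₀? ≡ i
      cnt-Q₀ = ≤-antisym (R₀.cnt-rank≤ i) (R₀.cnt-rank≥ i i≤)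

      cnt-Q₁ : cnt Q₁? ≡ j
      cnt-Q₁ = ≤-antisym (R₁.cnt-rank≤ j) (R₁.cnt-rank≥ j j≤)

      y′ : State
      y′ w u = ifDec (w Fin.≟ v) (low u + (bit (Q₀? u) + bit (Q₁? u))) (y w u)

      y′-v : ∀ u → y′ v u ≡ low u + (bit (Q₀? u) + bit (Q₁? u))
      y′-v u = ifDec-yes (v Fin.≟ v) refl

      rows : ∀ {w u} → w ≢ v → y′ w u ≡ y w u
      rows {w} w≢v = ifDec-no (w Fin.≟ v) w≢v

      others : ∀ {u} → ¬ O v u → y′ v u ≡ y v u
      others {u} ¬o = trans (y′-v u) (trans (cong₂ _+_ (low-other ¬o)
        (cong₂ _+_ (bit-no (Q₀? u) (¬o ∘ inj₁ ∘ proj₁)) (bit-no (Q₁? u) (¬o ∘ inj₂ ∘ proj₁)))) (+-identityʳ _))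

      y′-₀ : ∀ {u} → O₀ v u → y′ v u ≡ 1 ∸ S y u % 2 + bit (Q₀? u)
      y′-₀ {u} o = trans (y′-v u) (cong₂ _+_ (low₀ o)
        (trans (cong (bit (Q₀? u) +_) (bit-no (Q₁? u) (O-disj o ∘ proj₁))) (+-identityʳ _)))

      y′-₁ : ∀ {u} → O₁ v u → y′ v u ≡ 1 ∸ coarse (S y u) % 2 + bit (Q₁? u)
      y′-₁ {u} o = trans (y′-v u) (cong₂ _+_ (low₁ o) (cong (_+ bit (Q₁? u)) (bit-no (Q₀? u) (λ q → O-disj (proj₁ q) o))))

      small : ∀ {u} → O v u → y′ v u ≤ 2
      small {u} (inj₁ o) = ≤-trans (≤-reflexive (y′-₀ o)) (+-mono-≤ (m∸n≤m 1 (S y u % 2)) (bit≤1 (Q₀? u)))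
      small {u} (inj₂ o) = ≤-trans (≤-reflexive (y′-₁ o)) (+-mono-≤ (m∸n≤m 1 (coarse (S y u) % 2)) (bit≤1 (Q₁? u)))

      column : ∀ u → y′ u v ≡ y u v
      column u with u Fin.≟ v
      ... | no u≢v = refl
      ... | yes refl = trans (sym (y′-v v)) (others O-irr)

      weight : ∀ u → t v u * (bit (Q₀? u) + bit (Q₁? u)) ≡ bit (Q₀? u) + M * bit (Q₁? u)
      weight u with Q₀? u | Q₁? u
      ... | yes (o , _) | yes (o′ , _) = contradiction o′ (O-disj o)
      ... | yes (o , _) | no _ rewrite proj₁ (t₀ o) | *-zeroʳ M = refl
      ... | no _ | yes (o , _) = cong (_* 1) (proj₁ (t₁ o))
      ... | no _ | no _ = trans (*-zeroʳ (t v u)) (sym (*-zeroʳ M))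

      sum-v : S y′ v ≡ C + (j * M + i)
      sum-v = begin
        S y′ v ≡⟨ S-def y′ v ⟩
        ω v + sum (term y′ v) ≡⟨ cong (ω v +_) (sum-cong-≗ split) ⟩
        ω v + sum (λ u → base u + (bit (Q₀? u) + M * bit (Q₁? u))) ≡⟨ cong (ω v +_) (∑-distrib-+ base (λ u → bit (Q₀? u) + M * bit (Q₁? u))) ⟩
        ω v + (sum base + sum (λ u → bit (Q₀? u) + M * bit (Q₁? u))) ≡⟨ +-assoc (ω v) (sum base) _ ⟨
        C + sum (λ u → bit (Q₀? u) + M * bit (Q₁? u)) ≡⟨ cong (C +_) (∑-distrib-+ (λ u → bit (Q₀? u)) (λ u → M * bit (Q₁? u))) ⟩
        C + (sum (λ u → bit (Q₀? u)) + sum (λ u → M * bit (Q₁? u))) ≡⟨ cong (C +_) (cong₂ _+_ (trans (sym (cnt-sum Q₀?)) cnt-Q₀)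
            (trans (sum-* M (λ u → bit (Q₁? u))) (trans (cong (M *_) (trans (sym (cnt-sum Q₁?)) cnt-Q₁)) (*-comm M j)))) ⟩
        C + (i + j * M) ≡⟨ cong (C +_) (+-comm i (j * M)) ⟩
        C + (j * M + i) ∎
        where
        open ≡-Reasoning
        base : Fin n → ℕ
        base u = A v u + t v u * (low u + y u v)
        split : ∀ u → term y′ v u ≡ base u + (bit (Q₀? u) + M * bit (Q₁? u))
        split u = begin
          A v u + t v u * (y′ v u + y′ u v) ≡⟨ cong₂ (λ p q → A v u + t v u * (p + q)) (y′-v u) (column u) ⟩
          A v u + t v u * (low u + (bit (Q₀? u) + bit (Q₁? u)) + y u v)
            ≡⟨ solve 5 (λ a t l b y → a :+ t :* (l :+ b :+ y) := a :+ t :* (l :+ y) :+ t :* b) refl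
                 (A v u) (t v u) (low u) (bit (Q₀? u) + bit (Q₁? u)) (y u v) ⟩
          base u + t v u * (bit (Q₀? u) + bit (Q₁? u)) ≡⟨ cong (base u +_) (weight u) ⟩
          base u + (bit (Q₀? u) + M * bit (Q₁? u)) ∎
          where open +-*-Solver

      other-sum : ∀ {w} → w ≢ v → S y′ w + t w v * y v w ≡ S y w + t w v * y′ v w
      other-sum {w} w≢v = trans (cong (_+ t w v * y v w) (S-def y′ w)) (trans (+-cancelˡ-≡ (A w v + t w v * y w v) _ _ (begin
        (a + T * y w v) + (ω w + sum (term y′ w) + T * y v w)
          ≡⟨ solve 6 (λ a T p o s q → (a :+ T :* p) :+ (o :+ s :+ T :* q) := o :+ (s :+ (a :+ T :* (p :+ q)))) refl a T (y w v) (ω w) (sum (term y′ w)) (y v w) ⟩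
        ω w + (sum (term y′ w) + term y w v)
          ≡⟨ cong (ω w +_) (sum-two (term y′ w) (term y w) v same) ⟩
        ω w + (sum (term y w) + term y′ w v)
          ≡⟨ cong (λ z → ω w + (sum (term y w) + (a + T * (z + y′ v w)))) (rows w≢v) ⟩
        ω w + (sum (term y w) + (a + T * (y w v + y′ v w)))
          ≡⟨ solve 6 (λ a T p o s q → (a :+ T :* p) :+ (o :+ s :+ T :* q) := o :+ (s :+ (a :+ T :* (p :+ q)))) refl a T (y w v) (ω w) (sum (term y w)) (y′ v w) ⟨
        (a + T * y w v) + (ω w + sum (term y w) + T * y′ v w) ∎)) (cong (_+ t w v * y′ v w) (sym (S-def y w))))
        where
        open ≡-Reasoning
        open +-*-Solver
        a = A w v
        T = t w v
        same : ∀ u → u ≢ v → term y′ w u ≡ term y w u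
        same u u≢v = cong₂ (λ p q → A w u + t w u * (p + q)) (rows w≢v) (rows u≢v)

      sums : ∀ {w} → w ≢ v → ¬ O v w → S y′ w ≡ S y w
      sums {w} w≢v ¬o = +-cancelʳ-≡ (t w v * y v w) _ _ (trans (other-sum w≢v) (cong (λ z → S y w + t w v * z) (others ¬o)))

      cells : ∀ {w} → w ≢ v → cell (S y′ w) ≡ cell (S y w)
      cells {w} w≢v = go (O₀? v w) (O₁? v w)
        where
        go : Dec (O₀ v w) → Dec (O₁ v w) → cell (S y′ w) ≡ cell (S y w)
        go (no ¬p) (no ¬q) = cong cell (sums w≢v [ ¬p , ¬q ]′)
        go (yes o) _ = fine-move (S y w) (S y′ w) (bit (Q₀? w)) (bit≤1 (Q₀? w))
          (trans (cong (S y′ w +_) (sym (trans (cong₂ _*_ (proj₂ (t₀ o)) (ready (inj₁ o))) refl)))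
            (trans (other-sum w≢v) (cong (S y w +_) (trans (cong₂ _*_ (proj₂ (t₀ o)) (y′-₀ o)) (*-identityˡ _)))))
        go (no _) (yes o) = coarse-move (S y w) (S y′ w) (bit (Q₁? w)) (bit≤1 (Q₁? w))
          (trans (cong (S y′ w +_) (sym (cong₂ _*_ (proj₂ (t₁ o)) (ready (inj₂ o)))))
            (trans (other-sum w≢v) (cong (S y w +_) (cong₂ _*_ (proj₂ (t₁ o)) (y′-₁ o)))))

  abstract
    -- Raising `j` large and `i` small edges above `low` adds `j * M + i`. Because `m₀` is below
    -- `M`, distinct pairs give distinct sums, and there are more pairs than forbidden sums.
    step : ∀ y v → (∀ {u} → O v u → y v u ≡ 1) → ∀ F m₀ m₁ → m₀ ≤ cnt (O₀? v) → m₁ ≤ cnt (O₁? v) →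
           m₀ < 2 * m → length F < suc m₁ * suc m₀ → Step y v F
    step y v ready F m₀ m₁ m₀≤ m₁≤ m₀<M len = record
      { y′ = Ch.y′ ; rows = Ch.rows ; others = Ch.others ; small = Ch.small
      ; avoids = λ p → proj₂ choice (subst (_∈ F) Ch.sum-v p) ; cells = Ch.cells ; sums = Ch.sums }
      where
      open Move y v ready
      row col : Fin (suc m₁ * suc m₀) → ℕ
      row k = toℕ (proj₁ (remQuot {suc m₁} (suc m₀) k))
      col k = toℕ (proj₂ (remQuot {suc m₁} (suc m₀) k))
      value : Fin (suc m₁ * suc m₀) → ℕ
      value k = C + (row k * M + col k)
      small-digit : ∀ k → col k < M
      small-digit k = <-≤-trans (toℕ<n (proj₂ (remQuot {suc m₁} (suc m₀) k))) m₀<M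
      value-inj : ∀ k l → value k ≡ value l → k ≡ l
      value-inj k l e =
        let p , q = digit-inj M {{m*n≢0 2 m}} {row k} {col k} {row l} {col l} (small-digit k) (small-digit l) (+-cancelˡ-≡ C _ _ e) in
        trans (sym (Fin.combine-remQuot {suc m₁} (suc m₀) k))
          (trans (cong₂ combine (toℕ-injective p) (toℕ-injective q)) (Fin.combine-remQuot {suc m₁} (suc m₀) l))
      choice : ∃[ k ] value k ∉ F
      choice = avoid value value-inj F len
      i j : ℕ
      j = toℕ (proj₁ (remQuot {suc m₁} (suc m₀) (proj₁ choice)))
      i = toℕ (proj₂ (remQuot {suc m₁} (suc m₀) (proj₁ choice)))
      i≤ : i ≤ cnt (O₀? v)
      i≤ = ≤-trans (≤-pred (toℕ<n (proj₂ (remQuot {suc m₁} (suc m₀) (proj₁ choice))))) m₀≤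
      j≤ : j ≤ cnt (O₁? v)
      j≤ = ≤-trans (≤-pred (toℕ<n (proj₁ (remQuot {suc m₁} (suc m₀) (proj₁ choice))))) m₁≤
      module Ch = Choice i j i≤ j≤

-- Greedy extension of partial colourings

elems : ∀ {n} {P : Fin n → Set} → Decidable P → List (Fin n)
elems {zero}  P? = []
elems {suc n} P? with P? zero
... | yes _ = zero ∷ map suc (elems (P? ∘ suc))
... | no _  = map suc (elems (P? ∘ suc))

length-elems : ∀ {n} {P : Fin n → Set} (P? : Decidable P) → length (elems P?) ≡ cnt P?
length-elems P? = trans (go P?) (sym (cnt-sum P?))
  where
  go : ∀ {n} {P : Fin n → Set} (P? : Decidable P) → length (elems P?) ≡ sum (λ i → bit (P? i))
  go {zero}  P? = refl
  go {suc n} P? with P? zero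
  ... | yes _ = cong suc (trans (length-map suc (elems (P? ∘ suc))) (go (P? ∘ suc)))
  ... | no _  = trans (length-map suc (elems (P? ∘ suc))) (go (P? ∘ suc))

∈-elems : ∀ {n} {P : Fin n → Set} (P? : Decidable P) {i} → P i → i ∈ elems P?
∈-elems {suc n} P? {zero} p with P? zero
... | yes _ = here refl
... | no ¬p = contradiction p ¬p
∈-elems {suc n} P? {suc i} p with P? zero
... | yes _ = there (∈-map⁺ suc (∈-elems (P? ∘ suc) p))
... | no _  = ∈-map⁺ suc (∈-elems (P? ∘ suc) p)

images : ∀ {n} {P : Fin n → Set} → Decidable P → (Fin n → ℕ) → List ℕ
images P? f = map f (elems P?)

length-images : ∀ {n} {P : Fin n → Set} (P? : Decidable P) f → length (images P? f) ≡ cnt P?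
length-images P? f = trans (length-map f (elems P?)) (length-elems P?)

∈-images : ∀ {n} {P : Fin n → Set} (P? : Decidable P) (f : Fin n → ℕ) {i} → P i → f i ∈ images P? f
∈-images P? f p = ∈-map⁺ f (∈-elems P? p)

record Valid {n} (E : Fin n → Fin n → Set) (K : ℕ) (cv : Fin n → ℕ) (c : Fin n → Fin n → ℕ) : Set where
  field
    symm   : ∀ x y → c x y ≡ c y x
    bound  : ∀ x y → c x y ≤ K
    edges  : ∀ {x y} → c x y ≢ 0 → E x y
    proper : ∀ {x y w} → c x y ≢ 0 → y ≢ w → c x y ≢ c x w
    vertex : ∀ {x y} → c x y ≢ 0 → c x y ≢ cv x

-- Extension of a partial proper colouring (0 means uncoloured) to the edges in Sel, one edge at a time,
-- the sums of the pairs in Des being separated whenever one of them changes.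
module Greedy {n : ℕ} (E : Fin n → Fin n → Set) (E? : ∀ x y → Dec (E x y)) (E-irr : ∀ {x} → ¬ E x x)
    (K : ℕ) (cv σ : Fin n → ℕ)
    (Sel Des : Fin n → Fin n → Set) (Sel? : ∀ x y → Dec (Sel x y)) (Des? : ∀ x y → Dec (Des x y))
    (Sel⊆E : ∀ {x y} → Sel x y → E x y) (Sel-sym : ∀ {x y} → Sel x y → Sel y x)
    (Des-sym : ∀ {x y} → Des x y → Des y x) (Des-irr : ∀ {x} → ¬ Des x x)
    (room : ∀ {x y} → Sel x y → cnt (E? x) + (cnt (E? y) + (2 + (cnt (Des? x) + cnt (Des? y)))) < K) where

  Col = Fin n → Fin n → ℕ

  s : Col → Fin n → ℕ
  s c v = σ v + sum (c v)

  open Valid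

  -- Colouring the edge `yw` itself raises both sums by the same amount, so a separation can come
  -- only from another selected edge at one of the ends. Once achieved, it is respected by all later
  -- choices.
  Touched : Col → Fin n → Fin n → Set
  Touched c y w = ∃[ v ] v ≢ w × Sel y v × c y v ≢ 0

  record Extension (c₀ : Col) (ps : List (Fin n × Fin n)) : Set where
    field
      c      : Col
      valid  : Valid E K cv c
      same   : ∀ {x y} → ¬ Sel x y → c x y ≡ c₀ x y
      done   : ∀ {x y} → (x , y) ∈ ps → Sel x y → c x y ≢ 0
      apart  : ∀ {y w} → Des y w → Touched c y w → s c y ≢ s c w

  module Colour (c : Col) (valid : Valid E K cv c) (apart : ∀ {y w} → Des y w → Touched c y w → s c y ≢ s c w)
                {x u : Fin n} (sel : Sel x u) (c≡0 : c x u ≡ 0) where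

    x≢u : x ≢ u
    x≢u refl = E-irr (Sel⊆E sel)

    F F₁ F₂ F₃ F₄ : List ℕ
    F₁ = images (E? x) (c x)
    F₂ = images (E? u) (c u)
    -- Only this difference could make the sums of `x` and `w` equal. Truncation merely adds 0,
    -- which is not among the colours offered.
    F₃ = images (Des? x) (λ w → s c w ∸ s c x)
    F₄ = images (Des? u) (λ w → s c w ∸ s c u)
    F = F₁ ++ (F₂ ++ ((cv x ∷ cv u ∷ []) ++ (F₃ ++ F₄)))

    length-F : length F < K
    length-F = subst (_< K) (sym eq) (room sel)
      where
      eq : length F ≡ cnt (E? x) + (cnt (E? u) + (2 + (cnt (Des? x) + cnt (Des? u))))
      eq = trans (length-++ F₁) (cong₂ _+_ (length-images (E? x) _) (trans (length-++ F₂) (cong₂ _+_ (length-images (E? u) _)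
             (cong (2 +_) (trans (length-++ F₃) (cong₂ _+_ (length-images (Des? x) _) (length-images (Des? u) _)))))))

    abstract
      colour : ∃[ a ] a ≢ 0 × a ≤ K × a ∉ F
      colour = let i , ∉F = avoid {K} (λ i → suc (toℕ i)) (λ i j e → toℕ-injective (suc-injective e)) F length-F in
        suc (toℕ i) , (λ ()) , toℕ<n i , ∉F

    a = proj₁ colour
    a≢0 = proj₁ (proj₂ colour)

    a∉ : a ∉ F
    a∉ = proj₂ (proj₂ (proj₂ colour))

    ∈F₁ : ∀ {z} → z ∈ F₁ → z ∈ F
    ∈F₁ = ∈-++⁺ˡ
    ∈F₂ : ∀ {z} → z ∈ F₂ → z ∈ F
    ∈F₂ = ∈-++⁺ʳ F₁ ∘ ∈-++⁺ˡ
    ∈F₃ : ∀ {z} → z ∈ F₃ → z ∈ F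
    ∈F₃ p = ∈-++⁺ʳ F₁ (∈-++⁺ʳ F₂ (there (there (∈-++⁺ˡ p))))
    ∈F₄ : ∀ {z} → z ∈ F₄ → z ∈ F
    ∈F₄ p = ∈-++⁺ʳ F₁ (∈-++⁺ʳ F₂ (there (there (∈-++⁺ʳ F₃ p))))

    Here : Fin n → Fin n → Set
    Here y w = (y ≡ x × w ≡ u) ⊎ (y ≡ u × w ≡ x)

    Here? : ∀ y w → Dec (Here y w)
    Here? y w = ((y Fin.≟ x) ×-dec (w Fin.≟ u)) ⊎-dec ((y Fin.≟ u) ×-dec (w Fin.≟ x))

    Here-sym : ∀ {y w} → Here y w → Here w y
    Here-sym (inj₁ (p , q)) = inj₂ (q , p)
    Here-sym (inj₂ (p , q)) = inj₁ (q , p)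

    c′ : Col
    c′ y w = ifDec (Here? y w) a (c y w)

    at : ∀ {y w} → Here y w → c′ y w ≡ a
    at {y} {w} h = ifDec-yes (Here? y w) h

    off : ∀ {y w} → ¬ Here y w → c′ y w ≡ c y w
    off {y} {w} h = ifDec-no (Here? y w) h

    off-row : ∀ {y} → y ≢ x → y ≢ u → ∀ w → c′ y w ≡ c y w
    off-row p q w = off [ p ∘ proj₁ , q ∘ proj₁ ]′

    uncoloured : ∀ {y w} → Here y w → c y w ≡ 0
    uncoloured (inj₁ (refl , refl)) = c≡0
    uncoloured (inj₂ (refl , refl)) = trans (symm valid u x) c≡0

    sum-at : ∀ {y w} → Here y w → s c′ y ≡ s c y + a
    sum-at {y} {w} h = trans (cong (σ y +_) (begin
      sum (c′ y) ≡⟨ +-identityʳ _ ⟨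
      sum (c′ y) + 0 ≡⟨ cong (sum (c′ y) +_) (uncoloured h) ⟨
      sum (c′ y) + c y w ≡⟨ sum-two (c′ y) (c y) w (λ i i≢w → off (λ h′ → i≢w (other h h′))) ⟩
      sum (c y) + c′ y w ≡⟨ cong (sum (c y) +_) (at h) ⟩
      sum (c y) + a ∎)) (sym (+-assoc (σ y) (sum (c y)) a))
      where
      open ≡-Reasoning
      other : ∀ {y w i} → Here y w → Here y i → i ≡ w
      other (inj₁ (p , q)) (inj₁ (p′ , q′)) = trans q′ (sym q)
      other (inj₁ (p , q)) (inj₂ (p′ , q′)) = contradiction (trans (sym p) p′) x≢u
      other (inj₂ (p , q)) (inj₁ (p′ , q′)) = contradiction (trans (sym p′) p) x≢u
      other (inj₂ (p , q)) (inj₂ (p′ , q′)) = trans q′ (sym q)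

    sum-off : ∀ {y} → y ≢ x → y ≢ u → s c′ y ≡ s c y
    sum-off p q = cong (σ _ +_) (sum-cong-≗ (off-row p q))

    nonzero : ∀ {y w} → ¬ Here y w → c′ y w ≢ 0 → c y w ≢ 0
    nonzero ¬h = subst (_≢ 0) (off ¬h)

    a-new : ∀ {y w i} → Here y w → c y i ≢ 0 → c y i ≢ a
    a-new (inj₁ (refl , refl)) nz e = a∉ (subst (_∈ F) e (∈F₁ (∈-images (E? x) (c x) (edges valid nz))))
    a-new (inj₂ (refl , refl)) nz e = a∉ (subst (_∈ F) e (∈F₂ (∈-images (E? u) (c u) (edges valid nz))))

    valid′ : Valid E K cv c′
    valid′ .symm y w = go (Here? y w)
      where
      go : Dec (Here y w) → c′ y w ≡ c′ w y
      go (yes h) = trans (at h) (sym (at (Here-sym h)))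
      go (no h)  = trans (off h) (trans (symm valid y w) (sym (off (h ∘ Here-sym))))
    valid′ .bound y w = go (Here? y w)
      where
      go : Dec (Here y w) → c′ y w ≤ K
      go (yes h) = subst (_≤ K) (sym (at h)) (proj₁ (proj₂ (proj₂ colour)))
      go (no h)  = subst (_≤ K) (sym (off h)) (bound valid y w)
    valid′ .edges {y} {w} nz = go (Here? y w)
      where
      edge : Here y w → E y w
      edge (inj₁ (refl , refl)) = Sel⊆E sel
      edge (inj₂ (refl , refl)) = Sel⊆E (Sel-sym sel)
      go : Dec (Here y w) → E y w
      go (yes h) = edge h
      go (no h)  = edges valid (nonzero h nz)
    valid′ .proper {y} {w} {i} nz w≢i e = go (Here? y w) (Here? y i)
      where
      go : Dec (Here y w) → Dec (Here y i) → ⊥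
      go (yes (inj₁ (p , q))) (yes (inj₁ (p′ , q′))) = w≢i (trans q (sym q′))
      go (yes (inj₁ (p , q))) (yes (inj₂ (p′ , q′))) = x≢u (trans (sym p) p′)
      go (yes (inj₂ (p , q))) (yes (inj₁ (p′ , q′))) = x≢u (trans (sym p′) p)
      go (yes (inj₂ (p , q))) (yes (inj₂ (p′ , q′))) = w≢i (trans q (sym q′))
      go (yes h) (no h′) = a-new h (nonzero h′ (subst (_≢ 0) e nz)) (trans (sym (off h′)) (trans (sym e) (at h)))
      go (no h) (yes h′) = a-new h′ (nonzero h nz) (trans (sym (off h)) (trans e (at h′)))
      go (no h) (no h′) = proper valid (nonzero h nz) w≢i (trans (sym (off h)) (trans e (off h′)))
    valid′ .vertex {y} {w} nz e = go (Here? y w)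
      where
      cv∉ : Here y w → a ≢ cv y
      cv∉ (inj₁ (refl , refl)) q = a∉ (subst (_∈ F) (sym q) (∈-++⁺ʳ F₁ (∈-++⁺ʳ F₂ (here refl))))
      cv∉ (inj₂ (refl , refl)) q = a∉ (subst (_∈ F) (sym q) (∈-++⁺ʳ F₁ (∈-++⁺ʳ F₂ (there (here refl)))))
      go : Dec (Here y w) → ⊥
      go (yes h) = cv∉ h (trans (sym (at h)) e)
      go (no h)  = vertex valid (nonzero h nz) (trans (sym (off h)) e)

    a-apart : ∀ {y w i} → Here y w → Des y i → s c y + a ≢ s c i
    a-apart {y} h d e = a∉ (subst (_∈ F) (trans (cong (_∸ s c y) (sym e)) (m+n∸m≡n (s c y) a)) (mem h d))
      where
      mem : ∀ {y w i} → Here y w → Des y i → s c i ∸ s c y ∈ F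
      mem (inj₁ (refl , refl)) d = ∈F₃ (∈-images (Des? x) (λ w → s c w ∸ s c x) d)
      mem (inj₂ (refl , refl)) d = ∈F₄ (∈-images (Des? u) (λ w → s c w ∸ s c u) d)

    apart′ : ∀ {y w} → Des y w → Touched c′ y w → s c′ y ≢ s c′ w
    apart′ {y} {w} d (v , v≢w , sv , nz) = go (Here? y w) (y Fin.≟ x) (y Fin.≟ u) (w Fin.≟ x) (w Fin.≟ u)
      where
      old : ¬ Here y v → Touched c y w
      old ¬h = v , v≢w , sv , nonzero ¬h nz
      go : Dec (Here y w) → Dec (y ≡ x) → Dec (y ≡ u) → Dec (w ≡ x) → Dec (w ≡ u) → s c′ y ≢ s c′ w
      go (yes h) _ _ _ _ e = apart d (old (λ h′ → v≢w (same-end h h′)))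
          (+-cancelʳ-≡ a _ _ (trans (sym (sum-at h)) (trans e (sum-at (Here-sym h)))))
        where
        same-end : ∀ {y w v} → Here y w → Here y v → v ≡ w
        same-end (inj₁ (_ , q)) (inj₁ (_ , q′)) = trans q′ (sym q)
        same-end (inj₁ (p , _)) (inj₂ (p′ , _)) = contradiction (trans (sym p) p′) x≢u
        same-end (inj₂ (p , _)) (inj₁ (p′ , _)) = contradiction (trans (sym p′) p) x≢u
        same-end (inj₂ (_ , q)) (inj₂ (_ , q′)) = trans q′ (sym q)
      go (no ¬h) (yes p) _ (yes q) _ e = Des-irr (subst (Des y) (trans q (sym p)) d)
      go (no ¬h) (yes p) _ _ (yes q) e = ¬h (inj₁ (p , q))
      go (no ¬h) (yes p) _ (no q) (no r) e = a-apart (inj₁ (p , refl)) d (trans (sym (sum-at (inj₁ (p , refl)))) (trans e (sum-off q r)))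
      go (no ¬h) (no _) (yes p) (yes q) _ e = ¬h (inj₂ (p , q))
      go (no ¬h) (no _) (yes p) _ (yes q) e = Des-irr (subst (Des y) (trans q (sym p)) d)
      go (no ¬h) (no _) (yes p) (no q) (no r) e = a-apart (inj₂ (p , refl)) d (trans (sym (sum-at (inj₂ (p , refl)))) (trans e (sum-off q r)))
      go (no ¬h) (no p) (no q) (yes r) _ e = a-apart (inj₁ (r , refl)) (Des-sym d) (trans (sym (sum-at (inj₁ (r , refl)))) (trans (sym e) (sum-off p q)))
      go (no ¬h) (no p) (no q) (no _) (yes r) e = a-apart (inj₂ (r , refl)) (Des-sym d) (trans (sym (sum-at (inj₂ (r , refl)))) (trans (sym e) (sum-off p q)))
      go (no ¬h) (no p) (no q) (no r) (no t) e = apart d (old [ p ∘ proj₁ , q ∘ proj₁ ]′) (trans (sym (sum-off p q)) (trans e (sum-off r t)))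

  abstract
    extend : ∀ c₀ → Valid E K cv c₀ → (∀ {x y} → Sel x y → c₀ x y ≡ 0) → ∀ ps → Extension c₀ ps
    extend c₀ v₀ z₀ [] = record { c = c₀ ; valid = v₀ ; same = λ _ → refl ; done = λ ()
      ; apart = λ _ (_ , _ , sel , nz) → contradiction (z₀ sel) nz }
    extend c₀ v₀ z₀ ((x , u) ∷ ps) = go (Sel? x u) (c x u ≟ 0)
      where
      open Extension (extend c₀ v₀ z₀ ps)
      go : Dec (Sel x u) → Dec (c x u ≡ 0) → Extension c₀ ((x , u) ∷ ps)
      go (no ¬sel) _ = record { c = c ; valid = valid ; same = same ; apart = apart
        ; done = λ { (here refl) sel → contradiction sel ¬sel ; (there i) → done i } }
      go (yes _) (no nz) = record { c = c ; valid = valid ; same = same ; apart = apart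
        ; done = λ { (here refl) _ → nz ; (there i) → done i } }
      go (yes sel) (yes z) = record { c = Cl.c′ ; valid = Cl.valid′ ; apart = Cl.apart′
        ; same = λ ¬s → trans (Cl.off (λ { (inj₁ (refl , refl)) → ¬s sel ; (inj₂ (refl , refl)) → ¬s (Sel-sym sel) })) (same ¬s)
        ; done = λ { (here refl) _ e → Cl.a≢0 (trans (sym (Cl.at (inj₁ (refl , refl)))) e)
                   ; (there i) sl e → kept (Cl.Here? _ _) (done i sl) e } }
        where
        module Cl = Colour c valid apart sel z
        kept : ∀ {y w} → Dec (Cl.Here y w) → c y w ≢ 0 → Cl.c′ y w ≢ 0
        kept (yes h) _  e = Cl.a≢0 (trans (sym (Cl.at h)) e)
        kept (no h) nz e = nz (trans (sym (Cl.off h)) e)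

    extend-all : ∀ c₀ → Valid E K cv c₀ → (∀ {x y} → Sel x y → c₀ x y ≡ 0) →
                 Extension c₀ (List.cartesianProduct (allFin n) (allFin n))
    extend-all c₀ v₀ z₀ = extend c₀ v₀ z₀ _

-- The i-th shift of a base colour β in a palette with L layers and step t.
pos : (L t : ℕ) .{{_ : NonZero t}} → ℕ → ℕ → ℕ
pos L t β i = (β / t * L + i) * t + β % t

pos-step : ∀ L t .{{_ : NonZero t}} β i → pos L t β i ≡ pos L t β 0 + t * i
pos-step L t β i = solve 5 (λ q L i t r → (q :* L :+ i) :* t :+ r := ((q :* L :+ con 0) :* t :+ r) :+ t :* i) refl (β / t) L i t (β % t)
  where open +-*-Solver

-- `pos` has the mixed-radix digits `β / t`, `i` and `β % t`, so base colour and layer can be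
-- recovered. Hence edges with different base colours never collide, however they are shifted.
pos-inj : ∀ L t .{{_ : NonZero t}} {β γ i j} → i < L → j < L → pos L t β i ≡ pos L t γ j → β ≡ γ
pos-inj L t {β} {γ} {i} {j} i< j< e =
  let p , r = digit-inj t {β / t * L + i} {β % t} {γ / t * L + j} {γ % t} (m%n<n β t) (m%n<n γ t) e
      q , _ = digit-inj L {{>-nonZero (≤-<-trans z≤n i<)}} {β / t} {i} {γ / t} {j} i< j< p
  in trans (m≡m%n+[m/n]*n β t) (trans (cong₂ (λ r q → r + q * t) r q) (sym (m≡m%n+[m/n]*n γ t)))

pos-< : ∀ L t .{{_ : NonZero t}} {β i m} → β / t ≤ m → i < L → pos L t β i < suc m * L * t
pos-< L t {β} {i} {m} q≤ i< = begin-strict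
  (β / t * L + i) * t + β % t <⟨ +-monoʳ-< _ (m%n<n β t) ⟩
  (β / t * L + i) * t + t ≡⟨ +-comm _ t ⟩
  suc (β / t * L + i) * t ≤⟨ *-monoˡ-≤ t (begin
    suc (β / t * L + i) ≡⟨ +-suc (β / t * L) i ⟨
    β / t * L + suc i ≤⟨ +-mono-≤ (*-monoˡ-≤ L q≤) i< ⟩
    m * L + L ≡⟨ +-comm (m * L) L ⟩
    suc m * L ∎) ⟩
  suc m * L * t ∎
  where open ≤-Reasoning

-- Palettes of the alterable edges

module Palette {n : ℕ} (E : Fin n → Fin n → Set) (E? : ∀ x y → Dec (E x y))
    (E-sym : ∀ {x y} → E x y → E y x) (E-irr : ∀ {x} → ¬ E x x)
    (D : ℕ) .{{_ : NonZero D}} (D≥ : 240 ≤ D) (deg≤ : ∀ v → cnt (E? v) ≤ D * D) (Q : ℕ) where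

  open Selection E E? E-sym E-irr D D≥ deg≤ public

  m : ℕ
  m = suc D

  S₁ₑ : ℕ → Fin n → Fin n → Set
  S₁ₑ k x y = S₁ k x y ⊎ S₁ k y x

  S₁ₑ-sym : ∀ {k x y} → S₁ₑ k x y → S₁ₑ k y x
  S₁ₑ-sym (inj₁ a) = inj₂ a
  S₁ₑ-sym (inj₂ a) = inj₁ a

  S₁⇒E : ∀ {k x y} → S₁ k x y → E x y
  S₁⇒E ((_ , ((e , _) , _) , _) , _) = e

  S₁ₑ-irr : ∀ {k x} → ¬ S₁ₑ k x x
  S₁ₑ-irr {k} (inj₁ a) = E-irr (S₁⇒E {k} a)
  S₁ₑ-irr {k} (inj₂ a) = E-irr (S₁⇒E {k} a)

  -- Even numbers stand for the unit step and odd ones for the step `2 * m`; the first two classes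
  -- have a single owner, the next two have both ends as owners.
  Class : ℕ → Fin n → Fin n → Set
  Class 0 = S₁ₑ 0
  Class 1 = S₁ₑ 1
  Class 2 = S₂ 0
  Class 3 = S₂ 1
  Class _ = λ _ _ → ⊥

  Class-sym : ∀ q {x y} → Class q x y → Class q y x
  Class-sym 0 = S₁ₑ-sym {0}
  Class-sym 1 = S₁ₑ-sym {1}
  Class-sym 2 = S₂-sym {0}
  Class-sym 3 = S₂-sym {1}
  Class-sym (suc (suc (suc (suc _)))) ()

  Class-outer : ∀ q {x y} → Class q x y → Outer x y
  Class-outer 0 (inj₁ ((nx , ((e , _) , _) , _) , _)) = e , inj₁ (proj₁ nx)
  Class-outer 0 (inj₂ ((ny , ((e , _) , _) , _) , _)) = E-sym e , inj₂ (proj₁ ny)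
  Class-outer 1 (inj₁ ((nx , ((e , _) , _) , _) , _)) = e , inj₁ (proj₁ nx)
  Class-outer 1 (inj₂ ((ny , ((e , _) , _) , _) , _)) = E-sym e , inj₂ (proj₁ ny)
  Class-outer 2 (e , _) = e
  Class-outer 3 (e , _) = e
  Class-outer (suc (suc (suc (suc _)))) ()

  S₁-once : ∀ {x y} → S₁ₑ 0 x y → ¬ S₁ₑ 1 x y
  S₁-once (inj₁ (_ , p)) (inj₁ (_ , q)) = 0≢1+n (trans (sym p) q)
  S₁-once (inj₁ (a , _)) (inj₂ (b , _)) = Arc-asym a b
  S₁-once (inj₂ (a , _)) (inj₁ (b , _)) = Arc-asym a b
  S₁-once (inj₂ (_ , p)) (inj₂ (_ , q)) = 0≢1+n (trans (sym p) q)

  S₁-not-S₂ : ∀ {k x y} → S₁ₑ k x y → ¬ (S₂ 0 x y ⊎ S₂ 1 x y)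
  S₁-not-S₂ (inj₁ ((_ , (_ , ¬s) , _) , _)) s = ¬s s
  S₁-not-S₂ (inj₂ ((_ , (_ , ¬s) , _) , _)) (inj₁ s) = ¬s (inj₁ (S₂-sym s))
  S₁-not-S₂ (inj₂ ((_ , (_ , ¬s) , _) , _)) (inj₂ s) = ¬s (inj₂ (S₂-sym s))

  S₂-once : ∀ {x y} → S₂ 0 x y → ¬ S₂ 1 x y
  S₂-once (_ , p) (_ , q) = 0≢1+n (trans (sym p) q)

  Class-unique : ∀ q r {x y} → Class q x y → Class r x y → q ≡ r
  Class-unique 0 0 _ _ = refl
  Class-unique 1 1 _ _ = refl
  Class-unique 2 2 _ _ = refl
  Class-unique 3 3 _ _ = refl
  Class-unique 0 1 a b = contradiction b (S₁-once a)
  Class-unique 1 0 a b = contradiction a (S₁-once b)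
  Class-unique 0 2 a b = contradiction (inj₁ b) (S₁-not-S₂ {0} a)
  Class-unique 0 3 a b = contradiction (inj₂ b) (S₁-not-S₂ {0} a)
  Class-unique 1 2 a b = contradiction (inj₁ b) (S₁-not-S₂ {1} a)
  Class-unique 1 3 a b = contradiction (inj₂ b) (S₁-not-S₂ {1} a)
  Class-unique 2 0 a b = contradiction (inj₁ a) (S₁-not-S₂ {0} b)
  Class-unique 3 0 a b = contradiction (inj₂ a) (S₁-not-S₂ {0} b)
  Class-unique 2 1 a b = contradiction (inj₁ a) (S₁-not-S₂ {1} b)
  Class-unique 3 1 a b = contradiction (inj₂ a) (S₁-not-S₂ {1} b)
  Class-unique 2 3 a b = contradiction b (S₂-once a)
  Class-unique 3 2 a b = contradiction a (S₂-once b)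
  Class-unique (suc (suc (suc (suc _)))) _ () _
  Class-unique _ (suc (suc (suc (suc _)))) _ ()

  -- `L` counts the layers: one owner contributes 0, 1 or 2, and two owners together 0 to 4. `T-1`
  -- is the step minus one, which keeps `T` visibly nonzero. `quot` bounds base colour divided by
  -- step: 9D + 1 base colours fit into five intervals of length `2 * m`, and 2D + 1 of them into
  -- one.
  L T-1 quot : ℕ → ℕ
  L 0 = 3
  L 1 = 3
  L _ = 5
  T-1 1 = pred (2 * m)
  T-1 3 = pred (2 * m)
  T-1 _ = 0
  quot 0 = 9 * D
  quot 1 = 4
  quot 2 = 2 * D
  quot _ = 0

  T : ℕ → ℕ
  T q = suc (T-1 q)

  off : ℕ → ℕ
  off 0       = suc Q
  off (suc q) = off q + suc (quot q) * L q * T q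

  off-mono : ∀ {q r} → q ≤ r → off q ≤ off r
  off-mono {q} {r} le = subst (λ z → off q ≤ off z) (m∸n+n≡m le) (go (r ∸ q))
    where
    go : ∀ d → off q ≤ off (d + q)
    go zero    = ≤-refl
    go (suc d) = ≤-trans (go d) (m≤m+n _ _)

  abstract
    S₁ₑ? : ∀ k x y → Dec (S₁ₑ k x y)
    S₁ₑ? k x y = S₁? k x y ⊎-dec S₁? k y x

    base₁ : ∀ k → Σ (Fin n → Fin n → ℕ) (ProperOn (S₁ₑ k) (suc (9 * D)))
    base₁ k = Graphs.vizing (S₁ₑ k) (S₁ₑ? k) (S₁ₑ-sym {k}) (S₁ₑ-irr {k}) (9 * D)
      (λ v → ≤-trans (cnt-mono (S₁ₑ? k v) (λ y → S₁? k v y ⊎-dec S₁? k y v) (λ _ s → s)) (S₁-deg k v))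

    base₂ : ∀ k → Σ (Fin n → Fin n → ℕ) (ProperOn (S₂ k) (suc (2 * D)))
    base₂ k = Graphs.vizing (S₂ k) (S₂? k) (S₂-sym {k}) (λ ((e , _) , _) → E-irr e) (2 * D) (S₂-deg k)

  base : ℕ → Fin n → Fin n → ℕ
  base 0 = proj₁ (base₁ 0)
  base 1 = proj₁ (base₁ 1)
  base 2 = proj₁ (base₂ 0)
  base _ = proj₁ (base₂ 1)

  base-sym : ∀ q {x y} → Class q x y → base q x y ≡ base q y x
  base-sym 0 = proj₁ (proj₂ (proj₂ (base₁ 0)))
  base-sym 1 = proj₁ (proj₂ (proj₂ (base₁ 1)))
  base-sym 2 = proj₁ (proj₂ (proj₂ (base₂ 0)))
  base-sym 3 = proj₁ (proj₂ (proj₂ (base₂ 1)))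
  base-sym (suc (suc (suc (suc _)))) ()

  base-proper : ∀ q {x y w} → Class q x y → Class q x w → y ≢ w → base q x y ≢ base q x w
  base-proper 0 = proj₂ (proj₂ (proj₂ (base₁ 0)))
  base-proper 1 = proj₂ (proj₂ (proj₂ (base₁ 1)))
  base-proper 2 = proj₂ (proj₂ (proj₂ (base₂ 0)))
  base-proper 3 = proj₂ (proj₂ (proj₂ (base₂ 1)))
  base-proper (suc (suc (suc (suc _)))) ()

  base-quot : ∀ q {x y} → Class q x y → base q x y / T q ≤ quot q
  base-quot 0 c = ≤-trans (≤-reflexive (n/1≡n _)) (≤-pred (proj₁ (proj₂ (base₁ 0)) c))
  base-quot 1 {x} {y} c = ≤-pred (m<n*o⇒m/o<n {proj₁ (base₁ 1) x y} {5} {2 * m} (<-≤-trans (proj₁ (proj₂ (base₁ 1)) c) (begin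
    suc (9 * D) ≤⟨ +-mono-≤ (m≤n+m 1 9) (*-monoˡ-≤ D (m≤n+m 9 1)) ⟩
    10 + 10 * D ≡⟨ solve 1 (λ D → con 10 :+ con 10 :* D := con 5 :* (con 2 :* (con 1 :+ D))) refl D ⟩
    5 * (2 * m) ∎)))
    where
    open ≤-Reasoning
    open +-*-Solver
  base-quot 2 c = ≤-trans (≤-reflexive (n/1≡n _)) (≤-pred (proj₁ (proj₂ (base₂ 0)) c))
  base-quot 3 {x} {y} c = ≤-pred (m<n*o⇒m/o<n {proj₁ (base₂ 1) x y} {1} {2 * m} (<-≤-trans (proj₁ (proj₂ (base₂ 1)) c) (begin
    suc (2 * D) ≤⟨ n≤1+n _ ⟩
    2 + 2 * D ≡⟨ solve 1 (λ D → con 2 :+ con 2 :* D := con 1 :* (con 2 :* (con 1 :+ D))) refl D ⟩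
    1 * (2 * m) ∎)))
    where
    open ≤-Reasoning
    open +-*-Solver
  base-quot (suc (suc (suc (suc _)))) ()

  hcol : ℕ → Fin n → Fin n → ℕ → ℕ
  hcol q x y i = off q + pos (L q) (T q) (base q x y) i

  hcol-< : ∀ q {x y i} → Class q x y → i < L q → hcol q x y i < off (suc q)
  hcol-< q {x} {y} c i< = +-monoʳ-< (off q) (pos-< (L q) (T q) {base q x y} (base-quot q c) i<)

  hcol> : ∀ q {x y i} → Q < hcol q x y i
  hcol> q = ≤-trans (off-mono {0} {q} z≤n) (m≤m+n _ _)

  hcol-proper : ∀ q r {x y w i j} → Class q x y → Class r x w → i < L q → j < L r → y ≢ w →
                hcol q x y i ≢ hcol r x w j
  hcol-proper q r {x} {y} {w} {i} {j} c d i< j< y≢w e with <-cmp q r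
  ... | tri< lt _ _ = <⇒≢ (<-≤-trans (hcol-< q c i<) (≤-trans (off-mono lt) (m≤m+n _ _))) e
  ... | tri> _ _ gt = <⇒≢ (<-≤-trans (hcol-< r d j<) (≤-trans (off-mono gt) (m≤m+n _ _))) (sym e)
  ... | tri≈ _ refl _ = base-proper q c d y≢w (pos-inj (L q) (T q) {base q x y} {base q x w} i< j< (+-cancelˡ-≡ (off q) _ _ e))

  abstract
    Class? : ∀ q x y → Dec (Class q x y)
    Class? 0 = S₁ₑ? 0
    Class? 1 = S₁ₑ? 1
    Class? 2 = S₂? 0
    Class? 3 = S₂? 1
    Class? (suc (suc (suc (suc _)))) _ _ = no λ ()

    kind : ∀ x y → ∃[ q ] ((q < 4 × Class q x y) ⊎ (q ≡ 4 × (∀ r → ¬ Class r x y)))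
    kind x y with Class? 0 x y | Class? 1 x y | Class? 2 x y | Class? 3 x y
    ... | yes c | _ | _ | _ = 0 , inj₁ (s≤s z≤n , c)
    ... | no _ | yes c | _ | _ = 1 , inj₁ (s≤s (s≤s z≤n) , c)
    ... | no _ | no _ | yes c | _ = 2 , inj₁ (s≤s (s≤s (s≤s z≤n)) , c)
    ... | no _ | no _ | no _ | yes c = 3 , inj₁ (≤-refl , c)
    ... | no a | no b | no c | no d = 4 , inj₂ (refl , λ { 0 → a ; 1 → b ; 2 → c ; 3 → d ; (suc (suc (suc (suc _)))) () })

  Plain : Fin n → Fin n → Set
  Plain x y = ∀ r → ¬ Class r x y

  Plain-sym : ∀ {x y} → Plain x y → Plain y x
  Plain-sym p r c = p r (Class-sym r c)

  plain-or-class : ∀ x y → Plain x y ⊎ (∃[ q ] Class q x y)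
  plain-or-class x y with kind x y
  ... | q , inj₁ (_ , c) = inj₂ (q , c)
  ... | _ , inj₂ (_ , p) = inj₁ p

  Plain? : ∀ x y → Dec (Plain x y)
  Plain? x y with plain-or-class x y
  ... | inj₁ p = yes p
  ... | inj₂ (q , c) = no (λ p → p q c)

  -- The value 0 outside the four classes makes base colour and step vanish on all other pairs, so
  -- sums can run over every vertex.
  byKind : (ℕ → ℕ) → ℕ → ℕ
  byKind f 0 = f 0
  byKind f 1 = f 1
  byKind f 2 = f 2
  byKind f 3 = f 3
  byKind f _ = 0

  byKind-class : ∀ f q {x y} → Class q x y → byKind f (proj₁ (kind x y)) ≡ f q
  byKind-class f q {x} {y} c with kind x y
  ... | r , inj₂ (_ , p) = contradiction c (p q)
  ... | r , inj₁ (_ , d) rewrite Class-unique r q d c = at q c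
    where
    at : ∀ q → Class q x y → byKind f q ≡ f q
    at 0 _ = refl
    at 1 _ = refl
    at 2 _ = refl
    at 3 _ = refl
    at (suc (suc (suc (suc _)))) ()

  byKind-plain : ∀ f {x y} → Plain x y → byKind f (proj₁ (kind x y)) ≡ 0
  byKind-plain f {x} {y} p with kind x y
  ... | r , inj₁ (_ , d) = contradiction d (p r)
  ... | _ , inj₂ (refl , _) = refl

  abstract
    Aₕ t : Fin n → Fin n → ℕ
    Aₕ x y = byKind (λ q → hcol q x y 0) (proj₁ (kind x y))
    t x y = byKind T (proj₁ (kind x y))

    colour-class : ∀ q {x y} i → Class q x y → Aₕ x y + t x y * i ≡ hcol q x y i
    colour-class q {x} {y} i c = begin
      Aₕ x y + t x y * i ≡⟨ cong₂ (λ a b → a + b * i) (byKind-class (λ q → hcol q x y 0) q c) (byKind-class T q c) ⟩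
      hcol q x y 0 + T q * i ≡⟨ +-assoc (off q) _ _ ⟩
      off q + (pos (L q) (T q) (base q x y) 0 + T q * i) ≡⟨ cong (off q +_) (pos-step (L q) (T q) (base q x y) i) ⟨
      hcol q x y i ∎
      where open ≡-Reasoning

    colour-plain : ∀ {x y} i → Plain x y → Aₕ x y + t x y * i ≡ 0
    colour-plain {x} {y} i p = cong₂ (λ a b → a + b * i) (byKind-plain (λ q → hcol q x y 0) p) (byKind-plain T p)

    t-class : ∀ q {x y} → Class q x y → t x y ≡ T q
    t-class q c = byKind-class T q c

  O : Fin n → Fin n → Set
  O v u = Own 0 v u ⊎ Own 1 v u

  Own-class : ∀ k {v u} → k < 2 → Own k v u → ∃[ q ] Class q v u × T q ≡ suc (T-1 k)
  Own-class 0 _ (inj₁ s) = 2 , s , refl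
  Own-class 0 _ (inj₂ s) = 0 , inj₁ s , refl
  Own-class 1 _ (inj₁ s) = 3 , s , refl
  Own-class 1 _ (inj₂ s) = 1 , inj₁ s , refl
  Own-class (suc (suc _)) (s≤s (s≤s ())) _

  Own-t : ∀ k {v u} → k < 2 → Own k v u → t v u ≡ suc (T-1 k) × t u v ≡ suc (T-1 k)
  Own-t k k< o = let q , c , e = Own-class k k< o in
    trans (t-class q c) e , trans (t-class q (Class-sym q c)) e

  O-class : ∀ {v u} → O v u → ∃[ q ] Class q v u
  O-class (inj₁ o) = let q , c , _ = Own-class 0 (s≤s z≤n) o in q , c
  O-class (inj₂ o) = let q , c , _ = Own-class 1 ≤-refl o in q , c

  O-outer : ∀ {v u} → O v u → Outer v u
  O-outer o = let q , c = O-class o in Class-outer q c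

  O-disj : ∀ {v u} → Own 0 v u → ¬ Own 1 v u
  O-disj (inj₁ s) (inj₁ s′) = S₂-once s s′
  O-disj (inj₁ s) (inj₂ s′) = S₁-not-S₂ {1} (inj₁ s′) (inj₁ s)
  O-disj (inj₂ s) (inj₁ s′) = S₁-not-S₂ {0} (inj₁ s) (inj₂ s′)
  O-disj (inj₂ s) (inj₂ s′) = S₁-once (inj₁ s) (inj₁ s′)

  -- Consequently the other end contributes 0 to the shift, which is why three layers are enough for
  -- such an edge.
  S₁-one-owner : ∀ {k v u} → S₁ k v u → ¬ O u v
  S₁-one-owner {k} s (inj₁ (inj₁ s′)) = S₁-not-S₂ {k} (inj₂ s) (inj₁ s′)
  S₁-one-owner {k} s (inj₂ (inj₁ s′)) = S₁-not-S₂ {k} (inj₂ s) (inj₂ s′)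
  S₁-one-owner s (inj₁ (inj₂ s′)) = Arc-asym (proj₁ s) (proj₁ s′)
  S₁-one-owner s (inj₂ (inj₂ s′)) = Arc-asym (proj₁ s) (proj₁ s′)

  record Tame (y : Fin n → Fin n → ℕ) : Set where
    field
      ≤2   : ∀ v u → y v u ≤ 2
      idle : ∀ {v u} → ¬ O v u → y v u ≡ 0

  layer : ∀ {y} → Tame y → ∀ q {x u} → Class q x u → y x u + y u x < L q
  layer {y} tame q {x} {u} c = go q c
    where
    open Tame tame
    one : ∀ {k} → S₁ₑ k x u → y x u + y u x < 3
    one {k} (inj₁ s) = s≤s (≤-trans (≤-reflexive (trans (cong (y x u +_) (idle (S₁-one-owner {k} s))) (+-identityʳ _))) (≤2 x u))
    one {k} (inj₂ s) = s≤s (≤-trans (≤-reflexive (cong (_+ y u x) (idle (S₁-one-owner {k} s)))) (≤2 u x))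
    go : ∀ q → Class q x u → y x u + y u x < L q
    go 0 c = one {0} c
    go 1 c = one {1} c
    go 2 c = s≤s (+-mono-≤ (≤2 x u) (≤2 u x))
    go 3 c = s≤s (+-mono-≤ (≤2 x u) (≤2 u x))
    go (suc (suc (suc (suc _)))) ()

-- Assembly of the phases

cnt≥1 : ∀ {n} {P : Fin n → Set} (P? : Decidable P) {i} → P i → 1 ≤ cnt P?
cnt≥1 P? {i} p = subst (1 ≤_) (sym (cnt-remove P? i p)) (s≤s z≤n)

-- The weight `ω v` is what a vertex contributes to its own sum: its colour for total colourings, 0
-- for edge colourings. An isolated edge adds the same colour to both sums, so there the weights
-- themselves must differ; this is the hypothesis `isolated`.
module Assembly {n : ℕ} (E : Fin n → Fin n → Set) (E? : ∀ x y → Dec (E x y))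
    (E-sym : ∀ {x y} → E x y → E y x) (E-irr : ∀ {x} → ¬ E x x)
    (D : ℕ) .{{_ : NonZero D}} (D≥ : 240 ≤ D) (Δ : ℕ) (deg≤Δ : ∀ v → cnt (E? v) ≤ Δ)
    (Δ≤D² : Δ ≤ D * D) (D²≤ : D * D ≤ Δ + 2 * D) (ω cv : Fin n → ℕ)
    (cv≢0 : ∀ v → cv v ≢ 0) (cv≤ : ∀ v → cv v ≤ suc Δ)
    (isolated : ∀ {x z} → E x z → (∀ w → E x w → w ≡ z) → (∀ w → E z w → w ≡ x) → ω x ≢ ω z) where

  -- The size is dictated by the greedy colouring of edges between a high and a low vertex: the
  -- degrees are at most Δ and below 14D, and there are at most four further exclusions, two vertex
  -- colours and two sums.
  Q : ℕ
  Q = Δ + 15 * D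

  open Palette E E? E-sym E-irr D D≥ (λ v → ≤-trans (deg≤Δ v) Δ≤D²) Q
  open Cells m using (cell; members; ∈-members; length-members)

  16≤D : 16 ≤ D
  16≤D = ≤-trans (m≤n+m 16 224) D≥

  Low? : ∀ v → Dec (Low v)
  Low? v = ¬? (High? v)

  Sel₀ Sel₁ Sel₂ Pair : Fin n → Fin n → Set
  Sel₀ x u = E x u × (High x × High u) × Plain x u
  Sel₁ x u = E x u × ((High x × Low u) ⊎ (Low x × High u)) × Plain x u
  Sel₂ x u = E x u × Low x × Low u
  -- The isolated edges of the graph induced by the low vertices.
  Pair x z = Sel₂ x z × (∀ v → E x v → Low v → v ≡ z) × (∀ v → E z v → Low v → v ≡ x)

  abstract
    Sel₀? : ∀ x u → Dec (Sel₀ x u)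
    Sel₀? x u = E? x u ×-dec (High? x ×-dec High? u) ×-dec Plain? x u

    Sel₁? : ∀ x u → Dec (Sel₁ x u)
    Sel₁? x u = E? x u ×-dec ((High? x ×-dec Low? u) ⊎-dec (Low? x ×-dec High? u)) ×-dec Plain? x u

    Sel₂? : ∀ x u → Dec (Sel₂ x u)
    Sel₂? x u = E? x u ×-dec Low? x ×-dec Low? u

    Pair? : ∀ x z → Dec (Pair x z)
    Pair? x z = Sel₂? x z ×-dec all? (λ v → E? x v →-dec Low? v →-dec (v Fin.≟ z))
                          ×-dec all? (λ v → E? z v →-dec Low? v →-dec (v Fin.≟ x))

    O? : ∀ v u → Dec (O v u)
    O? v u = Own? 0 v u ⊎-dec Own? 1 v u

  Sel₀-sym : ∀ {x u} → Sel₀ x u → Sel₀ u x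
  Sel₀-sym (e , (h , h′) , p) = E-sym e , (h′ , h) , Plain-sym p

  Sel₁-sym : ∀ {x u} → Sel₁ x u → Sel₁ u x
  Sel₁-sym (e , inj₁ (h , l) , p) = E-sym e , inj₂ (l , h) , Plain-sym p
  Sel₁-sym (e , inj₂ (l , h) , p) = E-sym e , inj₁ (h , l) , Plain-sym p

  Sel₂-sym : ∀ {x u} → Sel₂ x u → Sel₂ u x
  Sel₂-sym (e , l , l′) = E-sym e , l′ , l

  Pair-sym : ∀ {x z} → Pair x z → Pair z x
  Pair-sym (s , p , q) = Sel₂-sym s , q , p

  Pair-inner : ∀ {x z} → Pair x z → Inner x
  Pair-inner ((e , l , l′) , _) = l , _ , e , l′

  low-not-O : ∀ {x z} → Low x → Low z → ¬ O x z
  low-not-O l l′ o = [ l , l′ ]′ (proj₂ (O-outer o))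

  low-plain : ∀ {x z} → Low x → Low z → Plain x z
  low-plain l l′ r c = [ l , l′ ]′ (proj₂ (Class-outer r c))

  -- Edges between high vertices

  main : Σ (Fin n → Fin n → ℕ) λ c → ProperOn Sel₀ (suc D * suc D + suc (3 * D)) c ×
         (∀ {x y} → Sel₀ x y → c x y ≢ pred (cv x))
  main = TotalColouring.total-colouring Sel₀ Sel₀? Sel₀-sym (λ (e , _) → E-irr e) D
    (λ v → ≤-trans (cnt-mono (Sel₀? v) (E? v) (λ _ → proj₁)) (≤-trans (deg≤Δ v) Δ≤D²))
    -- `TotalColouring` counts colours from 0, hence `pred` here and `suc` in `c₀`.
    (λ v → pred (cv v)) (λ v → ≤-<-trans (≤-trans (pred-mono-≤ (cv≤ v)) Δ≤D²) (*-mono-< (n<1+n D) (n<1+n D)))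

  c₀ : Fin n → Fin n → ℕ
  c₀ x u = ifDec (Sel₀? x u) (suc (proj₁ main x u)) 0

  c₀-sel : ∀ {x u} → Sel₀ x u → c₀ x u ≡ suc (proj₁ main x u)
  c₀-sel {x} {u} s = ifDec-yes (Sel₀? x u) s

  c₀-off : ∀ {x u} → ¬ Sel₀ x u → c₀ x u ≡ 0
  c₀-off {x} {u} s = ifDec-no (Sel₀? x u) s

  c₀-nz : ∀ {x u} → c₀ x u ≢ 0 → Sel₀ x u
  c₀-nz {x} {u} nz = decidable-stable (Sel₀? x u) (λ s → nz (c₀-off s))

  palette₀ : suc D * suc D + suc (3 * D) ≤ Q
  palette₀ = begin
    suc D * suc D + suc (3 * D) ≡⟨ solve 1 (λ D → (con 1 :+ D) :* (con 1 :+ D) :+ (con 1 :+ con 3 :* D) := D :* D :+ (con 5 :* D :+ con 2)) refl D ⟩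
    D * D + (5 * D + 2) ≤⟨ +-mono-≤ D²≤ (+-monoʳ-≤ (5 * D) (≤-trans (m≤n+m 2 14) 16≤D)) ⟩
    Δ + 2 * D + (5 * D + D) ≡⟨ solve 2 (λ Δ D → Δ :+ con 2 :* D :+ (con 5 :* D :+ D) := Δ :+ con 8 :* D) refl Δ D ⟩
    Δ + 8 * D ≤⟨ +-monoʳ-≤ Δ (*-monoˡ-≤ D (m≤n+m 8 7)) ⟩
    Δ + 15 * D ∎
    where
    open ≤-Reasoning
    open +-*-Solver

  valid₀ : Valid E Q cv c₀
  valid₀ = record { symm = symm ; bound = bound ; edges = λ nz → proj₁ (c₀-nz nz) ; proper = proper ; vertex = vertex }
    where
    symm : ∀ x y → c₀ x y ≡ c₀ y x
    symm x y = go (Sel₀? x y)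
      where
      go : Dec (Sel₀ x y) → c₀ x y ≡ c₀ y x
      go (yes s) = trans (c₀-sel s) (trans (cong suc (proj₁ (proj₂ (proj₁ (proj₂ main))) s)) (sym (c₀-sel (Sel₀-sym s))))
      go (no s)  = trans (c₀-off s) (sym (c₀-off (s ∘ Sel₀-sym)))
    bound : ∀ x y → c₀ x y ≤ Q
    bound x y = go (Sel₀? x y)
      where
      go : Dec (Sel₀ x y) → c₀ x y ≤ Q
      go (yes s) = ≤-trans (≤-reflexive (c₀-sel s)) (≤-trans (proj₁ (proj₁ (proj₂ main)) s) palette₀)
      go (no s)  = ≤-trans (≤-reflexive (c₀-off s)) z≤n
    proper : ∀ {x y w} → c₀ x y ≢ 0 → y ≢ w → c₀ x y ≢ c₀ x w
    proper {x} {y} {w} nz y≢w e = proj₂ (proj₂ (proj₁ (proj₂ main))) s s′ y≢w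
      (suc-injective (trans (sym (c₀-sel s)) (trans e (c₀-sel s′))))
      where
      s = c₀-nz nz
      s′ = c₀-nz (subst (_≢ 0) e nz)
    vertex : ∀ {x y} → c₀ x y ≢ 0 → c₀ x y ≢ cv x
    vertex nz e = proj₂ (proj₂ main) (c₀-nz nz) (cong pred (trans (sym (c₀-sel (c₀-nz nz))) e))

  -- Owned edges start in the middle of 0, 1, 2, so that the owner can later move either way.
  y₀ : Fin n → Fin n → ℕ
  y₀ v u = bit (O? v u)

  carried : (Fin n → Fin n → ℕ) → Fin n → Fin n → ℕ
  carried y v u = Aₕ v u + t v u * (y v u + y u v)

  σ : (Fin n → Fin n → ℕ) → Fin n → ℕ
  σ y v = ω v + sum (carried y v)

  -- Edges between a high and a low vertex

  Pair-deg : ∀ x → cnt (Pair? x) ≤ 1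
  Pair-deg x = cnt-bound (Pair? x) (λ _ → 0) 1 (λ _ _ → s≤s z≤n)
    (λ u w (_ , p , _) ((e , _ , l) , _) _ → sym (p w e l))

  low-deg : ∀ {x} → Low x → cnt (E? x) < 14 * D
  low-deg l = ≰⇒> l

  room₁ : ∀ {x u} → Sel₁ x u → cnt (E? x) + (cnt (E? u) + (2 + (cnt (Pair? x) + cnt (Pair? u)))) < Q
  room₁ {x} {u} (_ , hl , _) = begin-strict
    dx + (du + (2 + (cnt (Pair? x) + cnt (Pair? u)))) ≤⟨ +-monoʳ-≤ dx (+-monoʳ-≤ du (+-monoʳ-≤ 2 (+-mono-≤ (Pair-deg x) (Pair-deg u)))) ⟩
    dx + (du + 4) ≡⟨ +-assoc dx du 4 ⟨
    dx + du + 4 <⟨ +-mono-<-≤ (both hl) (≤-trans (m≤n+m 4 12) 16≤D) ⟩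
    Δ + 14 * D + D ≡⟨ solve 2 (λ Δ D → Δ :+ con 14 :* D :+ D := Δ :+ con 15 :* D) refl Δ D ⟩
    Δ + 15 * D ∎
    where
    open ≤-Reasoning
    open +-*-Solver
    dx = cnt (E? x)
    du = cnt (E? u)
    both : (High x × Low u) ⊎ (Low x × High u) → dx + du < Δ + 14 * D
    both (inj₁ (_ , l)) = +-mono-≤-< (deg≤Δ x) (low-deg l)
    both (inj₂ (l , _)) = ≤-trans (+-mono-<-≤ (low-deg l) (deg≤Δ u)) (≤-reflexive (+-comm (14 * D) Δ))

  -- The sums include the selected edges in their starting position. An end of a pair that owns no
  -- selected edge keeps this sum through the alteration phases, so for a pair with two such ends a
  -- separation reached here lasts.
  module G₁ = Greedy E E? E-irr Q cv (σ y₀) Sel₁ Pair Sel₁? Pair? proj₁ Sel₁-sym Pair-sym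
    (λ ((e , _) , _) → E-irr e) room₁

  zero₀ : ∀ {x u} → Sel₁ x u → c₀ x u ≡ 0
  zero₀ (_ , inj₁ (h , l) , _) = c₀-off (λ (_ , (_ , h′) , _) → l h′)
  zero₀ (_ , inj₂ (l , h) , _) = c₀-off (λ (_ , (h′ , _) , _) → l h′)

  ext₁ : G₁.Extension c₀ (List.cartesianProduct (allFin n) (allFin n))
  ext₁ = G₁.extend-all c₀ valid₀ zero₀

  module X₁ = G₁.Extension ext₁

  c₁ : Fin n → Fin n → ℕ
  c₁ = X₁.c

  c₁-low : ∀ {x u} → Low x → Low u → c₁ x u ≡ 0
  c₁-low l l′ = trans (X₁.same (λ { (_ , inj₁ (h , _) , _) → l h ; (_ , inj₂ (_ , h) , _) → l′ h }))
                      (c₀-off (λ (_ , (h , _) , _) → l h))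

  -- Alteration of the selected edges

  module Pr = Process m ω (λ v u → c₁ v u + Aₕ v u) t (Own 0) (Own 1) (Own? 0) (Own? 1)
    (λ o → E-irr (proj₁ (O-outer o))) O-disj (Own-t 0 (s≤s z≤n)) (Own-t 1 ≤-refl)
  open Pr using (S; S-def; Step; step)

  S-split : ∀ y v → S y v ≡ σ y v + sum (c₁ v)
  S-split y v = trans (S-def y v) (trans (cong (ω v +_) (trans (sum-cong-≗ (λ u → trans (+-assoc (c₁ v u) _ _) (+-comm (c₁ v u) _)))
    (∑-distrib-+ (carried y v) (c₁ v)))) (sym (+-assoc (ω v) _ _)))

  tame₀ : Tame y₀
  tame₀ = record { ≤2 = λ v u → ≤-trans (bit≤1 (O? v u)) (n≤1+n 1) ; idle = λ {v} {u} ¬o → bit-no (O? v u) ¬o }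

  tame-step : ∀ {y v F} → Tame y → (st : Step y v F) → Tame (Step.y′ st)
  tame-step {y} {v} tame st = record { ≤2 = λ w u → ≤2′ w u (w Fin.≟ v) (O? w u) ; idle = λ {w} ¬o → idle′ ¬o (w Fin.≟ v) }
    where
    open Step st
    ≤2′ : ∀ w u → Dec (w ≡ v) → Dec (O w u) → y′ w u ≤ 2
    ≤2′ w u (no w≢v) _ = ≤-trans (≤-reflexive (rows w≢v)) (Tame.≤2 tame w u)
    ≤2′ w u (yes refl) (yes o) = small o
    ≤2′ w u (yes refl) (no ¬o) = ≤-trans (≤-reflexive (others ¬o)) (Tame.≤2 tame w u)
    idle′ : ∀ {w u} → ¬ O w u → Dec (w ≡ v) → y′ w u ≡ 0
    idle′ ¬o (no w≢v) = trans (rows w≢v) (Tame.idle tame ¬o)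
    idle′ ¬o (yes refl) = trans (others ¬o) (Tame.idle tame ¬o)

  -- An `S₂`-edge is owned by both ends, and no arc leads to an inner vertex.
  inner-not-O : ∀ {v w} → Inner w → (∀ u → ¬ O w u) → ¬ O v w
  inner-not-O i ¬o (inj₁ (inj₁ s)) = ¬o _ (inj₁ (inj₁ (S₂-sym s)))
  inner-not-O i ¬o (inj₂ (inj₁ s)) = ¬o _ (inj₂ (inj₁ (S₂-sym s)))
  inner-not-O i ¬o (inj₁ (inj₂ ((_ , ((_ , ¬i , _) , _) , _) , _))) = ¬i i
  inner-not-O i ¬o (inj₂ (inj₂ ((_ , ((_ , ¬i , _) , _) , _) , _))) = ¬i i

  -- Different cells are demanded instead of different sums, because later steps preserve the cells
  -- of other vertices but not their sums.
  Processed : ℕ → Set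
  Processed N = Σ (Fin n → Fin n → ℕ) λ y → Tame y ×
    (∀ v u → ¬ (High v × κ v < N) → O v u → y v u ≡ 1) ×
    (∀ v u → High v → κ v < N → Back v u → cell (S y v) ≢ cell (S y u)) ×
    (∀ w → Inner w → (∀ u → ¬ O w u) → S y w ≡ S y₀ w)

  module Processed {N} (pr : Processed N) where
    y     = proj₁ pr
    tame  = proj₁ (proj₂ pr)
    fresh = proj₁ (proj₂ (proj₂ pr))
    cells = proj₁ (proj₂ (proj₂ (proj₂ pr)))
    still = proj₂ (proj₂ (proj₂ (proj₂ pr)))

  cellsOf : (Fin n → Fin n → ℕ) → List (Fin n) → List ℕ
  cellsOf y []       = []
  cellsOf y (u ∷ us) = members (cell (S y u)) ++ cellsOf y us

  length-cellsOf : ∀ y us → length (cellsOf y us) ≡ 4 * length us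
  length-cellsOf y []       = refl
  length-cellsOf y (u ∷ us) = trans (length-++ (members (cell (S y u))))
    (trans (cong₂ _+_ (length-members (cell (S y u))) (length-cellsOf y us)) (sym (*-suc 4 (length us))))

  ∈-cellsOf : ∀ y {u} s us → u ∈ us → cell s ≡ cell (S y u) → s ∈ cellsOf y us
  ∈-cellsOf y s (u ∷ us) (here refl) e = ∈-++⁺ˡ (subst (λ c → s ∈ members c) e (∈-members s))
  ∈-cellsOf y s (u ∷ us) (there i)   e = ∈-++⁺ʳ (members (cell (S y u))) (∈-cellsOf y s us i e)

  advance : ∀ N → Processed N → Processed (suc N)
  advance N pr = go (any? (λ v → High? v ×-dec (κ v ≟ N)))
    where
    open Processed pr
    go : Dec (∃[ v ] High v × κ v ≡ N) → Processed (suc N)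
    go (no none) = y , tame ,
      (λ v u ¬p → fresh v u (λ (h , lt) → ¬p (h , m≤n⇒m≤1+n lt))) ,
      (λ v u h lt → cells v u h (≤∧≢⇒< (≤-pred lt) (λ e → none (v , h , e)))) , still
    go (yes (v , hv , κ≡N)) = y′ , tame-step tame st , fresh′ , cells′ , still′
      where
      en = enough v hv
      m₀ = proj₁ en
      F = cellsOf y (elems (Back? v))
      len : length F < suc m₀ * suc m₀
      len = subst (_< suc m₀ * suc m₀) (sym (trans (length-cellsOf y (elems (Back? v))) (cong (4 *_) (length-elems (Back? v))))) (proj₁ (proj₂ en))
      small-m : m₀ < 2 * m
      small-m = ≤-<-trans (proj₁ (proj₂ (proj₂ en))) (*-monoʳ-< 2 (n<1+n D))
      st : Step y v F
      st = step y v (fresh v _ (λ (_ , lt) → <-irrefl κ≡N lt)) F m₀ m₀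
        (proj₁ (proj₂ (proj₂ (proj₂ en)))) (proj₂ (proj₂ (proj₂ (proj₂ en)))) small-m len
      module St = Step st
      y′ = St.y′
      fresh′ : ∀ w u → ¬ (High w × κ w < suc N) → O w u → y′ w u ≡ 1
      fresh′ w u ¬p o = trans (St.rows (λ { refl → ¬p (hv , s≤s (≤-reflexive κ≡N)) }))
        (fresh w u (λ (h , lt) → ¬p (h , m≤n⇒m≤1+n lt)) o)
      cells′ : ∀ w u → High w → κ w < suc N → Back w u → cell (S y′ w) ≢ cell (S y′ u)
      cells′ w u h lt bk = go′ (w Fin.≟ v)
        where
        go′ : Dec (w ≡ v) → cell (S y′ w) ≢ cell (S y′ u)
        go′ (yes refl) e = St.avoids (∈-cellsOf y (S y′ v) (elems (Back? v)) (∈-elems (Back? v) bk)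
          (trans e (St.cells (λ { refl → E-irr (proj₁ bk) }))))
        go′ (no w≢v) e = cells w u h κ< bk (trans (sym (St.cells w≢v)) (trans e (St.cells u≢v)))
          where
          κ< : κ w < N
          κ< = ≤∧≢⇒< (≤-pred lt) (λ q → w≢v (κ-inj w v (trans q (sym κ≡N))))
          u≢v : u ≢ v
          u≢v refl = <-asym κ< (subst (_< κ w) κ≡N (proj₂ (proj₂ bk)))
      still′ : ∀ w → Inner w → (∀ u → ¬ O w u) → S y′ w ≡ S y₀ w
      still′ w i ¬o = trans (St.sums (λ { refl → proj₁ i hv }) (inner-not-O i ¬o)) (still w i ¬o)

  processed : ∀ N → Processed N
  processed zero = y₀ , tame₀ , (λ v u _ o → bit-yes (O? v u) o) , (λ _ _ _ ()) , (λ _ _ _ → refl)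
  processed (suc N) = advance N (processed N)

  Separated : ℕ → Set
  Separated N = Σ (Fin n → Fin n → ℕ) λ y → Tame y ×
    (∀ v u → Low v → ¬ (toℕ v < N) → O v u → y v u ≡ 1) ×
    (∀ v u → High v → Back v u → cell (S y v) ≢ cell (S y u)) ×
    (∀ x z → Pair x z → toℕ x < N → ∃ (O x) → S y x ≢ S y z) ×
    (∀ w → Inner w → (∀ u → ¬ O w u) → S y w ≡ S y₀ w)

  module Separated {N} (se : Separated N) where
    y     = proj₁ se
    tame  = proj₁ (proj₂ se)
    fresh = proj₁ (proj₂ (proj₂ se))
    cells = proj₁ (proj₂ (proj₂ (proj₂ se)))
    apart = proj₁ (proj₂ (proj₂ (proj₂ (proj₂ se))))
    still = proj₂ (proj₂ (proj₂ (proj₂ (proj₂ se))))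

  -- One owned edge already gives two attainable sums, and only the sum of `z` is excluded. Since
  -- `x` is low and inner, its cell occurs in no condition on `Back`; the edge `xz` is not selected,
  -- so the sum of `z` does not move.
  separate : ∀ N → Separated N → Separated (suc N)
  separate N se = go (any? (λ x → (toℕ x ≟ N) ×-dec any? (λ z → Pair? x z ×-dec any? (O? x) ×-dec (S y x ≟ S y z))))
    where
    open Separated se
    go : Dec (∃[ x ] toℕ x ≡ N × ∃[ z ] Pair x z × ∃ (O x) × S y x ≡ S y z) → Separated (suc N)
    go (no none) = y , tame , (λ v u l ¬p → fresh v u l (λ lt → ¬p (m≤n⇒m≤1+n lt))) , cells , apart′ , still
      where
      apart′ : ∀ x z → Pair x z → toℕ x < suc N → ∃ (O x) → S y x ≢ S y z
      apart′ x z pz lt o e = go′ (toℕ x ≟ N)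
        where
        go′ : Dec (toℕ x ≡ N) → ⊥
        go′ (yes q) = none (x , q , z , pz , o , e)
        go′ (no q)  = apart x z pz (≤∧≢⇒< (≤-pred lt) q) o e
    go (yes (x , x≡N , z , pz , ox , eq)) = y′ , tame-step tame st , fresh′ ,
      (λ v u h bk e → cells v u h bk (trans (sym (St.cells (λ { refl → lx h })))
        (trans e (St.cells (λ { refl → proj₁ (proj₂ bk) ix }))))) , apart′ , still′
      where
      ix = Pair-inner pz
      lx = proj₁ ix
      F = S y z ∷ []
      ready : ∀ {u} → O x u → y x u ≡ 1
      ready = fresh x _ lx (λ lt → <-irrefl x≡N lt)
      2≤2m : 2 ≤ 2 * m
      2≤2m = *-monoʳ-≤ 2 (s≤s z≤n)
      st : Step y x F
      st = make (proj₂ ox)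
        where
        make : ∀ {u} → O x u → Step y x F
        make (inj₁ o) = step y x ready F 1 0 (cnt≥1 (Own? 0 x) o) z≤n 2≤2m ≤-refl
        make (inj₂ o) = step y x ready F 0 1 z≤n (cnt≥1 (Own? 1 x) o) (≤-trans (n≤1+n 1) 2≤2m) ≤-refl
      module St = Step st
      y′ = St.y′
      fresh′ : ∀ w u → Low w → ¬ (toℕ w < suc N) → O w u → y′ w u ≡ 1
      fresh′ w u l ¬p o = trans (St.rows (λ { refl → ¬p (s≤s (≤-reflexive x≡N)) })) (fresh w u l (λ lt → ¬p (m≤n⇒m≤1+n lt)) o)
      unmoved : ∀ {w} → w ≢ x → Low w → S y′ w ≡ S y w
      unmoved w≢x lw = St.sums w≢x (low-not-O lx lw)
      z≢ : ∀ {w v} → Pair w v → v ≢ w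
      z≢ ((e , _) , _) refl = E-irr e
      apart′ : ∀ w v → Pair w v → toℕ w < suc N → ∃ (O w) → S y′ w ≢ S y′ v
      apart′ w v pw lt o = go′ (w Fin.≟ x)
        where
        lw = proj₁ (Pair-inner pw)
        lv = proj₁ (Pair-inner (Pair-sym pw))
        go′ : Dec (w ≡ x) → S y′ w ≢ S y′ v
        go′ (yes refl) e = St.avoids (here (trans e (trans (unmoved (z≢ pw) lv)
          (cong (S y) (proj₁ (proj₂ pz) v (proj₁ (proj₁ pw)) lv)))))
        go′ (no w≢x) e = go″ (v Fin.≟ x)
          where
          old : S y w ≢ S y v
          old = apart w v pw (≤∧≢⇒< (≤-pred lt) (λ q → w≢x (toℕ-injective (trans q (sym x≡N))))) o
          go″ : Dec (v ≡ x) → ⊥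
          go″ (no v≢x) = old (trans (sym (unmoved w≢x lw)) (trans e (unmoved v≢x lv)))
          go″ (yes refl) = old (trans (cong (S y) (proj₁ (proj₂ pz) w (E-sym (proj₁ (proj₁ pw))) lw)) (sym eq))
      still′ : ∀ w → Inner w → (∀ u → ¬ O w u) → S y′ w ≡ S y₀ w
      still′ w i ¬o = trans (unmoved (λ { refl → ¬o _ (proj₂ ox) }) (proj₁ i)) (still w i ¬o)

  κ-bound : ∀ v → κ v < n * n + n
  κ-bound v = +-mono-≤-< (*-monoˡ-≤ n (cnt≤n (E? v))) (toℕ<n v)

  separated : ∀ N → Separated N
  separated zero = y , tame , (λ v u l _ → fresh v u (l ∘ proj₁)) ,
    (λ v u h → cells v u h (κ-bound v)) , (λ _ _ _ ()) , still
    where open Processed (processed (n * n + n))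
  separated (suc N) = separate N (separated N)

  abstract
    final : Separated n
    final = separated n

  open Separated final using (y; tame; cells; apart; still)

  -- Edges between low vertices

  Δ≥ : 238 * D ≤ Δ
  Δ≥ = +-cancelʳ-≤ (2 * D) (238 * D) Δ (≤-trans (≤-reflexive (sym (*-distribʳ-+ D 238 2))) (≤-trans (*-monoˡ-≤ D D≥) D²≤))

  -- Every neighbour of an end is counted twice, once for the colour of the edge and once for its
  -- sum. With degrees below 14D this makes at most 57D exclusions, far fewer than Δ.
  room₂ : ∀ {x u} → Sel₂ x u → cnt (E? x) + (cnt (E? u) + (2 + (cnt (E? x) + cnt (E? u)))) < Q
  room₂ {x} {u} (_ , l , l′) = begin-strict
    dx + (du + (2 + (dx + du))) ≤⟨ +-mono-≤ dx≤ (+-mono-≤ du≤ (+-mono-≤ (≤-trans (m≤n+m 2 14) 16≤D) (+-mono-≤ dx≤ du≤))) ⟩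
    a + (a + (D + (a + a))) ≡⟨ solve 1 (λ D → con 14 :* D :+ (con 14 :* D :+ (D :+ (con 14 :* D :+ con 14 :* D))) := con 57 :* D) refl D ⟩
    57 * D ≤⟨ *-monoˡ-≤ D (m≤n+m 57 181) ⟩
    238 * D ≤⟨ Δ≥ ⟩
    Δ <⟨ m<m+n Δ (≤-trans (s≤s z≤n) (*-monoʳ-≤ 15 (>-nonZero⁻¹ D))) ⟩
    Δ + 15 * D ∎
    where
    open ≤-Reasoning
    open +-*-Solver
    a = 14 * D
    dx = cnt (E? x)
    du = cnt (E? u)
    dx≤ : dx ≤ a
    dx≤ = <⇒≤ (low-deg l)
    du≤ : du ≤ a
    du≤ = <⇒≤ (low-deg l′)

  module G₂ = Greedy E E? E-irr Q cv (σ y) Sel₂ E Sel₂? E? proj₁ Sel₂-sym E-sym E-irr room₂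

  ext₂ : G₂.Extension c₁ (List.cartesianProduct (allFin n) (allFin n))
  ext₂ = G₂.extend-all c₁ X₁.valid (λ (_ , l , l′) → c₁-low l l′)

  module X₂ = G₂.Extension ext₂
  module V₂ = Valid X₂.valid

  c₂ : Fin n → Fin n → ℕ
  c₂ = X₂.c

  colour : Fin n → Fin n → ℕ
  colour x u = c₂ x u + carried y x u

  total : Fin n → ℕ
  total v = ω v + sum (colour v)

  total-split : ∀ v → total v ≡ σ y v + sum (c₂ v)
  total-split v = trans (cong (ω v +_) (trans (sum-cong-≗ (λ u → +-comm (c₂ v u) (carried y v u)))
    (∑-distrib-+ (carried y v) (c₂ v)))) (sym (+-assoc (ω v) _ _))

  all-pairs : ∀ x u → (x , u) ∈ List.cartesianProduct (allFin n) (allFin n)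
  all-pairs x u = ∈-cartesianProduct⁺ (∈-allFin x) (∈-allFin u)

  done₂ : ∀ {x u} → Sel₂ x u → c₂ x u ≢ 0
  done₂ {x} {u} = X₂.done (all-pairs x u)

  done₁ : ∀ {x u} → Sel₁ x u → c₁ x u ≢ 0
  done₁ {x} {u} = X₁.done (all-pairs x u)

  c₂-class : ∀ q {x u} → Class q x u → c₂ x u ≡ 0
  c₂-class q c = trans (X₂.same (λ (_ , l , l′) → low-plain l l′ q c))
    (trans (X₁.same (λ (_ , _ , p) → p q c)) (c₀-off (λ (_ , _ , p) → p q c)))

  c₂-plain : ∀ {x u} → E x u → Plain x u → c₂ x u ≢ 0
  c₂-plain {x} {u} e p = go (High? x) (High? u)
    where
    go : Dec (High x) → Dec (High u) → c₂ x u ≢ 0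
    go (no l) (no l′) = done₂ (e , l , l′)
    go (yes h) (no l) z = done₁ (e , inj₁ (h , l) , p) (trans (sym (X₂.same (λ (_ , l , _) → l h))) z)
    go (no l) (yes h) z = done₁ (e , inj₂ (l , h) , p) (trans (sym (X₂.same (λ (_ , _ , l) → l h))) z)
    go (yes h) (yes h′) z = 0≢1+n (trans (sym (trans (sym (X₁.same not₁)) (trans (sym (X₂.same (λ (_ , l , _) → l h))) z))) (c₀-sel (e , (h , h′) , p)))
      where
      not₁ : ¬ Sel₁ x u
      not₁ (_ , inj₁ (_ , l) , _) = l h′
      not₁ (_ , inj₂ (l , _) , _) = l h

  colour-of-plain : ∀ {x u} → Plain x u → colour x u ≡ c₂ x u
  colour-of-plain {x} {u} p = trans (cong (c₂ x u +_) (colour-plain _ p)) (+-identityʳ _)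

  shiftOf : Fin n → Fin n → ℕ
  shiftOf x u = y x u + y u x

  colour-of-class : ∀ q {x u} → Class q x u → colour x u ≡ hcol q x u (shiftOf x u)
  colour-of-class q c = cong₂ _+_ (c₂-class q c) (colour-class q _ c)

  colour-off : ∀ {x u} → ¬ E x u → colour x u ≡ 0
  colour-off {x} {u} ¬e = trans (colour-of-plain (λ q c → ¬e (proj₁ (Class-outer q c))))
    (decidable-stable (c₂ x u ≟ 0) (λ nz → ¬e (V₂.edges nz)))

  colour-sym : ∀ x u → colour x u ≡ colour u x
  colour-sym x u = go (plain-or-class x u)
    where
    go : Plain x u ⊎ (∃[ q ] Class q x u) → colour x u ≡ colour u x
    go (inj₁ p) = trans (colour-of-plain p) (trans (V₂.symm x u) (sym (colour-of-plain (Plain-sym p))))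
    go (inj₂ (q , c)) = trans (colour-of-class q c) (trans
      (cong₂ (λ β i → off q + pos (L q) (T q) β i) (base-sym q c) (+-comm (y x u) (y u x)))
      (sym (colour-of-class q (Class-sym q c))))

  layer-of : ∀ q {x u} → Class q x u → shiftOf x u < L q
  layer-of q c = layer tame q c

  Q<colour : ∀ q {x u} → Class q x u → Q < colour x u
  Q<colour q c = <-≤-trans (hcol> q) (≤-reflexive (sym (colour-of-class q c)))

  colour≢0 : ∀ {x u} → E x u → colour x u ≢ 0
  colour≢0 {x} {u} e z = go (plain-or-class x u)
    where
    go : Plain x u ⊎ (∃[ q ] Class q x u) → ⊥
    go (inj₁ p) = c₂-plain e p (trans (sym (colour-of-plain p)) z)
    go (inj₂ (q , c)) = n≮0 (subst (Q <_) z (Q<colour q c))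

  colour-bound : ∀ x u → colour x u < off 4
  colour-bound x u = go (plain-or-class x u)
    where
    go : Plain x u ⊎ (∃[ q ] Class q x u) → colour x u < off 4
    go (inj₁ p) = ≤-trans (s≤s (≤-trans (≤-reflexive (colour-of-plain p)) (V₂.bound x u))) (off-mono {0} {4} z≤n)
    go (inj₂ (q , c)) = <-≤-trans (≤-<-trans (≤-reflexive (colour-of-class q c)) (hcol-< q c (layer-of q c))) (off-mono (q<4 q c))
      where
      q<4 : ∀ q → Class q x u → q < 4
      q<4 0 _ = s≤s z≤n
      q<4 1 _ = s≤s (s≤s z≤n)
      q<4 2 _ = s≤s (s≤s (s≤s z≤n))
      q<4 3 _ = ≤-refl
      q<4 (suc (suc (suc (suc _)))) ()

  colour-proper : ∀ {x u w} → E x u → E x w → u ≢ w → colour x u ≢ colour x w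
  colour-proper {x} {u} {w} e f u≢w eq = go (plain-or-class x u) (plain-or-class x w)
    where
    mixed : ∀ {u w} → Plain x u → ∃[ q ] Class q x w → colour x u ≢ colour x w
    mixed p (q , c) eq = <⇒≢ (≤-<-trans (≤-trans (≤-reflexive (colour-of-plain p)) (V₂.bound _ _)) (Q<colour q c)) eq
    go : Plain x u ⊎ (∃[ q ] Class q x u) → Plain x w ⊎ (∃[ q ] Class q x w) → ⊥
    go (inj₁ p) (inj₁ p′) = V₂.proper (c₂-plain e p) u≢w (trans (sym (colour-of-plain p)) (trans eq (colour-of-plain p′)))
    go (inj₁ p) (inj₂ c) = mixed p c eq
    go (inj₂ c) (inj₁ p) = mixed p c (sym eq)
    go (inj₂ (q , c)) (inj₂ (r , d)) = hcol-proper q r c d (layer-of q c) (layer-of r d) u≢w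
      (trans (sym (colour-of-class q c)) (trans eq (colour-of-class r d)))

  colour-vertex : ∀ {x u} → E x u → cv x ≢ colour x u
  colour-vertex {x} {u} e eq = go (plain-or-class x u)
    where
    go : Plain x u ⊎ (∃[ q ] Class q x u) → ⊥
    go (inj₁ p) = V₂.vertex (c₂-plain e p) (trans (sym (colour-of-plain p)) (sym eq))
    go (inj₂ (q , c)) = <⇒≢ (≤-<-trans (≤-trans (cv≤ x) (≤-trans (≤-reflexive (+-comm 1 Δ))
      (+-monoʳ-≤ Δ (≤-trans (≤-trans (m≤n+m 1 15) 16≤D) (≤-trans (≤-reflexive (sym (*-identityˡ D))) (*-monoˡ-≤ D (m≤n+m 1 14))))))) (Q<colour q c)) eq

  total-outside : ∀ {v} → (∀ u → ¬ Sel₂ v u) → total v ≡ S y v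
  total-outside {v} h = trans (total-split v) (trans (cong (σ y v +_) (sum-cong-≗ (λ u → X₂.same (h u)))) (sym (S-split y v)))

  total-pair : ∀ {x z} → Pair x z → total x ≡ S y x + c₂ x z
  total-pair {x} {z} ((e , l , l′) , only , _) = trans (total-split x) (trans (cong (σ y x +_) row)
    (trans (sym (+-assoc (σ y x) (sum (c₁ x)) (c₂ x z))) (cong (_+ c₂ x z) (sym (S-split y x)))))
    where
    row : sum (c₂ x) ≡ sum (c₁ x) + c₂ x z
    row = trans (sym (trans (cong (sum (c₂ x) +_) (c₁-low l l′)) (+-identityʳ _)))
      (sum-two (c₂ x) (c₁ x) z (λ i i≢z → X₂.same (λ (e′ , _ , l″) → i≢z (only i e′ l″))))

  high-total : ∀ {v} → High v → total v ≡ S y v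
  high-total h = total-outside (λ u (_ , l , _) → l h)

  back-apart : ∀ {v u} → High v → Back v u → total v ≢ total u
  back-apart {v} {u} h bk e = cells v u h bk (cong cell (trans (sym (high-total h)) (trans e (total-outside outside))))
    where
    outside : ∀ w → ¬ Sel₂ u w
    outside w (e , l , l′) = proj₁ (proj₂ bk) (l , w , e , l′)

  touched-apart : ∀ {x u z} → E x u → z ≢ u → Sel₂ x z → total x ≢ total u
  touched-apart {x} {u} {z} e z≢u s eq =
    X₂.apart e (z , z≢u , s , done₂ s) (trans (sym (total-split x)) (trans eq (total-split u)))

  pair-plain : ∀ {x w} → Inner x → (∀ u → ¬ O x u) → Plain x w
  pair-plain i ¬o 0 (inj₁ ((nx , _) , _)) = proj₁ i (proj₁ nx)
  pair-plain i ¬o 0 (inj₂ ((_ , ((_ , ¬i , _) , _) , _) , _)) = ¬i i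
  pair-plain i ¬o 1 (inj₁ ((nx , _) , _)) = proj₁ i (proj₁ nx)
  pair-plain i ¬o 1 (inj₂ ((_ , ((_ , ¬i , _) , _) , _) , _)) = ¬i i
  pair-plain i ¬o 2 s = ¬o _ (inj₁ (inj₁ s))
  pair-plain i ¬o 3 s = ¬o _ (inj₂ (inj₁ s))
  pair-plain i ¬o (suc (suc (suc (suc _)))) ()

  -- As `x` is inner and owns nothing, its edge to the high vertex `w` is not selected. So it was
  -- coloured greedily, with the sums of the pair already to be kept apart.
  start-apart : ∀ {x z w} → Pair x z → (∀ u → ¬ O x u) → E x w → High w → S y₀ x ≢ S y₀ z
  start-apart {x} {z} {w} pz ¬o e h eq =
    X₁.apart pz (w , (λ { refl → proj₁ (Pair-inner (Pair-sym pz)) h }) , s , done₁ s)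
      (trans (sym (S-split y₀ x)) (trans eq (S-split y₀ z)))
    where
    s : Sel₁ x w
    s = e , inj₂ (proj₁ (Pair-inner pz) , h) , pair-plain (Pair-inner pz) ¬o

  lonely : ∀ {x z} → Pair x z → (∀ w → E x w → ¬ High w) → S y₀ x ≡ ω x
  lonely {x} {z} ((_ , l , _) , _) ¬h = trans (S-def y₀ x) (trans (cong (ω x +_) (sum-zero (λ w → none w (E? x w)))) (+-identityʳ (ω x)))
    where
    none : ∀ w → Dec (E x w) → c₁ x w + Aₕ x w + t x w * (y₀ x w + y₀ w x) ≡ 0
    none w d = trans (+-assoc (c₁ x w) _ _) (cong₂ _+_ (c₁-zero d) (colour-plain (y₀ x w + y₀ w x) (λ q c → plain q c)))
      where
      plain : ∀ q → ¬ Class q x w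
      plain q c = let e , h = Class-outer q c in [ l , ¬h w e ]′ h
      c₁-zero : Dec (E x w) → c₁ x w ≡ 0
      c₁-zero (yes e) = c₁-low l (¬h w e)
      c₁-zero (no ¬e) = decidable-stable (c₁ x w ≟ 0) (λ nz → ¬e (Valid.edges X₁.valid nz))

  -- An end owning a selected edge was handled by `separate`. If neither owns one, the sums are
  -- still the initial ones; then either an end has a high neighbour and `start-apart` applies, or
  -- `xz` is an isolated edge and the weights decide.
  pair-apart : ∀ {x z} → Pair x z → S y x ≢ S y z
  pair-apart {x} {z} pz = go (any? (O? x)) (any? (O? z))
    where
    go : Dec (∃ (O x)) → Dec (∃ (O z)) → S y x ≢ S y z
    go (yes o) _ = apart x z pz (toℕ<n x) o
    go (no _) (yes o) = apart z x (Pair-sym pz) (toℕ<n z) o ∘ sym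
    go (no p) (no q) eq = start (any? (λ w → E? x w ×-dec High? w)) (any? (λ w → E? z w ×-dec High? w))
      where
      p′ : ∀ u → ¬ O x u
      p′ u o = p (u , o)
      q′ : ∀ u → ¬ O z u
      q′ u o = q (u , o)
      eq₀ : S y₀ x ≡ S y₀ z
      eq₀ = trans (sym (still x (Pair-inner pz) p′)) (trans eq (still z (Pair-inner (Pair-sym pz)) q′))
      start : Dec (∃[ w ] E x w × High w) → Dec (∃[ w ] E z w × High w) → ⊥
      start (yes (w , e , h)) _ = start-apart pz p′ e h eq₀
      start (no _) (yes (w , e , h)) = start-apart (Pair-sym pz) q′ e h (sym eq₀)
      start (no a) (no b) = isolated (proj₁ (proj₁ pz))
        (λ w e → proj₁ (proj₂ pz) w e (λ h → a (w , e , h)))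
        (λ w e → proj₂ (proj₂ pz) w e (λ h → b (w , e , h)))
        (trans (sym (lonely pz (λ w e h → a (w , e , h)))) (trans eq₀ (lonely (Pair-sym pz) (λ w e h → b (w , e , h)))))

  -- Cells settle two high ends, and a high end with a low end that is not inner. An inner end with
  -- a low neighbour other than the opposite end was touched in the last greedy phase. Only pairs
  -- remain, and their common edge shifts both sums equally.
  distinguished : ∀ {v u} → E v u → total v ≢ total u
  distinguished {v} {u} e = go (High? v) (High? u)
    where
    high-low : ∀ {v u} → E v u → High v → Low u → total v ≢ total u
    high-low {v} {u} e h l = inner (Inner? u)
      where
      inner : Dec (Inner u) → total v ≢ total u
      inner (yes (_ , z , f , l′)) = touched-apart (E-sym e) (λ { refl → l′ h }) (f , l , l′) ∘ sym
      inner (no ¬i) = back-apart h (e , ¬i , κ-< (<-≤-trans (low-deg l) h))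
    high-not-inner : ∀ {w} → High w → ¬ Inner w
    high-not-inner h (l , _) = l h
    go : Dec (High v) → Dec (High u) → total v ≢ total u
    go (yes h) (no l) = high-low e h l
    go (no l) (yes h) = high-low (E-sym e) h l ∘ sym
    go (yes h) (yes h′) = ordered (<-cmp (κ v) (κ u))
      where
      ordered : Tri (κ v < κ u) (κ v ≡ κ u) (κ v > κ u) → total v ≢ total u
      ordered (tri< lt _ _) = back-apart h′ (E-sym e , high-not-inner h , lt) ∘ sym
      ordered (tri> _ _ gt) = back-apart h (e , high-not-inner h′ , gt)
      ordered (tri≈ _ q _)  = contradiction (subst (E v) (sym (κ-inj v u q)) e) E-irr
    go (no l) (no l′) = low (any? (λ z → Sel₂? v z ×-dec ¬? (z Fin.≟ u))) (any? (λ z → Sel₂? u z ×-dec ¬? (z Fin.≟ v)))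
      where
      low : Dec (∃[ z ] Sel₂ v z × z ≢ u) → Dec (∃[ z ] Sel₂ u z × z ≢ v) → total v ≢ total u
      low (yes (z , s , z≢u)) _ = touched-apart e z≢u s
      low (no _) (yes (z , s , z≢v)) = touched-apart (E-sym e) z≢v s ∘ sym
      low (no a) (no b) eq = pair-apart pz (+-cancelʳ-≡ (c₂ v u) _ _ (trans (sym (total-pair pz))
          (trans eq (trans (total-pair (Pair-sym pz)) (cong (S y u +_) (V₂.symm u v))))))
        where
        pz : Pair v u
        pz = (e , l , l′) ,
          (λ w f lw → decidable-stable (w Fin.≟ u) (λ w≢u → a (w , (f , l , lw) , w≢u))) ,
          (λ w f lw → decidable-stable (w Fin.≟ v) (λ w≢v → b (w , (f , l′ , lw) , w≢v)))

  -- The coefficient 92 is 15 from `Q`, 27 + 30 from the two single-owner classes with three layers,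
  -- and 10 + 10 from the two classes with five layers. The greatest colour is one less than
  -- `off 4`.
  off-4 : off 4 ≡ suc (Δ + (92 * D + 48))
  off-4 = solve 2 (λ Δ D → ((((con 1 :+ (Δ :+ con 15 :* D)) :+ (con 1 :+ con 9 :* D) :* con 3 :* con 1)
      :+ con 5 :* con 3 :* (con 2 :* (con 1 :+ D))) :+ (con 1 :+ con 2 :* D) :* con 5 :* con 1) :+ con 1 :* con 5 :* (con 2 :* (con 1 :+ D))
      := con 1 :+ (Δ :+ (con 92 :* D :+ con 48))) refl Δ D
    where open +-*-Solver

-- Numerical bounds and the vertex colouring

ceiling-root : ∀ Δ → ∃[ D ] Δ ≤ D * D × D * D ≤ Δ + 2 * D
ceiling-root zero = 0 , z≤n , z≤n
ceiling-root (suc Δ) with ceiling-root Δ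
... | D , lo , hi with suc Δ ≤? D * D
...   | yes le = D , le , m≤n⇒m≤1+n hi
...   | no ¬le = suc D , ≤-trans (s≤s lo) (s≤s (≤-trans (m≤n+m (D * D) D) (+-monoʳ-≤ D (*-monoʳ-≤ D (n≤1+n D))))) , (begin
    suc D * suc D ≡⟨ solve 1 (λ D → (con 1 :+ D) :* (con 1 :+ D) := D :* D :+ (con 1 :+ con 2 :* D)) refl D ⟩
    D * D + (1 + 2 * D) ≤⟨ +-mono-≤ (≤-pred (≰⇒> ¬le)) (s≤s (*-monoʳ-≤ 2 (n≤1+n D))) ⟩
    Δ + suc (2 * suc D) ≡⟨ +-suc Δ (2 * suc D) ⟩
    suc Δ + 2 * suc D ∎)
  where
  open ≤-Reasoning
  open +-*-Solver

-- The leading coefficients differ by 95² - 92² = 561. Since D ≥ 240, this slack absorbs the linear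
-- terms, including the 2 · 9025 D that arise from replacing D² by Δ + 2D.
excess-bound : ∀ {Δ D} → 240 ≤ D → D * D ≤ Δ + 2 * D → (92 * D + 48) * (92 * D + 48) ≤ 9025 * Δ
excess-bound {Δ} {D} D≥ hi = +-cancelʳ-≤ (18050 * D) _ _ (begin
  (92 * D + 48) * (92 * D + 48) + 18050 * D
    ≡⟨ solve 1 (λ D → (con 92 :* D :+ con 48) :* (con 92 :* D :+ con 48) :+ con 18050 :* D := con 8464 :* (D :* D) :+ con 26882 :* D :+ con 2304) refl D ⟩
  8464 * (D * D) + 26882 * D + 2304
    ≤⟨ +-monoʳ-≤ (8464 * (D * D) + 26882 * D) (≤-trans (m≤n+m 2304 96) (*-monoʳ-≤ 10 D≥)) ⟩
  8464 * (D * D) + 26882 * D + 10 * D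
    ≡⟨ solve 1 (λ D → con 8464 :* (D :* D) :+ con 26882 :* D :+ con 10 :* D := con 8464 :* (D :* D) :+ con 26892 :* D) refl D ⟩
  8464 * (D * D) + 26892 * D
    ≤⟨ +-monoʳ-≤ (8464 * (D * D)) (*-monoˡ-≤ D (≤-trans (m≤n+m 26892 107748) (*-monoʳ-≤ 561 D≥))) ⟩
  8464 * (D * D) + 561 * D * D
    ≡⟨ solve 1 (λ D → con 8464 :* (D :* D) :+ con 561 :* D :* D := con 9025 :* (D :* D)) refl D ⟩
  9025 * (D * D)
    ≤⟨ *-monoʳ-≤ 9025 hi ⟩
  9025 * (Δ + 2 * D)
    ≡⟨ solve 2 (λ Δ D → con 9025 :* (Δ :+ con 2 :* D) := con 9025 :* Δ :+ con 18050 :* D) refl Δ D ⟩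
  9025 * Δ + 18050 * D ∎)
  where
  open ≤-Reasoning
  open +-*-Solver

vertex-colouring : ∀ {n} (E : Fin n → Fin n → Set) (E? : ∀ x y → Dec (E x y)) → (∀ {x y} → E x y → E y x) →
  (∀ {x} → ¬ E x x) → ∀ Δ → (∀ v → cnt (E? v) ≤ Δ) →
  Σ (Fin n → ℕ) λ cv → (∀ v → cv v ≢ 0) × (∀ v → cv v ≤ suc Δ) × (∀ {u v} → E u v → cv u ≢ cv v)
vertex-colouring {n} E E? E-sym E-irr Δ deg≤ = let cv , nz , le , pr = go n in cv , nz , le , λ {u} {v} e → pr e (toℕ<n u) (toℕ<n v)
  where
  Upto : ℕ → Set
  Upto N = Σ (Fin n → ℕ) λ cv → (∀ v → cv v ≢ 0) × (∀ v → cv v ≤ suc Δ) ×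
           (∀ {u v} → E u v → toℕ u < N → toℕ v < N → cv u ≢ cv v)
  go : ∀ N → Upto N
  go zero = (λ _ → 1) , (λ _ ()) , (λ _ → s≤s z≤n) , (λ _ ())
  go (suc N) with go N
  ... | cv , nz , le , pr with any? (λ v → toℕ v ≟ N)
  ...   | no none = cv , nz , le , λ {u} {v} e p q →
            pr e (≤∧≢⇒< (≤-pred p) (λ r → none (u , r))) (≤∧≢⇒< (≤-pred q) (λ r → none (v , r)))
  ...   | yes (x , x≡N) = cv′ , nz′ , le′ , pr′
    where
    F = images (E? x) cv
    free = avoid {suc Δ} (λ i → suc (toℕ i)) (λ i j e → toℕ-injective (suc-injective e)) F
             (s≤s (≤-trans (≤-reflexive (length-images (E? x) cv)) (deg≤ x)))
    a = suc (toℕ (proj₁ free))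
    cv′ : Fin n → ℕ
    cv′ v = ifDec (v Fin.≟ x) a (cv v)
    at : cv′ x ≡ a
    at = ifDec-yes (x Fin.≟ x) refl
    off : ∀ {v} → v ≢ x → cv′ v ≡ cv v
    off {v} = ifDec-no (v Fin.≟ x)
    nz′ : ∀ v → cv′ v ≢ 0
    nz′ v with v Fin.≟ x
    ... | yes _ = λ ()
    ... | no _  = nz v
    le′ : ∀ v → cv′ v ≤ suc Δ
    le′ v with v Fin.≟ x
    ... | yes _ = toℕ<n (proj₁ free)
    ... | no _  = le v
    fresh : ∀ {v} → E x v → cv′ x ≢ cv′ v
    fresh {v} e q = proj₂ free (subst (_∈ F) (trans (sym (off (λ { refl → E-irr e }))) (trans (sym q) at)) (∈-images (E? x) cv e))
    pr′ : ∀ {u v} → E u v → toℕ u < suc N → toℕ v < suc N → cv′ u ≢ cv′ v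
    pr′ {u} {v} e p q = cases (u Fin.≟ x) (v Fin.≟ x)
      where
      cases : Dec (u ≡ x) → Dec (v ≡ x) → cv′ u ≢ cv′ v
      cases (yes refl) _ = fresh e
      cases (no _) (yes refl) = fresh (E-sym e) ∘ sym
      cases (no u≢x) (no v≢x) r = pr e (below p u≢x) (below q v≢x) (trans (sym (off u≢x)) (trans r (off v≢x)))
        where
        below : ∀ {w} → toℕ w < suc N → w ≢ x → toℕ w < N
        below lt w≢x = ≤∧≢⇒< (≤-pred lt) (λ s → w≢x (toℕ-injective (trans s (sym x≡N))))

-- Transfer to graphs

module OnGraph (G : Graph) where

  N : ℕ
  N = Graph.n G

  E : Fin N → Fin N → Set
  E = Adj G

  E? : ∀ x y → Dec (E x y)
  E? x y = adj G x y Bool.≟ true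

  E-sym : ∀ {x y} → E x y → E y x
  E-sym {x} {y} e = trans (Graph.sym G y x) e

  E-irr : ∀ {x} → ¬ E x x
  E-irr {x} e = case trans (sym e) (irref G x) of λ ()

  nbSum-sum : ∀ v f → nbSum G v f ≡ sum (λ u → if adj G v u then f u else 0)
  nbSum-sum v f = trans (cong ListAction.sum (map-tabulate id (λ u → if adj G v u then f u else 0))) (tab (λ u → if adj G v u then f u else 0))
    where
    tab : ∀ {k} (g : Fin k → ℕ) → ListAction.sum (List.tabulate g) ≡ sum g
    tab {zero}  g = refl
    tab {suc k} g = cong (g zero +_) (tab (g ∘ suc))

  degree-cnt : ∀ v → degree G v ≡ cnt (E? v)
  degree-cnt v = trans (nbSum-sum v (λ _ → 1)) (trans (sum-cong-≗ one) (sym (cnt-sum (E? v))))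
    where
    one : ∀ u → (if adj G v u then 1 else 0) ≡ bit (E? v u)
    one u with adj G v u
    ... | true  = refl
    ... | false = refl

  degree≤ : ∀ v → cnt (E? v) ≤ maxDegree G
  degree≤ v = subst (_≤ maxDegree G) (degree-cnt v) (below (∈-map⁺ (degree G) (∈-allFin v)))
    where
    below : ∀ {x xs} → x ∈ xs → x ≤ List.foldr _⊔_ 0 xs
    below {xs = x ∷ xs} (here refl) = m≤m⊔n x _
    below {xs = y ∷ xs} (there i)   = ≤-trans (below i) (m≤n⊔m y _)

  dsum-sum : ∀ c → (∀ {x u} → ¬ E x u → c x u ≡ 0) → ∀ v → dsum G c v ≡ sum (c v)
  dsum-sum c off v = trans (nbSum-sum v (c v)) (sum-cong-≗ drop)
    where
    drop : ∀ u → (if adj G v u then c v u else 0) ≡ c v u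
    drop u with adj G v u in eq
    ... | true  = refl
    ... | false = sym (off (λ e → case trans (sym e) eq of λ ()))

  module Bound (Δ≥ : maxDegree G ≥ 240 * 240) where

    Δ D : ℕ
    Δ = maxDegree G
    D = proj₁ (ceiling-root Δ)

    D≥ : 240 ≤ D
    D≥ = ≮⇒≥ (λ lt → <-irrefl refl (<-≤-trans (Arithmetic.square-< lt) (≤-trans Δ≥ (proj₁ (proj₂ (ceiling-root Δ))))))

    D≢0 : NonZero D
    D≢0 = >-nonZero (≤-trans (s≤s z≤n) D≥)

    k : ℕ
    k = Δ + (92 * D + 48)

    below : BelowBound Δ k
    below = subst (λ z → z * z ≤ 9025 * Δ) (sym (m+n∸m≡n Δ (92 * D + 48))) (excess-bound {Δ} {D} D≥ (proj₂ (proj₂ (ceiling-root Δ))))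

    module Colouring (ω cv : Fin N → ℕ) (cv≢0 : ∀ v → cv v ≢ 0) (cv≤ : ∀ v → cv v ≤ suc Δ)
      (isolated : ∀ {x z} → E x z → (∀ w → E x w → w ≡ z) → (∀ w → E z w → w ≡ x) → ω x ≢ ω z) where

      module A = Assembly E E? E-sym E-irr D {{D≢0}} D≥ Δ degree≤ (proj₁ (proj₂ (ceiling-root Δ)))
        (proj₂ (proj₂ (ceiling-root Δ))) ω cv cv≢0 cv≤ isolated

      proper : IsProperEdgeColouring G k A.colour
      proper = (λ u v _ → A.colour-sym u v) ,
        (λ u v e → n≢0⇒n>0 (A.colour≢0 e) , ≤-pred (subst (A.colour u v <_) A.off-4 (A.colour-bound u v))) ,
        (λ u v w e f v≢w → A.colour-proper e f v≢w)

      distinct : ∀ u v → E u v → ω u + dsum G A.colour u ≢ ω v + dsum G A.colour v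
      distinct u v e q = A.distinguished e (trans (sym (total u)) (trans q (total v)))
        where
        total : ∀ v → ω v + dsum G A.colour v ≡ A.total v
        total v = cong (ω v +_) (dsum-sum A.colour A.colour-off v)

    total-bound : χ''Σ≤Bound G Δ
    total-bound = k , below , cv , C.A.colour , (C.proper ,
        (λ v → n≢0⇒n>0 (cv≢0 v) , ≤-trans (cv≤ v) (≤-trans (≤-reflexive (+-comm 1 Δ)) (+-monoʳ-≤ Δ (≤-trans (m≤n+m 1 47) (m≤n+m 48 (92 * D)))))) ,
        (λ u v → cv-proper) , (λ u v → C.A.colour-vertex)) , C.distinct
      where
      V = vertex-colouring E E? E-sym E-irr Δ degree≤
      cv = proj₁ V
      cv≢0 = proj₁ (proj₂ V)
      cv≤ = proj₁ (proj₂ (proj₂ V))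
      cv-proper : ∀ {u v} → E u v → cv u ≢ cv v
      cv-proper = proj₂ (proj₂ (proj₂ V))
      module C = Colouring cv cv cv≢0 cv≤ (λ e _ _ → cv-proper e)

    edge-bound : NoIsolatedEdges G → χ'Σ≤Bound G Δ
    edge-bound noIso = k , below , C.A.colour , C.proper , C.distinct
      where
      one : ∀ {x z} → E x z → (∀ w → E x w → w ≡ z) → degree G x ≡ 1
      one {x} {z} e h = trans (degree-cnt x) (trans (cnt-remove (E? x) z e)
        (cong suc (cnt-none (λ w → E? x w ×-dec ¬? (w Fin.≟ z)) (λ w (f , w≢z) → w≢z (h w f)))))
      -- All vertices get the colour 1, which no edge then uses, and contribute 0 to the sums. The
      -- condition on isolated edges holds because both ends of such an edge would have degree 1.
      module C = Colouring (λ _ → 0) (λ _ → 1) (λ _ ()) (λ _ → s≤s z≤n)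
        (λ {x} {z} e h h′ _ → noIso x z e (one e h , one (E-sym e) h′))

theorem3 : ∃[ Δ₂ ] ((G : Graph) → maxDegree G ≥ Δ₂ →
    χ''Σ≤Bound G (maxDegree G) × (NoIsolatedEdges G → χ'Σ≤Bound G (maxDegree G)))
-- This makes the rounded-up square root of Δ at least 240.
theorem3 = 240 * 240 , λ G Δ≥ → OnGraph.Bound.total-bound G Δ≥ , OnGraph.Bound.edge-bound G Δ≥
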